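{- For every interval $[a,b]\subset[0,1]$, as $X\to\infty$, $$\#\{(T_{p,q},\alpha)\in\Omega_1(X)\mid \theta(\alpha)\in[a,b]\}=\frac{(b-a)}{4\zeta(2)}X^4+O(X^3\log X).$$
   Context: For coprime positive integers $p,q$, $T_{p,q}$ denotes the $(p,q)$-torus knot, with Alexander polynomial $\Delta_{p,q}(t)=\frac{(t^{pq}-1)(t-1)}{(t^p-1)(t^q-1)}$, and height $\max\{p,q\}$. The pair $(p,q)$ is identified with $T_{p,q}$ (so pairs are ordered). For $X>0$, $\Omega_1(X)$ is the set of all pairs $(T_{p,q},\alpha)$ where $p,q$ are coprime positive integers with $\max\{p,q\}\le X$ and $\alpha\in\mathbb{C}$ is a root of $\Delta_{p,q}(t)$. Let $\mathbb{T}=\{z\in\mathbb{C}: |z|=1\}$ and write each $z\in\mathbb{T}$ as $z=e^{2\pi i\theta(z)}$ with $\theta(z)\in[0,1)$; all roots of $\Delta_{p,q}(t)$ lie on $\mathbb{T}$. Here $\zeta(2)=\sum_{n\ge1}n^{ -2}=\pi^2/6$, and $f(X)=g(X)+O(h(X))$ has its usual meaning: $|f(X)-g(X)|\le C\,h(X)$ for some constant $C$ and all sufficiently large $X$. -}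

module Defs where

open import Level using (Level; _⊔_) renaming (suc to lsuc)
open import Algebra.Bundles using (CommutativeRing; Semiring)
open import Algebra.Bundles.Raw using (RawRing)
open import Algebra.Core using (Op₁)
import Algebra.Definitions.RawSemiring as RawSemiringDefinitions
open import Data.Bool.Base using (if_then_else_)
open import Data.Fin.Base using (Fin; toℕ)
open import Data.Integer.Base as ℤ using (ℤ; 0ℤ; 1ℤ; -1ℤ; +_; -[1+_])
open import Data.List.Base using (List; []; _∷_; [_]; _++_; map; replicate)
open import Data.Nat.Base as ℕ using (ℕ; zero; suc; _!)
open import Data.Nat.Coprimality using (Coprime)
open import Data.Product.Base using (Σ; ∃; _×_; _,_; proj₁; proj₂)
open import Data.Product.Relation.Binary.Pointwise.NonDependent using (×-setoid)
open import Function.Base using (_∘_)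
open import Function.Bundles using (Inverse)
open import Relation.Binary.Bundles using (Setoid)
open import Relation.Binary.Core using (Rel)
import Relation.Binary.Construct.On as On
import Relation.Binary.Construct.StrictToNonStrict as StrictToNonStrict
open import Relation.Binary.PropositionalEquality as ≡ using (_≡_)
open import Relation.Binary.Structures using (IsStrictTotalOrder)
open import Relation.Nullary.Decidable.Core using (does)
open import Relation.Nullary.Negation.Core using (¬_)

------------------------------------------------------------------------
-- Integer polynomials, as coefficient lists with the constant term first

Poly : Set
Poly = List ℤ

coeff : Poly → ℕ → ℤ
coeff []      _       = 0ℤ
coeff (c ∷ _) zero    = c
coeff (_ ∷ f) (suc n) = coeff f n

infix 4 _≋_
infixl 6 _+ₚ_
infixl 7 _*ₚ_

-- Coefficientwise, because a list may carry trailing zeros.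
_≋_ : Rel Poly _
f ≋ g = ∀ n → coeff f n ≡ coeff g n

_+ₚ_ : Poly → Poly → Poly
[]      +ₚ g       = g
(c ∷ f) +ₚ []      = c ∷ f
(c ∷ f) +ₚ (d ∷ g) = (c ℤ.+ d) ∷ (f +ₚ g)

_*ₚ_ : Poly → Poly → Poly
[]      *ₚ g = []
(c ∷ f) *ₚ g = map (c ℤ.*_) g +ₚ (0ℤ ∷ (f *ₚ g))

t^_−1 : ℕ → Poly
t^ n −1 = (replicate n 0ℤ ++ [ 1ℤ ]) +ₚ [ -1ℤ ]

-- Δ = (t^(pq) - 1)(t - 1) / ((t^p - 1)(t^q - 1)).  For p, q > 0 the
-- denominator is monic, so the quotient Δ is determined up to _≋_.
IsAlexander : ℕ → ℕ → Poly → Set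
IsAlexander p q Δ =
  Δ *ₚ ((t^ p −1) *ₚ (t^ q −1)) ≋ (t^ (p ℕ.* q) −1) *ₚ (t^ 1 −1)

------------------------------------------------------------------------
-- The real numbers

-- An Archimedean, Cauchy complete, totally ordered field.  Classically ℝ
-- is the only one up to isomorphism.  Comparison is decidable, as for the
-- classical reals; 0# ⁻¹ is an unspecified value.
record RealField c ℓ₁ ℓ₂ : Set (lsuc (c ⊔ ℓ₁ ⊔ ℓ₂)) where
  infix 4 _<_
  infix 9 _⁻¹
  field
    commutativeRing : CommutativeRing c ℓ₁

  open CommutativeRing commutativeRing public
  open RawSemiringDefinitions (Semiring.rawSemiring semiring) public
    using (_^_; sum) renaming (_×_ to _·_)

  field
    _<_                : Rel Carrier ℓ₂
    isStrictTotalOrder : IsStrictTotalOrder _≈_ _<_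
    +-monoˡ-<          : ∀ {x y} z → x < y → x + z < y + z
    *-pos              : ∀ {x y} → 0# < x → 0# < y → 0# < x * y
    _⁻¹                : Op₁ Carrier
    ⁻¹-cong            : ∀ {x y} → x ≈ y → x ⁻¹ ≈ y ⁻¹
    ⁻¹-inverseʳ        : ∀ {x} → x ≉ 0# → x * x ⁻¹ ≈ 1#
    0≉1                : 0# ≉ 1#

  open IsStrictTotalOrder isStrictTotalOrder public using (compare; _<?_)
  open StrictToNonStrict _≈_ _<_ public using (_≤_)

  ∣_∣ : Op₁ Carrier
  ∣ x ∣ = if does (x <? 0#) then - x else x

  ι : ℕ → Carrier
  ι n = n · 1#

  IsCauchy : (ℕ → Carrier) → Set (c ⊔ ℓ₂)
  IsCauchy s = ∀ ε → 0# < ε →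
    ∃ λ N → ∀ m n → N ℕ.≤ m → N ℕ.≤ n → ∣ s m - s n ∣ < ε

  infix 4 _⟶_
  _⟶_ : (ℕ → Carrier) → Carrier → Set (c ⊔ ℓ₂)
  s ⟶ l = ∀ ε → 0# < ε → ∃ λ N → ∀ n → N ℕ.≤ n → ∣ s n - l ∣ < ε

  field
    archimedean : ∀ x → ∃ λ n → x < ι n
    complete    : ∀ s → IsCauchy s → ∃ λ l → s ⟶ l

module Analysis {c ℓ₁ ℓ₂ : Level} (ℝ : RealField c ℓ₁ ℓ₂) where

  open RealField ℝ public

  partialSums : (ℕ → Carrier) → ℕ → Carrier
  partialSums f N = sum {N} (f ∘ toℕ)

  IsExp : Rel Carrier _
  IsExp x y = partialSums (λ n → (ι (n !)) ⁻¹ * x ^ n) ⟶ y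

  IsLog : Rel Carrier _
  IsLog x y = IsExp y x

  IsZeta2 : Carrier → Set _
  IsZeta2 z = partialSums (λ n → (ι (suc n) ^ 2) ⁻¹) ⟶ z

  ----------------------------------------------------------------------
  -- The complex numbers, as pairs (re , im)

  ℂ-setoid : Setoid c ℓ₁
  ℂ-setoid = ×-setoid setoid setoid

  open Setoid ℂ-setoid public using () renaming (Carrier to ℂ; _≈_ to _≈ℂ_)

  ℂ-rawRing : RawRing c ℓ₁
  ℂ-rawRing = record
    { Carrier = ℂ
    ; _≈_     = _≈ℂ_
    ; _+_     = λ (a , b) (a′ , b′) → (a + a′ , b + b′)
    ; _*_     = λ (a , b) (a′ , b′) → (a * a′ - b * b′ , a * b′ + b * a′)
    ; -_      = λ (a , b) → (- a , - b)
    ; 0#      = 0# , 0#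
    ; 1#      = 1# , 0#
    }

  open RawRing ℂ-rawRing public using () renaming
    (_+_ to _+ℂ_; _*_ to _*ℂ_; -_ to -ℂ_; 0# to 0ℂ; 1# to 1ℂ)
  open RawSemiringDefinitions (RawRing.rawSemiring ℂ-rawRing) public using ()
    renaming (_^_ to _^ℂ_; sum to sumℂ; _×_ to _·ℂ_)

  ofℝ : Carrier → ℂ
  ofℝ x = x , 0#

  imaginary : Carrier → ℂ
  imaginary y = 0# , y

  partialSumsℂ : (ℕ → ℂ) → ℕ → ℂ
  partialSumsℂ f N = sumℂ {N} (f ∘ toℕ)

  infix 4 _⟶ℂ_
  _⟶ℂ_ : (ℕ → ℂ) → ℂ → Set _
  s ⟶ℂ (a , b) = ((proj₁ ∘ s) ⟶ a) × ((proj₂ ∘ s) ⟶ b)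

  IsExpℂ : Rel ℂ _
  IsExpℂ z w = partialSumsℂ (λ n → ofℝ ((ι (n !)) ⁻¹) *ℂ z ^ℂ n) ⟶ℂ w

  -- π is the least positive real y with e^(iy) = -1.
  IsPi : Carrier → Set _
  IsPi π = 0# < π
         × IsExpℂ (imaginary π) (-ℂ 1ℂ)
         × (∀ y → 0# < y → y < π → ¬ IsExpℂ (imaginary y) (-ℂ 1ℂ))

  -- IsTheta π z θ says that θ = θ(z).
  IsTheta : Carrier → ℂ → Carrier → Set _
  IsTheta π z θ = 0# ≤ θ × θ < 1# × IsExpℂ (imaginary (ι 2 * π * θ)) z

  ----------------------------------------------------------------------
  -- Roots of the Alexander polynomials of torus knots

  fromℤ : ℤ → ℂ
  fromℤ (+ n)    = n ·ℂ 1ℂ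
  fromℤ -[1+ n ] = -ℂ (suc n ·ℂ 1ℂ)

  eval : Poly → ℂ → ℂ
  eval []      z = 0ℂ
  eval (a ∷ f) z = fromℤ a +ℂ z *ℂ eval f z

  IsAlexanderRoot : ℕ → ℕ → ℂ → Set _
  IsAlexanderRoot p q α = ∃ λ Δ → IsAlexander p q Δ × eval Δ α ≈ℂ 0ℂ

  record Ω₁ (X : Carrier) : Set (c ⊔ ℓ₁ ⊔ ℓ₂) where
    field
      p q     : ℕ
      p>0     : 0 ℕ.< p
      q>0     : 0 ℕ.< q
      coprime : Coprime p q
      height≤ : ι (p ℕ.⊔ q) ≤ X
      α       : ℂ
      isRoot  : IsAlexanderRoot p q α

  -- Elements are compared by the data (p , q , α) only, so each root is
  -- counted once.
  Ω₁-setoid : Carrier → Setoid _ _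
  Ω₁-setoid X =
    On.setoid (×-setoid (≡.setoid ℕ) (×-setoid (≡.setoid ℕ) ℂ-setoid))
              (λ (x : Ω₁ X) → Ω₁.p x , Ω₁.q x , Ω₁.α x)

  -- { (T_{p,q} , α) ∈ Ω₁(X) ∣ θ(α) ∈ [a , b] }
  Ω₁-between : (π X a b : Carrier) → Setoid _ _
  Ω₁-between π X a b = On.setoid (Ω₁-setoid X)
    (proj₁ {B = λ x → ∃ λ θ → IsTheta π (Ω₁.α x) θ × a ≤ θ × θ ≤ b})

HasCardinality : ∀ {a ℓ} → Setoid a ℓ → ℕ → Set _
HasCardinality S N = Inverse (≡.setoid (Fin N)) S

{-# OPTIONS --safe #-}

-- Writing α = e^(2πiθ), the roots of Δ_{p,q} are the α with α^(pq) = 1, α^p ≠ 1 and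
-- α^q ≠ 1: if α^p = 1 then Δ (t^q - 1)/(t - 1) = (t^(pq) - 1)/(t^p - 1) takes the value
-- q ≠ 0 at α.  So θ = k/(pq) with p ∤ k and q ∤ k, and (b - a)pq + O(p + q) of these lie
-- in [a , b].  It remains to estimate F(n) = Σ pq over coprime p , q ≤ n.  With
-- A_d = Σ_{d ∣ k ≤ n} k and B_d = Σ_{d ∣ k ≤ n} k⁻², Möbius inversion gives F(n) = Σ μ(d) A_d²
-- and 1 = Σ μ(d) B_d, hence
--   4ζ(2) F(n) - n⁴ = Σ_{d ≤ n} μ(d) (ζ(2) (2A_d)² - n⁴ B_d).
-- Each summand is O(n³/d), and Σ_{d ≤ n} 1/d = O(log n).

module Submission where

open import Defs
open import Algebra.Bundles using (CommutativeRing; Semiring)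
import Algebra.Definitions.RawSemiring as RawSemiringDefinitions
import Algebra.Properties.CommutativeSemiring.Exp
import Algebra.Properties.Ring
import Algebra.Properties.Semiring.Mult
import Algebra.Solver.Ring
open import Algebra.Solver.Ring.AlmostCommutativeRing
  using (fromCommutativeRing; _-Raw-AlmostCommutative⟶_)
open import Data.Bool.Base using (true; false; if_then_else_)
open import Data.Fin.Base as Fin using (Fin; toℕ)
open import Data.Integer.Base as ℤ using (ℤ; 0ℤ; 1ℤ; -1ℤ; +_; -[1+_])
import Data.Integer.Properties as ℤ
open import Data.List.Base
  using (List; []; _∷_; [_]; _++_; map; replicate; length; filter; downFrom; cartesianProduct;
    lookup)
open import Data.List.Membership.Propositional using (_∈_)
open import Data.List.Membership.Propositional.Properties
  using (∈-map⁻; ∈-map⁺; ∈-downFrom⁻; ∈-downFrom⁺; ∈-++⁻; ∈-lookup; ∈-filter⁺; ∈-filter⁻;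
    ∈-cartesianProduct⁺; ∈-cartesianProduct⁻)
import Data.List.Properties as List
open import Data.List.Relation.Unary.All as All using (All; []; _∷_)
open import Data.List.Relation.Unary.AllPairs using ([]; _∷_)
open import Data.List.Relation.Unary.Any as Any using (here; there)
import Data.List.Relation.Unary.Any.Properties as Any
open import Data.List.Relation.Unary.Unique.Propositional using (Unique)
import Data.List.Relation.Unary.Unique.Propositional.Properties as Unique
open import Data.Maybe.Base using (Maybe; just; nothing)
open import Data.Nat.Base as ℕ using (ℕ; zero; suc; _!; 2+; NonTrivial)
open import Data.Nat.Coprimality
  using (Coprime; coprime-Bézout; coprime?; coprime-divisor; prime⇒coprime; coprime⇒gcd≡1;
    gcd≡1⇒coprime)
open import Data.Nat.Divisibility
  using (_∣_; _∤_; _∣?_; divides; m∣m*n; ∣m+n∣m⇒∣n; ∣⇒≤; ∣1⇒≡1; 1∣_; ∣-trans; ∣-refl; *-cancelˡ-∣;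
    *-monoʳ-∣; 0∣⇒≡0)
open import Data.Nat.Divisibility.Core using (hasNonTrivialDivisor)
open import Data.Nat.GCD using (module Bézout; gcd; gcd[m,n]∣m; gcd[m,n]∣n; gcd-greatest)
open import Data.Nat.Primality
  using (Prime; prime?; _Rough_; 0-rough; 1-rough; 2-rough; rough-1; ∤⇒rough-suc; rough∧∣⇒rough;
    rough∧∣⇒prime; euclidsLemma; prime⇒nonTrivial; prime⇒nonZero)
import Data.Nat.Properties as ℕ
open import Data.Product.Base using (∃; _×_; _,_; proj₁; proj₂; ∃₂)
open import Data.Sum.Base using (_⊎_; inj₁; inj₂; [_,_]′)
open import Function.Base using (_∘_)
open import Level using (Level; _⊔_)
open import Relation.Binary.Bundles using (StrictPartialOrder; Setoid)
import Relation.Binary.Construct.StrictToNonStrict as StrictToNonStrict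
open import Relation.Binary.Definitions using (tri<; tri≈; tri>)
open import Relation.Binary.PropositionalEquality as ≡ using (_≡_)
import Relation.Binary.Reasoning.Setoid as SetoidReasoning
import Relation.Binary.Reasoning.StrictPartialOrder
open import Relation.Binary.Structures using (IsStrictTotalOrder; IsDecTotalOrder)
open import Relation.Nullary using (Dec; yes; no; ¬_; does)
open import Relation.Nullary.Decidable using (_×-dec_; ¬?)
open import Relation.Nullary.Negation using (contradiction)
open import Relation.Unary using (Decidable)

-- Expanding 1 = Σ μ(d) B_d instead of 1/ζ(2) = Σ μ(d)/d² keeps every Möbius sum finite. With x =
-- n/d, 2 A_d is close to d x² and B_d is close to ζ(2)/d², so both products in the d-th summand
-- have the main term ζ(2) n⁴/d². It cancels; what remains comes from the rounding of n/d and from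
-- the tail of the series of ζ(2) beyond ⌊n/d⌋. The real numbers are an arbitrary complete
-- Archimedean ordered field, and π is given only as the least positive y with e^(iy) = -1. The
-- description of the roots of unity by fractions must therefore come from the exponential series
-- itself: from its functional equation, and from the minimality of π, which shows that e^(2πix) = 1
-- with x ≥ 0 forces x to be an integer. The logarithm is likewise given only by e^(log X) = X. To
-- compare it with the harmonic sum, n is caught between powers of integers: a power of 2 below n
-- and a power of an integer above e beyond X.

module IntegerImage {c ℓ : Level} (R : CommutativeRing c ℓ) where
  open CommutativeRing R
  open Algebra.Properties.Ring ring
  open Algebra.Properties.Semiring.Mult semiring renaming (_×_ to _·_)
  open SetoidReasoning setoid

  image : ℤ → Carrier
  image (+ n)    = n · 1#
  image -[1+ n ] = - (suc n · 1#)

  image-⊖ : ∀ m n → image (m ℤ.⊖ n) ≈ m · 1# - n · 1#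
  image-⊖ m zero = sym (trans (+-congˡ -0#≈0#) (+-identityʳ _))
  image-⊖ zero (suc n) = sym (+-identityˡ _)
  image-⊖ (suc m) (suc n) = begin
    image (suc m ℤ.⊖ suc n)  ≡⟨ ≡.cong image (ℤ.[1+m]⊖[1+n]≡m⊖n m n) ⟩
    image (m ℤ.⊖ n)  ≈⟨ image-⊖ m n ⟩
    m · 1# - n · 1#  ≈⟨ +-congʳ (+-identityˡ _) ⟨
    0# + m · 1# - n · 1#  ≈⟨ +-congʳ (+-congʳ (-‿inverseʳ 1#)) ⟨
    1# - 1# + m · 1# - n · 1#  ≈⟨ +-congʳ (+-assoc _ _ _) ⟩
    1# + (- 1# + m · 1#) - n · 1#  ≈⟨ +-congʳ (+-congˡ (+-comm _ _)) ⟩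
    1# + (m · 1# - 1#) - n · 1#  ≈⟨ +-congʳ (+-assoc _ _ _) ⟨
    suc m · 1# - 1# - n · 1#  ≈⟨ +-assoc _ _ _ ⟩
    suc m · 1# + (- 1# - n · 1#)  ≈⟨ +-congˡ (-‿+-comm _ _) ⟩
    suc m · 1# - suc n · 1#  ∎

  image-neg : ∀ i → image (ℤ.- i) ≈ - image i
  image-neg (+ zero)  = sym -0#≈0#
  image-neg (+ suc n) = refl
  image-neg -[1+ n ]  = sym (-‿involutive _)

  image-+ : ∀ i j → image (i ℤ.+ j) ≈ image i + image j
  image-+ (+ m)    (+ n)    = ×-homo-+ 1# m n
  image-+ (+ m)    -[1+ n ] = image-⊖ m (suc n)
  image-+ -[1+ m ] (+ n)    = trans (image-⊖ n (suc m)) (+-comm _ _)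
  image-+ -[1+ m ] -[1+ n ] = begin
    - (suc (suc (m ℕ.+ n)) · 1#)  ≡⟨ ≡.cong (λ k → - (k · 1#)) (≡.cong suc (≡.sym (ℕ.+-suc m n))) ⟩
    - ((suc m ℕ.+ suc n) · 1#)  ≈⟨ -‿cong (×-homo-+ 1# (suc m) (suc n)) ⟩
    - (suc m · 1# + suc n · 1#)  ≈⟨ -‿+-comm _ _ ⟨
    - (suc m · 1#) - suc n · 1#  ∎

  image-pos-* : ∀ m j → image (+ m ℤ.* j) ≈ image (+ m) * image j
  image-pos-* m (+ n) = trans (reflexive (≡.cong image (≡.sym (ℤ.pos-* m n)))) (×1-homo-* m n)
  image-pos-* m -[1+ n ] = begin
    image (+ m ℤ.* (ℤ.- (+ suc n)))  ≡⟨ ≡.cong image (≡.sym (ℤ.neg-distribʳ-* (+ m) (+ suc n))) ⟩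
    image (ℤ.- (+ m ℤ.* + suc n))  ≈⟨ image-neg (+ m ℤ.* + suc n) ⟩
    - image (+ m ℤ.* + suc n)  ≈⟨ -‿cong (image-pos-* m (+ suc n)) ⟩
    - (m · 1# * suc n · 1#)  ≈⟨ -‿distribʳ-* _ _ ⟩
    m · 1# * - (suc n · 1#)  ∎

  image-* : ∀ i j → image (i ℤ.* j) ≈ image i * image j
  image-* (+ m) j = image-pos-* m j
  image-* -[1+ m ] j = begin
    image (ℤ.- (+ suc m) ℤ.* j)  ≡⟨ ≡.cong image (≡.sym (ℤ.neg-distribˡ-* (+ suc m) j)) ⟩
    image (ℤ.- (+ suc m ℤ.* j))  ≈⟨ image-neg (+ suc m ℤ.* j) ⟩
    - image (+ suc m ℤ.* j)  ≈⟨ -‿cong (image-pos-* (suc m) j) ⟩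
    - (suc m · 1# * image j)  ≈⟨ -‿distribˡ-* _ _ ⟩
    - (suc m · 1#) * image j  ∎

  -- Gives the ring solver integer constants in any commutative ring. `con (+ n)` means n · 1#,
  -- which for the reals is `ι n` by definition. The unit 1# differs from `ι 1` by a trailing 0#, so
  -- solver calls below either take 1# as a variable or convert it by `ι-1`.
  image-homomorphism : CommutativeRing.rawRing ℤ.+-*-commutativeRing -Raw-AlmostCommutative⟶ fromCommutativeRing R
  image-homomorphism = record
    { ⟦_⟧    = image
    ; +-homo = image-+
    ; *-homo = image-*
    ; -‿homo = image-neg
    ; 0-homo = refl
    ; 1-homo = +-identityʳ 1#
    }

  image-≟ : ∀ i j → Maybe (image i ≈ image j)
  image-≟ i j with i ℤ.≟ j
  ... | yes i≡j = just (reflexive (≡.cong image i≡j))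
  ... | no  _   = nothing

  open Algebra.Solver.Ring (CommutativeRing.rawRing ℤ.+-*-commutativeRing) (fromCommutativeRing R)
    image-homomorphism image-≟ public
    using (solve; con; _:+_; _:*_; _:-_; _:^_; :-_; _:=_)

-- Sums over initial segments and the Cauchy product

module RangeSum {c ℓ : Level} (R : CommutativeRing c ℓ) where
  open CommutativeRing R
  open RawSemiringDefinitions (Semiring.rawSemiring semiring) using (sum)
  open IntegerImage R using (solve; con; _:+_; _:*_; _:-_; _:=_)
  open SetoidReasoning setoid

  -- Opaque, so that unification can recover the summand.
  opaque
    Σ< : ℕ → (ℕ → Carrier) → Carrier
    Σ< n f = sum {n} (f ∘ toℕ)

    Σ<-cong : ∀ n {f g} → (∀ i → i ℕ.< n → f i ≈ g i) → Σ< n f ≈ Σ< n g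
    Σ<-cong zero    f≈g = refl
    Σ<-cong (suc n) f≈g = +-cong (f≈g 0 ℕ.z<s) (Σ<-cong n (λ i i<n → f≈g (suc i) (ℕ.s<s i<n)))

    Σ<-snoc : ∀ n f → Σ< (suc n) f ≈ Σ< n f + f n
    Σ<-snoc zero    f = +-comm _ _
    Σ<-snoc (suc n) f = trans (+-congˡ (Σ<-snoc n (f ∘ suc))) (sym (+-assoc _ _ _))

    Σ<-+ : ∀ n f g → Σ< n (λ i → f i + g i) ≈ Σ< n f + Σ< n g
    Σ<-+ zero    f g = sym (+-identityˡ 0#)
    Σ<-+ (suc n) f g = trans (+-congˡ (Σ<-+ n (f ∘ suc) (g ∘ suc)))
      (solve 4 (λ a b c d → (a :+ b) :+ (c :+ d) := (a :+ c) :+ (b :+ d)) refl _ _ _ _)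

    Σ<-*ˡ : ∀ n x f → x * Σ< n f ≈ Σ< n (λ i → x * f i)
    Σ<-*ˡ zero    x f = zeroʳ x
    Σ<-*ˡ (suc n) x f = trans (distribˡ _ _ _) (+-congˡ (Σ<-*ˡ n x (f ∘ suc)))

    Σ<-empty : ∀ f → Σ< 0 f ≈ 0#
    Σ<-empty f = refl

    Σ<-cons : ∀ n f → Σ< (suc n) f ≈ f 0 + Σ< n (f ∘ suc)
    Σ<-cons n f = refl

    Σ<≡sum : ∀ n f → Σ< n f ≡ sum {n} (f ∘ toℕ)
    Σ<≡sum n f = ≡.refl

    Σ<-- : ∀ n f g → Σ< n f - Σ< n g ≈ Σ< n (λ i → f i - g i)
    Σ<-- zero    f g = -‿inverseʳ 0#
    Σ<-- (suc n) f g = trans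
      (solve 4 (λ a b c d → (a :+ b) :- (c :+ d) := (a :- c) :+ (b :- d)) refl _ _ _ _)
      (+-congˡ (Σ<-- n (f ∘ suc) (g ∘ suc)))

  Σ<-*ʳ : ∀ n x f → Σ< n f * x ≈ Σ< n (λ i → f i * x)
  Σ<-*ʳ n x f = trans (*-comm _ _) (trans (Σ<-*ˡ n x f) (Σ<-cong n (λ _ _ → *-comm _ _)))

  Σ<-tail-suc : ∀ n f x → Σ< (suc n) f - x ≈ (Σ< n f - x) + f n
  Σ<-tail-suc n f x = trans (+-congʳ (Σ<-snoc n f)) (solve 3 (λ s t x → (s :+ t) :- x := (s :- x) :+ t) refl _ _ _)

  convolution : (a b : ℕ → Carrier) → ℕ → Carrier
  convolution a b n = Σ< (suc n) (λ i → a i * b (n ℕ.∸ i))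

  -- Row by row, the sum of a i * b j over the pairs with i + j < n.
  triangle : (a b : ℕ → Carrier) → ℕ → Carrier
  triangle a b n = Σ< n (λ i → a i * Σ< (n ℕ.∸ i) b)

  -- Passing from n to n + 1 lengthens each row by one term, and the added terms form the
  -- antidiagonal i + j = n, which is a convolution. The row i = n was empty before.
  triangle≈Σ-convolution : ∀ a b n → triangle a b n ≈ Σ< n (convolution a b)
  triangle≈Σ-convolution a b zero    = trans (Σ<-empty _) (sym (Σ<-empty _))
  triangle≈Σ-convolution a b (suc n) = begin
    triangle a b (suc n)
      ≈⟨ Σ<-cong (suc n) (λ { i (ℕ.s≤s i≤n) → trans
           (*-congˡ (trans (reflexive (≡.cong (λ k → Σ< k b) (ℕ.+-∸-assoc 1 i≤n))) (Σ<-snoc (n ℕ.∸ i) b)))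
           (distribˡ _ _ _) }) ⟩
    Σ< (suc n) (λ i → a i * Σ< (n ℕ.∸ i) b + a i * b (n ℕ.∸ i))
      ≈⟨ Σ<-+ (suc n) _ _ ⟩
    Σ< (suc n) (λ i → a i * Σ< (n ℕ.∸ i) b) + convolution a b n
      ≈⟨ +-congʳ (Σ<-snoc n _) ⟩
    triangle a b n + a n * Σ< (n ℕ.∸ n) b + convolution a b n
      ≈⟨ +-congʳ (+-congˡ (trans (*-congˡ (trans (reflexive (≡.cong (λ k → Σ< k b) (ℕ.n∸n≡0 n))) (Σ<-empty b))) (zeroʳ _))) ⟩
    triangle a b n + 0# + convolution a b n
      ≈⟨ +-congʳ (trans (+-identityʳ _) (triangle≈Σ-convolution a b n)) ⟩
    Σ< n (convolution a b) + convolution a b n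
      ≈⟨ Σ<-snoc n (convolution a b) ⟨
    Σ< (suc n) (convolution a b)
      ∎

  -- Isolates the part of the square i, j < n outside the triangle. It is the error in the
  -- functional equation of the exponential series cut off at n.
  square-triangle : ∀ a b n → Σ< n a * Σ< n b - triangle a b n ≈ Σ< n (λ i → a i * (Σ< n b - Σ< (n ℕ.∸ i) b))
  square-triangle a b n = begin
    Σ< n a * Σ< n b - triangle a b n  ≈⟨ +-congʳ (Σ<-*ʳ n _ a) ⟩
    Σ< n (λ i → a i * Σ< n b) - triangle a b n  ≈⟨ Σ<-- n _ _ ⟩
    Σ< n (λ i → a i * Σ< n b - a i * Σ< (n ℕ.∸ i) b)  ≈⟨ Σ<-cong n (λ i _ → solve 3 (λ a s t → a :* s :- a :* t := a :* (s :- t)) refl _ _ _) ⟩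
    Σ< n (λ i → a i * (Σ< n b - Σ< (n ℕ.∸ i) b))  ∎

-- The terms of the exponential series

module Exponential {c ℓ : Level} (R : CommutativeRing c ℓ) where
  open CommutativeRing R
  open RawSemiringDefinitions (Semiring.rawSemiring semiring) using (_^_) renaming (_×_ to _·_)
  open RangeSum R
  open IntegerImage R using (solve; con; _:+_; _:*_; _:-_; _:=_)
  open Algebra.Properties.Semiring.Mult semiring using (×-homo-+)
  open SetoidReasoning setoid

  -- κ n stands for 1/n! and ν n for 1/(n + 1). Only their recursions are assumed, so that one
  -- computation serves the real and the complex series.
  module Terms
    (κ ν : ℕ → Carrier)
    (κ-zero : κ 0 ≈ 1#) (κ-suc : ∀ n → (suc n · 1#) * κ (suc n) ≈ κ n)
    (ν-inverse : ∀ n → ν n * (suc n · 1#) ≈ 1#)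
    where

    term : Carrier → ℕ → Carrier
    term x n = κ n * x ^ n

    term-suc : ∀ x n → (suc n · 1#) * term x (suc n) ≈ x * term x n
    term-suc x n = begin
      (suc n · 1#) * (κ (suc n) * (x * x ^ n))  ≈⟨ solve 4 (λ m k x p → m :* (k :* (x :* p)) := x :* ((m :* k) :* p)) refl _ _ _ _ ⟩
      x * ((suc n · 1#) * κ (suc n) * x ^ n)  ≈⟨ *-congˡ (*-congʳ (κ-suc n)) ⟩
      x * (κ n * x ^ n)  ∎

    suc-cancel : ∀ n {x y} → (suc n · 1#) * x ≈ (suc n · 1#) * y → x ≈ y
    suc-cancel n {x} {y} eq = begin
      x  ≈⟨ unit x ⟨
      ν n * ((suc n · 1#) * x)  ≈⟨ *-congˡ eq ⟩
      ν n * ((suc n · 1#) * y)  ≈⟨ unit y ⟩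
      y  ∎
      where
      unit : ∀ z → ν n * ((suc n · 1#) * z) ≈ z
      unit z = trans (sym (*-assoc _ _ _)) (trans (*-congʳ (ν-inverse n)) (*-identityˡ z))

    -- Both sides satisfy the recursion (n + 1) u (n + 1) = (x + y) u n.
    term-+ : ∀ x y n → term (x + y) n ≈ convolution (term x) (term y) n
    term-+ x y zero = begin
      κ 0 * 1#  ≈⟨ *-congʳ κ-zero ⟩
      1# * 1#  ≈⟨ *-identityˡ 1# ⟩
      1#  ≈⟨ *-identityˡ 1# ⟨
      1# * 1#  ≈⟨ *-cong (unit) (unit) ⟨
      (κ 0 * 1#) * (κ 0 * 1#)  ≈⟨ trans (Σ<-snoc 0 _) (trans (+-congʳ (Σ<-empty _)) (+-identityˡ _)) ⟨
      convolution (term x) (term y) 0  ∎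
      where
      unit : κ 0 * 1# ≈ 1#
      unit = trans (*-identityʳ _) κ-zero
    term-+ x y (suc n) = suc-cancel n (begin
      (suc n · 1#) * term (x + y) (suc n)
        ≈⟨ term-suc (x + y) n ⟩
      (x + y) * term (x + y) n
        ≈⟨ *-congˡ (term-+ x y n) ⟩
      (x + y) * convolution (term x) (term y) n
        ≈⟨ trans (distribʳ _ _ _) (+-cong (Σ<-*ˡ (suc n) x _) (Σ<-*ˡ (suc n) y _)) ⟩
      Σ< (suc n) (λ i → x * (term x i * term y (n ℕ.∸ i))) + Σ< (suc n) (λ i → y * (term x i * term y (n ℕ.∸ i)))
        ≈⟨ +-cong (Σ<-cong (suc n) (λ i _ → trans (sym (*-assoc _ _ _)) (trans (*-congʳ (sym (term-suc x i))) (*-assoc _ _ _))))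
                  (Σ<-cong (suc n) (λ { i (ℕ.s≤s i≤n) → right i i≤n })) ⟩
      Σ< (suc n) (λ i → (suc i · 1#) * (term x (suc i) * term y (n ℕ.∸ i))) + Σ< (suc n) (λ i → ((suc n ℕ.∸ i) · 1#) * (term x i * term y (suc n ℕ.∸ i)))
        -- Each sum receives the term of weight 0 that it lacks, i = 0 in the first and i = n + 1 in
        -- the second. They then share the range i ≤ n + 1, and the weights i and n + 1 - i add up
        -- to n + 1.
        ≈⟨ +-cong (+-identityˡ _) (+-identityʳ _) ⟨
      (0# + Σ< (suc n) (λ i → (suc i · 1#) * (term x (suc i) * term y (n ℕ.∸ i)))) + (Σ< (suc n) (λ i → ((suc n ℕ.∸ i) · 1#) * (term x i * term y (suc n ℕ.∸ i))) + 0#)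
        ≈⟨ +-cong (trans (Σ<-cons (suc n) _) (+-congʳ (zeroˡ _))) (+-congˡ (trans (*-congʳ (reflexive (≡.cong (_· 1#) (ℕ.n∸n≡0 (suc n))))) (zeroˡ _))) ⟨
      Σ< (2 ℕ.+ n) (λ i → (i · 1#) * (term x i * term y (suc n ℕ.∸ i))) + (Σ< (suc n) (λ i → ((suc n ℕ.∸ i) · 1#) * (term x i * term y (suc n ℕ.∸ i))) + (((suc n ℕ.∸ suc n) · 1#) * (term x (suc n) * term y (suc n ℕ.∸ suc n))))
        ≈⟨ +-congˡ (Σ<-snoc (suc n) (λ i → ((suc n ℕ.∸ i) · 1#) * (term x i * term y (suc n ℕ.∸ i)))) ⟨
      Σ< (2 ℕ.+ n) (λ i → (i · 1#) * (term x i * term y (suc n ℕ.∸ i))) + Σ< (2 ℕ.+ n) (λ i → ((suc n ℕ.∸ i) · 1#) * (term x i * term y (suc n ℕ.∸ i)))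
        ≈⟨ Σ<-+ (2 ℕ.+ n) _ _ ⟨
      Σ< (2 ℕ.+ n) (λ i → (i · 1#) * (term x i * term y (suc n ℕ.∸ i)) + ((suc n ℕ.∸ i) · 1#) * (term x i * term y (suc n ℕ.∸ i)))
        ≈⟨ Σ<-cong (2 ℕ.+ n) (λ { i (ℕ.s≤s i≤1+n) → trans (sym (distribʳ _ _ _)) (*-congʳ (weights i i≤1+n)) }) ⟩
      Σ< (2 ℕ.+ n) (λ i → (suc n · 1#) * (term x i * term y (suc n ℕ.∸ i)))
        ≈⟨ Σ<-*ˡ (2 ℕ.+ n) _ _ ⟨
      (suc n · 1#) * convolution (term x) (term y) (suc n)
        ∎)
      where
      right : ∀ i → i ℕ.≤ n → y * (term x i * term y (n ℕ.∸ i)) ≈ ((suc n ℕ.∸ i) · 1#) * (term x i * term y (suc n ℕ.∸ i))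
      right i i≤n rewrite ℕ.+-∸-assoc 1 i≤n = begin
        y * (term x i * term y (n ℕ.∸ i))  ≈⟨ solve 3 (λ y t u → y :* (t :* u) := t :* (y :* u)) refl _ _ _ ⟩
        term x i * (y * term y (n ℕ.∸ i))  ≈⟨ *-congˡ (term-suc y (n ℕ.∸ i)) ⟨
        term x i * ((suc (n ℕ.∸ i) · 1#) * term y (suc (n ℕ.∸ i)))  ≈⟨ solve 3 (λ m t u → t :* (m :* u) := m :* (t :* u)) refl _ _ _ ⟩
        (suc (n ℕ.∸ i) · 1#) * (term x i * term y (suc (n ℕ.∸ i)))  ∎

      weights : ∀ i → i ℕ.≤ suc n → i · 1# + (suc n ℕ.∸ i) · 1# ≈ suc n · 1#
      weights i i≤1+n = trans (sym (×-homo-+ 1# i (suc n ℕ.∸ i))) (reflexive (≡.cong (_· 1#) (ℕ.m+[n∸m]≡n i≤1+n)))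

    product-error : ∀ x y n →
      Σ< n (term x) * Σ< n (term y) - Σ< n (term (x + y)) ≈ Σ< n (λ i → term x i * (Σ< n (term y) - Σ< (n ℕ.∸ i) (term y)))
    product-error x y n = trans
      (+-congˡ (-‿cong (trans (Σ<-cong n (λ i _ → term-+ x y i)) (sym (triangle≈Σ-convolution (term x) (term y) n)))))
      (square-triangle (term x) (term y) n)

-- Square roots and powers of 1

module SquareRootsOfOne {c ℓ : Level} (R : CommutativeRing c ℓ) where
  open CommutativeRing R
  open RawSemiringDefinitions (Semiring.rawSemiring semiring) using (_^_)
  open IntegerImage R using (solve; con; _:+_; _:*_; _:-_; :-_; _:=_)

  x*x≈1⇒[x-1][x+1]≈0 : ∀ {x} → x * x ≈ 1# → (x - 1#) * (x + 1#) ≈ 0#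
  x*x≈1⇒[x-1][x+1]≈0 {x} xx≈1 = trans (solve 2 (λ x o → (x :- o) :* (x :+ o) := x :* x :- o :* o) refl x 1#)
    (trans (+-cong xx≈1 (-‿cong (*-identityˡ 1#))) (-‿inverseʳ 1#))

  x+1≈0⇒x≈-1 : ∀ {x} → x + 1# ≈ 0# → x ≈ - 1#
  x+1≈0⇒x≈-1 {x} eq = trans (solve 2 (λ x o → x := (x :+ o) :- o) refl x 1#) (trans (+-congʳ eq) (+-identityˡ _))

  x-1≈0⇒x≈1 : ∀ {x} → x - 1# ≈ 0# → x ≈ 1#
  x-1≈0⇒x≈1 {x} eq = trans (solve 2 (λ x o → x := (x :- o) :+ o) refl x 1#) (trans (+-congʳ eq) (+-identityˡ _))

  x≈1⇒x-1≈0 : ∀ {x} → x ≈ 1# → x - 1# ≈ 0#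
  x≈1⇒x-1≈0 x≈1 = trans (+-congʳ x≈1) (-‿inverseʳ 1#)

  [-1]*[-1]≈1 : - 1# * - 1# ≈ 1#
  [-1]*[-1]≈1 = trans (solve 1 (λ o → :- o :* :- o := o :* o) refl 1#) (*-identityˡ 1#)

  1^n≈1 : ∀ n → 1# ^ n ≈ 1#
  1^n≈1 zero    = refl
  1^n≈1 (suc n) = trans (*-identityˡ _) (1^n≈1 n)

-- The ring of integer polynomials

module PolynomialRing where
  open IntegerImage ℤ.+-*-commutativeRing using (solve; con; _:+_; _:*_; _:-_; :-_; _:=_)
  open ≡.≡-Reasoning

  -ₚ_ : Poly → Poly
  -ₚ f = map ℤ.-_ f

  coeff-+ : ∀ f g n → coeff (f +ₚ g) n ≡ coeff f n ℤ.+ coeff g n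
  coeff-+ []      g       n       = ≡.sym (ℤ.+-identityˡ _)
  coeff-+ (c ∷ f) []      n       = ≡.sym (ℤ.+-identityʳ _)
  coeff-+ (c ∷ f) (d ∷ g) zero    = ≡.refl
  coeff-+ (c ∷ f) (d ∷ g) (suc n) = coeff-+ f g n

  coeff-scale : ∀ c f n → coeff (map (c ℤ.*_) f) n ≡ c ℤ.* coeff f n
  coeff-scale c []      n       = ≡.sym (ℤ.*-zeroʳ c)
  coeff-scale c (d ∷ f) zero    = ≡.refl
  coeff-scale c (d ∷ f) (suc n) = coeff-scale c f n

  coeff-neg : ∀ f n → coeff (-ₚ f) n ≡ ℤ.- coeff f n
  coeff-neg []      n       = ≡.refl
  coeff-neg (d ∷ f) zero    = ≡.refl
  coeff-neg (d ∷ f) (suc n) = coeff-neg f n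

  coeff-* : ∀ c f g n → coeff ((c ∷ f) *ₚ g) n ≡ c ℤ.* coeff g n ℤ.+ coeff (0ℤ ∷ (f *ₚ g)) n
  coeff-* c f g n = ≡.trans (coeff-+ (map (c ℤ.*_) g) (0ℤ ∷ (f *ₚ g)) n) (≡.cong (ℤ._+ _) (coeff-scale c g n))

  ∷-cong : ∀ {c d f g} → c ≡ d → f ≋ g → (c ∷ f) ≋ (d ∷ g)
  ∷-cong c≡d f≋g zero    = c≡d
  ∷-cong c≡d f≋g (suc n) = f≋g n

  -- A list of zeros also satisfies f ≋ []. This settles the cases of `*ₚ-congʳ` in which one list
  -- ends before the other.
  ≋-zero-* : ∀ f g → f ≋ [] → f *ₚ g ≋ []
  ≋-zero-* []      g f≋0 n = ≡.refl
  ≋-zero-* (c ∷ f) g f≋0 n = begin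
    coeff ((c ∷ f) *ₚ g) n  ≡⟨ coeff-* c f g n ⟩
    c ℤ.* coeff g n ℤ.+ coeff (0ℤ ∷ (f *ₚ g)) n  ≡⟨ ≡.cong₂ (λ u v → u ℤ.* coeff g n ℤ.+ v) (f≋0 0) (shifted n) ⟩
    0ℤ ℤ.* coeff g n ℤ.+ 0ℤ  ≡⟨ solve 1 (λ x → con 0ℤ :* x :+ con 0ℤ := con 0ℤ) ≡.refl (coeff g n) ⟩
    0ℤ  ∎
    where
    shifted : ∀ n → coeff (0ℤ ∷ (f *ₚ g)) n ≡ 0ℤ
    shifted zero    = ≡.refl
    shifted (suc n) = ≋-zero-* f g (f≋0 ∘ suc) n

  *ₚ-congˡ : ∀ f {g h} → g ≋ h → f *ₚ g ≋ f *ₚ h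
  *ₚ-congˡ []      g≋h n = ≡.refl
  *ₚ-congˡ (c ∷ f) {g} {h} g≋h n = begin
    coeff ((c ∷ f) *ₚ g) n  ≡⟨ coeff-* c f g n ⟩
    c ℤ.* coeff g n ℤ.+ coeff (0ℤ ∷ (f *ₚ g)) n  ≡⟨ ≡.cong₂ (λ u v → c ℤ.* u ℤ.+ v) (g≋h n) (∷-cong ≡.refl (*ₚ-congˡ f g≋h) n) ⟩
    c ℤ.* coeff h n ℤ.+ coeff (0ℤ ∷ (f *ₚ h)) n  ≡⟨ coeff-* c f h n ⟨
    coeff ((c ∷ f) *ₚ h) n  ∎

  *ₚ-congʳ : ∀ f f′ g → f ≋ f′ → f *ₚ g ≋ f′ *ₚ g
  *ₚ-congʳ []      f′       g f≋f′ n = ≡.sym (≋-zero-* f′ g (≡.sym ∘ f≋f′) n)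
  *ₚ-congʳ (c ∷ f) []       g f≋f′ n = ≋-zero-* (c ∷ f) g f≋f′ n
  *ₚ-congʳ (c ∷ f) (d ∷ f′) g f≋f′ n = begin
    coeff ((c ∷ f) *ₚ g) n  ≡⟨ coeff-* c f g n ⟩
    c ℤ.* coeff g n ℤ.+ coeff (0ℤ ∷ (f *ₚ g)) n  ≡⟨ ≡.cong₂ (λ u v → u ℤ.* coeff g n ℤ.+ v) (f≋f′ 0) (∷-cong ≡.refl (*ₚ-congʳ f f′ g (f≋f′ ∘ suc)) n) ⟩
    d ℤ.* coeff g n ℤ.+ coeff (0ℤ ∷ (f′ *ₚ g)) n  ≡⟨ coeff-* d f′ g n ⟨
    coeff ((d ∷ f′) *ₚ g) n  ∎

  coeff-∷-+ : ∀ f g n → coeff (0ℤ ∷ (f +ₚ g)) n ≡ coeff (0ℤ ∷ f) n ℤ.+ coeff (0ℤ ∷ g) n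
  coeff-∷-+ f g zero    = ≡.refl
  coeff-∷-+ f g (suc n) = coeff-+ f g n

  *ₚ-distribˡ : ∀ f g h → f *ₚ (g +ₚ h) ≋ f *ₚ g +ₚ f *ₚ h
  *ₚ-distribˡ []      g h n = ≡.refl
  *ₚ-distribˡ (c ∷ f) g h n = begin
    coeff ((c ∷ f) *ₚ (g +ₚ h)) n
      ≡⟨ coeff-* c f (g +ₚ h) n ⟩
    c ℤ.* coeff (g +ₚ h) n ℤ.+ coeff (0ℤ ∷ (f *ₚ (g +ₚ h))) n
      ≡⟨ ≡.cong₂ (λ u v → c ℤ.* u ℤ.+ v) (coeff-+ g h n) (≡.trans (∷-cong ≡.refl (*ₚ-distribˡ f g h) n) (coeff-∷-+ (f *ₚ g) (f *ₚ h) n)) ⟩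
    c ℤ.* (coeff g n ℤ.+ coeff h n) ℤ.+ (coeff (0ℤ ∷ (f *ₚ g)) n ℤ.+ coeff (0ℤ ∷ (f *ₚ h)) n)
      ≡⟨ solve 5 (λ c x y u v → c :* (x :+ y) :+ (u :+ v) := (c :* x :+ u) :+ (c :* y :+ v)) ≡.refl c _ _ _ _ ⟩
    (c ℤ.* coeff g n ℤ.+ coeff (0ℤ ∷ (f *ₚ g)) n) ℤ.+ (c ℤ.* coeff h n ℤ.+ coeff (0ℤ ∷ (f *ₚ h)) n)
      ≡⟨ ≡.cong₂ ℤ._+_ (coeff-* c f g n) (coeff-* c f h n) ⟨
    coeff ((c ∷ f) *ₚ g) n ℤ.+ coeff ((c ∷ f) *ₚ h) n
      ≡⟨ coeff-+ ((c ∷ f) *ₚ g) ((c ∷ f) *ₚ h) n ⟨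
    coeff ((c ∷ f) *ₚ g +ₚ (c ∷ f) *ₚ h) n
      ∎

  -- Multiplication recurses on its left factor; this is the matching recursion on the right factor,
  -- which makes commutativity an induction.
  coeff-*-∷ : ∀ f d g n → coeff (f *ₚ (d ∷ g)) n ≡ d ℤ.* coeff f n ℤ.+ coeff (0ℤ ∷ (f *ₚ g)) n
  coeff-*-∷ []      d g zero    = ≡.sym (≡.trans (ℤ.+-identityʳ _) (ℤ.*-zeroʳ d))
  coeff-*-∷ []      d g (suc n) = ≡.sym (≡.trans (ℤ.+-identityʳ _) (ℤ.*-zeroʳ d))
  coeff-*-∷ (c ∷ f) d g zero    = ≡.cong (ℤ._+ 0ℤ) (ℤ.*-comm c d)
  coeff-*-∷ (c ∷ f) d g (suc n) = begin
    coeff ((c ∷ f) *ₚ (d ∷ g)) (suc n)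
      ≡⟨ coeff-* c f (d ∷ g) (suc n) ⟩
    c ℤ.* coeff g n ℤ.+ coeff (f *ₚ (d ∷ g)) n
      ≡⟨ ≡.cong (λ u → c ℤ.* coeff g n ℤ.+ u) (coeff-*-∷ f d g n) ⟩
    c ℤ.* coeff g n ℤ.+ (d ℤ.* coeff f n ℤ.+ coeff (0ℤ ∷ (f *ₚ g)) n)
      ≡⟨ solve 3 (λ x y z → x :+ (y :+ z) := y :+ (x :+ z)) ≡.refl (c ℤ.* coeff g n) (d ℤ.* coeff f n) _ ⟩
    d ℤ.* coeff f n ℤ.+ (c ℤ.* coeff g n ℤ.+ coeff (0ℤ ∷ (f *ₚ g)) n)
      ≡⟨ ≡.cong (λ u → d ℤ.* coeff f n ℤ.+ u) (coeff-* c f g n) ⟨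
    d ℤ.* coeff f n ℤ.+ coeff ((c ∷ f) *ₚ g) n
      ∎

  *ₚ-zeroʳ : ∀ f → f *ₚ [] ≋ []
  *ₚ-zeroʳ []      n       = ≡.refl
  *ₚ-zeroʳ (c ∷ f) zero    = ≡.refl
  *ₚ-zeroʳ (c ∷ f) (suc n) = *ₚ-zeroʳ f n

  *ₚ-comm : ∀ f g → f *ₚ g ≋ g *ₚ f
  *ₚ-comm []      g n = ≡.sym (*ₚ-zeroʳ g n)
  *ₚ-comm (c ∷ f) g n = begin
    coeff ((c ∷ f) *ₚ g) n  ≡⟨ coeff-* c f g n ⟩
    c ℤ.* coeff g n ℤ.+ coeff (0ℤ ∷ (f *ₚ g)) n  ≡⟨ ≡.cong (λ u → c ℤ.* coeff g n ℤ.+ u) (∷-cong ≡.refl (*ₚ-comm f g) n) ⟩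
    c ℤ.* coeff g n ℤ.+ coeff (0ℤ ∷ (g *ₚ f)) n  ≡⟨ coeff-*-∷ g c f n ⟨
    coeff (g *ₚ (c ∷ f)) n  ∎

  *ₚ-distribʳ : ∀ f g h → (g +ₚ h) *ₚ f ≋ g *ₚ f +ₚ h *ₚ f
  *ₚ-distribʳ f g h n = begin
    coeff ((g +ₚ h) *ₚ f) n  ≡⟨ *ₚ-comm (g +ₚ h) f n ⟩
    coeff (f *ₚ (g +ₚ h)) n  ≡⟨ *ₚ-distribˡ f g h n ⟩
    coeff (f *ₚ g +ₚ f *ₚ h) n  ≡⟨ coeff-+ (f *ₚ g) (f *ₚ h) n ⟩
    coeff (f *ₚ g) n ℤ.+ coeff (f *ₚ h) n  ≡⟨ ≡.cong₂ ℤ._+_ (*ₚ-comm f g n) (*ₚ-comm f h n) ⟩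
    coeff (g *ₚ f) n ℤ.+ coeff (h *ₚ f) n  ≡⟨ coeff-+ (g *ₚ f) (h *ₚ f) n ⟨
    coeff (g *ₚ f +ₚ h *ₚ f) n  ∎

  scale-* : ∀ c g h n → coeff (map (c ℤ.*_) g *ₚ h) n ≡ c ℤ.* coeff (g *ₚ h) n
  scale-* c []      h n = ≡.sym (ℤ.*-zeroʳ c)
  scale-* c (d ∷ g) h n = begin
    coeff ((c ℤ.* d ∷ map (c ℤ.*_) g) *ₚ h) n  ≡⟨ coeff-* (c ℤ.* d) (map (c ℤ.*_) g) h n ⟩
    c ℤ.* d ℤ.* coeff h n ℤ.+ coeff (0ℤ ∷ (map (c ℤ.*_) g *ₚ h)) n  ≡⟨ ≡.cong (λ u → c ℤ.* d ℤ.* coeff h n ℤ.+ u) (shifted n) ⟩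
    c ℤ.* d ℤ.* coeff h n ℤ.+ c ℤ.* coeff (0ℤ ∷ (g *ₚ h)) n  ≡⟨ solve 4 (λ c d x y → c :* d :* x :+ c :* y := c :* (d :* x :+ y)) ≡.refl c d _ _ ⟩
    c ℤ.* (d ℤ.* coeff h n ℤ.+ coeff (0ℤ ∷ (g *ₚ h)) n)  ≡⟨ ≡.cong (c ℤ.*_) (coeff-* d g h n) ⟨
    c ℤ.* coeff ((d ∷ g) *ₚ h) n  ∎
    where
    shifted : ∀ n → coeff (0ℤ ∷ (map (c ℤ.*_) g *ₚ h)) n ≡ c ℤ.* coeff (0ℤ ∷ (g *ₚ h)) n
    shifted zero    = ≡.sym (ℤ.*-zeroʳ c)
    shifted (suc n) = scale-* c g h n

  shift-* : ∀ f g n → coeff ((0ℤ ∷ f) *ₚ g) n ≡ coeff (0ℤ ∷ (f *ₚ g)) n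
  shift-* f g n = ≡.trans (coeff-* 0ℤ f g n) (solve 2 (λ x y → con 0ℤ :* x :+ y := y) ≡.refl (coeff g n) _)

  *ₚ-assoc : ∀ f g h → (f *ₚ g) *ₚ h ≋ f *ₚ (g *ₚ h)
  *ₚ-assoc []      g h n = ≡.refl
  *ₚ-assoc (c ∷ f) g h n = begin
    coeff ((map (c ℤ.*_) g +ₚ (0ℤ ∷ (f *ₚ g))) *ₚ h) n  ≡⟨ *ₚ-distribʳ h (map (c ℤ.*_) g) (0ℤ ∷ (f *ₚ g)) n ⟩
    coeff (map (c ℤ.*_) g *ₚ h +ₚ (0ℤ ∷ (f *ₚ g)) *ₚ h) n  ≡⟨ coeff-+ (map (c ℤ.*_) g *ₚ h) ((0ℤ ∷ (f *ₚ g)) *ₚ h) n ⟩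
    coeff (map (c ℤ.*_) g *ₚ h) n ℤ.+ coeff ((0ℤ ∷ (f *ₚ g)) *ₚ h) n  ≡⟨ ≡.cong₂ ℤ._+_ (scale-* c g h n) (≡.trans (shift-* (f *ₚ g) h n) (∷-cong ≡.refl (*ₚ-assoc f g h) n)) ⟩
    c ℤ.* coeff (g *ₚ h) n ℤ.+ coeff (0ℤ ∷ (f *ₚ (g *ₚ h))) n  ≡⟨ coeff-* c f (g *ₚ h) n ⟨
    coeff ((c ∷ f) *ₚ (g *ₚ h)) n  ∎

  *ₚ-identityˡ : ∀ f → [ 1ℤ ] *ₚ f ≋ f
  *ₚ-identityˡ f n = begin
    coeff ([ 1ℤ ] *ₚ f) n  ≡⟨ coeff-* 1ℤ [] f n ⟩
    1ℤ ℤ.* coeff f n ℤ.+ coeff (0ℤ ∷ []) n  ≡⟨ ≡.cong₂ ℤ._+_ (ℤ.*-identityˡ (coeff f n)) (shifted n) ⟩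
    coeff f n ℤ.+ 0ℤ  ≡⟨ ℤ.+-identityʳ _ ⟩
    coeff f n  ∎
    where
    shifted : ∀ n → coeff (0ℤ ∷ []) n ≡ 0ℤ
    shifted zero    = ≡.refl
    shifted (suc n) = ≡.refl

  lift₂ : ∀ f g h k → (∀ n → coeff f n ℤ.+ coeff g n ≡ coeff h n ℤ.+ coeff k n) → f +ₚ g ≋ h +ₚ k
  lift₂ f g h k eq n = ≡.trans (coeff-+ f g n) (≡.trans (eq n) (≡.sym (coeff-+ h k n)))

  commutativeRing : CommutativeRing _ _
  commutativeRing = record
    { Carrier = Poly
    ; _≈_ = _≋_
    ; _+_ = _+ₚ_
    ; _*_ = _*ₚ_
    ; -_  = -ₚ_
    ; 0#  = []
    ; 1#  = [ 1ℤ ]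
    ; isCommutativeRing = record
      { isRing = record
        { +-isAbelianGroup = record
          { isGroup = record
            { isMonoid = record
              { isSemigroup = record
                { isMagma = record
                  { isEquivalence = record
                    { refl  = λ n → ≡.refl
                    ; sym   = λ p n → ≡.sym (p n)
                    ; trans = λ p q n → ≡.trans (p n) (q n)
                    }
                  ; ∙-cong = λ {f} {g} {h} {k} p q → lift₂ f h g k (λ n → ≡.cong₂ ℤ._+_ (p n) (q n))
                  }
                ; assoc = λ f g h → lift₂ (f +ₚ g) h f (g +ₚ h) (λ n → ≡.trans (≡.cong (ℤ._+ coeff h n) (coeff-+ f g n))
                    (≡.trans (ℤ.+-assoc (coeff f n) (coeff g n) (coeff h n)) (≡.cong (λ u → coeff f n ℤ.+ u) (≡.sym (coeff-+ g h n)))))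
                }
              ; identity = (λ f n → ≡.refl) , (λ f n → ≡.trans (coeff-+ f [] n) (ℤ.+-identityʳ _))
              }
            ; inverse = (λ f n → ≡.trans (coeff-+ (-ₚ f) f n) (≡.trans (≡.cong (ℤ._+ coeff f n) (coeff-neg f n)) (ℤ.+-inverseˡ (coeff f n))))
                      , (λ f n → ≡.trans (coeff-+ f (-ₚ f) n) (≡.trans (≡.cong (ℤ._+_ (coeff f n)) (coeff-neg f n)) (ℤ.+-inverseʳ (coeff f n))))
            ; ⁻¹-cong = λ {f} {g} p n → ≡.trans (coeff-neg f n) (≡.trans (≡.cong ℤ.-_ (p n)) (≡.sym (coeff-neg g n)))
            }
          ; comm = λ f g → lift₂ f g g f (λ n → ℤ.+-comm (coeff f n) (coeff g n))
          }
        ; *-cong = λ {f} {g} {h} {k} p q n → ≡.trans (*ₚ-congˡ f q n) (*ₚ-congʳ f g k p n)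
        ; *-assoc = *ₚ-assoc
        ; *-identity = *ₚ-identityˡ , (λ f n → ≡.trans (*ₚ-comm f [ 1ℤ ] n) (*ₚ-identityˡ f n))
        ; distrib = *ₚ-distribˡ , *ₚ-distribʳ
        }
      ; *-comm = *ₚ-comm
      }
    }

  -- The constant coefficient of the product is c times that of g, hence c itself, so c = 0. The
  -- remaining coefficients are then those of the product of the tail with g, and the argument
  -- repeats.
  *ₚ≋0⇒≋0 : ∀ f g → coeff g 0 ≡ 1ℤ → f *ₚ g ≋ [] → f ≋ []
  *ₚ≋0⇒≋0 []      g g₀≡1 fg≋0 n = ≡.refl
  *ₚ≋0⇒≋0 (c ∷ f) g g₀≡1 fg≋0 = λ { zero → c≡0 ; (suc n) → *ₚ≋0⇒≋0 f g g₀≡1 tail n }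
    where
    c≡0 : c ≡ 0ℤ
    c≡0 = begin
      c  ≡⟨ ≡.trans (ℤ.+-identityʳ _) (ℤ.*-identityʳ c) ⟨
      c ℤ.* 1ℤ ℤ.+ 0ℤ  ≡⟨ ≡.cong (λ u → c ℤ.* u ℤ.+ 0ℤ) g₀≡1 ⟨
      c ℤ.* coeff g 0 ℤ.+ 0ℤ  ≡⟨ coeff-* c f g 0 ⟨
      coeff ((c ∷ f) *ₚ g) 0  ≡⟨ fg≋0 0 ⟩
      0ℤ  ∎
    tail : f *ₚ g ≋ []
    tail n = begin
      coeff (f *ₚ g) n  ≡⟨ ℤ.+-identityˡ _ ⟨
      0ℤ ℤ.* coeff g (suc n) ℤ.+ coeff (f *ₚ g) n  ≡⟨ ≡.cong (λ u → u ℤ.* coeff g (suc n) ℤ.+ coeff (f *ₚ g) n) c≡0 ⟨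
      c ℤ.* coeff g (suc n) ℤ.+ coeff (f *ₚ g) n  ≡⟨ coeff-* c f g (suc n) ⟨
      coeff ((c ∷ f) *ₚ g) (suc n)  ≡⟨ fg≋0 (suc n) ⟩
      0ℤ  ∎

  private module P = CommutativeRing commutativeRing

  *ₚ-cancelʳ : ∀ f f′ g → coeff g 0 ≡ 1ℤ → f *ₚ g ≋ f′ *ₚ g → f ≋ f′
  *ₚ-cancelʳ f f′ g g₀≡1 fg≋f′g n = begin
    coeff f n  ≡⟨ solve 2 (λ x y → x := (x :+ (:- y)) :+ y) ≡.refl (coeff f n) (coeff f′ n) ⟩
    coeff f n ℤ.+ ℤ.- coeff f′ n ℤ.+ coeff f′ n  ≡⟨ ≡.cong (ℤ._+ coeff f′ n) (≡.trans (coeff-+ f (-ₚ f′) n) (≡.cong (λ u → coeff f n ℤ.+ u) (coeff-neg f′ n))) ⟨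
    coeff (f +ₚ -ₚ f′) n ℤ.+ coeff f′ n  ≡⟨ ≡.cong (ℤ._+ coeff f′ n) (*ₚ≋0⇒≋0 (f +ₚ -ₚ f′) g g₀≡1 difference n) ⟩
    0ℤ ℤ.+ coeff f′ n  ≡⟨ ℤ.+-identityˡ _ ⟩
    coeff f′ n  ∎
    where
    difference : (f +ₚ -ₚ f′) *ₚ g ≋ []
    difference = P.trans {(f +ₚ -ₚ f′) *ₚ g} {f *ₚ g +ₚ (-ₚ f′) *ₚ g} {[]} (P.distribʳ g f (-ₚ f′))
      (P.trans {f *ₚ g +ₚ (-ₚ f′) *ₚ g} {f′ *ₚ g +ₚ (-ₚ f′) *ₚ g} {[]}
        (P.+-congʳ {(-ₚ f′) *ₚ g} {f *ₚ g} {f′ *ₚ g} fg≋f′g)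
        (P.trans {f′ *ₚ g +ₚ (-ₚ f′) *ₚ g} {(f′ +ₚ -ₚ f′) *ₚ g} {[]} (P.sym {(f′ +ₚ -ₚ f′) *ₚ g} {f′ *ₚ g +ₚ (-ₚ f′) *ₚ g} (P.distribʳ g f′ (-ₚ f′)))
          (≋-zero-* (f′ +ₚ -ₚ f′) g (P.-‿inverseʳ f′))))

-- Geometric sums and division by (t^p - 1)(t^q - 1)

module GeometricSum {c ℓ : Level} (R : CommutativeRing c ℓ) where
  open CommutativeRing R
  open RawSemiringDefinitions (Semiring.rawSemiring semiring) using (_^_) renaming (_×_ to _·_)
  open Algebra.Properties.CommutativeSemiring.Exp commutativeSemiring using (^-assocʳ)
  open IntegerImage R using (solve; con; _:+_; _:*_; _:-_; :-_; _:=_)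
  open SetoidReasoning setoid

  geometric : Carrier → ℕ → Carrier
  geometric x zero    = 0#
  geometric x (suc n) = 1# + x * geometric x n

  geometric-telescopes : ∀ x n → geometric x n * (x - 1#) ≈ x ^ n - 1#
  geometric-telescopes x zero    = trans (zeroˡ _) (sym (-‿inverseʳ 1#))
  geometric-telescopes x (suc n) = begin
    (1# + x * geometric x n) * (x - 1#)  ≈⟨ distribʳ _ _ _ ⟩
    1# * (x - 1#) + x * geometric x n * (x - 1#)  ≈⟨ +-cong (*-identityˡ _) (trans (*-assoc _ _ _) (*-congˡ (geometric-telescopes x n))) ⟩
    (x - 1#) + x * (x ^ n - 1#)  ≈⟨ solve 3 (λ x o p → (x :- o) :+ x :* (p :- o) := x :* p :+ (x :- x :* o) :- o) refl x 1# (x ^ n) ⟩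
    x * x ^ n + (x - x * 1#) - 1#  ≈⟨ +-congʳ (+-congˡ (trans (+-congˡ (-‿cong (*-identityʳ x))) (-‿inverseʳ x))) ⟩
    x * x ^ n + 0# - 1#  ≈⟨ +-congʳ (+-identityʳ _) ⟩
    x ^ suc n - 1#  ∎

  geometric-one : ∀ {x} n → x ≈ 1# → geometric x n ≈ n · 1#
  geometric-one zero    x≈1 = refl
  geometric-one (suc n) x≈1 = +-congˡ (trans (*-congʳ x≈1) (trans (*-identityˡ _) (geometric-one n x≈1)))

  geometric-power-telescopes : ∀ x p n → geometric (x ^ p) n * (x ^ p - 1#) ≈ x ^ (p ℕ.* n) - 1#
  geometric-power-telescopes x p n = trans (geometric-telescopes (x ^ p) n) (+-congʳ (^-assocʳ x p n))

  -- With a p = 1 + b q one has t - 1 = (t^(ap) - 1) - t (t^(bq) - 1), and each of the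
  -- two terms, multiplied by t^(pq) - 1, is divisible by (t^p - 1)(t^q - 1).
  bézoutQuotient : Carrier → (p q a b : ℕ) → Carrier
  bézoutQuotient x p q a b = geometric (x ^ q) p * geometric (x ^ p) a - x * (geometric (x ^ p) q * geometric (x ^ q) b)

  bézoutQuotient-divides : ∀ x p q a b → 1 ℕ.+ b ℕ.* q ≡ a ℕ.* p →
    bézoutQuotient x p q a b * ((x ^ p - 1#) * (x ^ q - 1#)) ≈ (x ^ (p ℕ.* q) - 1#) * (x - 1#)
  bézoutQuotient-divides x p q a b 1+bq≡ap = begin
    bézoutQuotient x p q a b * ((x ^ p - 1#) * (x ^ q - 1#))
      ≈⟨ solve 7 (λ g₁ g₂ g₃ g₄ x u v → (g₁ :* g₂ :- x :* (g₃ :* g₄)) :* (u :* v)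
                   := (g₁ :* v) :* (g₂ :* u) :- x :* ((g₃ :* u) :* (g₄ :* v))) refl
                 (geometric (x ^ q) p) (geometric (x ^ p) a) (geometric (x ^ p) q) (geometric (x ^ q) b) x (x ^ p - 1#) (x ^ q - 1#) ⟩
    (geometric (x ^ q) p * (x ^ q - 1#)) * (geometric (x ^ p) a * (x ^ p - 1#)) - x * ((geometric (x ^ p) q * (x ^ p - 1#)) * (geometric (x ^ q) b * (x ^ q - 1#)))
      ≈⟨ +-cong (*-cong (trans (geometric-power-telescopes x q p) (+-congʳ (power (ℕ.*-comm q p))))
                        (trans (geometric-power-telescopes x p a) (+-congʳ (power (≡.trans (ℕ.*-comm p a) (≡.sym 1+bq≡ap))))))
                (-‿cong (*-congˡ (*-cong (geometric-power-telescopes x p q)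
                        (trans (geometric-power-telescopes x q b) (+-congʳ (power (ℕ.*-comm q b))))))) ⟩
    (x ^ (p ℕ.* q) - 1#) * (x * x ^ (b ℕ.* q) - 1#) - x * ((x ^ (p ℕ.* q) - 1#) * (x ^ (b ℕ.* q) - 1#))
      ≈⟨ solve 4 (λ u x z o → u :* (x :* z :- o) :- x :* (u :* (z :- o)) := u :* (x :* o :- o)) refl (x ^ (p ℕ.* q) - 1#) x (x ^ (b ℕ.* q)) 1# ⟩
    (x ^ (p ℕ.* q) - 1#) * (x * 1# - 1#)
      ≈⟨ *-congˡ (+-congʳ (*-identityʳ x)) ⟩
    (x ^ (p ℕ.* q) - 1#) * (x - 1#)
      ∎
    where
    power : ∀ {m n} → m ≡ n → x ^ m ≈ x ^ n
    power m≡n = reflexive (≡.cong (x ^_) m≡n)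

  -- Both Δ (t^q - 1)/(t - 1) and (t^(pq) - 1)/(t^p - 1) become (t^(pq) - 1)(t - 1)
  -- on multiplication by (t - 1)(t^p - 1).
  quotient-comparison : ∀ d x p q → d * ((x ^ p - 1#) * (x ^ q - 1#)) ≈ (x ^ (p ℕ.* q) - 1#) * (x - 1#) →
    (d * geometric x q) * ((x - 1#) * (x ^ p - 1#)) ≈ geometric (x ^ p) q * ((x - 1#) * (x ^ p - 1#))
  quotient-comparison d x p q eq = begin
    (d * geometric x q) * ((x - 1#) * (x ^ p - 1#))  ≈⟨ solve 4 (λ d g y u → (d :* g) :* (y :* u) := d :* (u :* (g :* y))) refl d (geometric x q) (x - 1#) (x ^ p - 1#) ⟩
    d * ((x ^ p - 1#) * (geometric x q * (x - 1#)))  ≈⟨ *-congˡ (*-congˡ (geometric-telescopes x q)) ⟩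
    d * ((x ^ p - 1#) * (x ^ q - 1#))  ≈⟨ eq ⟩
    (x ^ (p ℕ.* q) - 1#) * (x - 1#)  ≈⟨ *-congʳ (geometric-power-telescopes x p q) ⟨
    geometric (x ^ p) q * (x ^ p - 1#) * (x - 1#)  ≈⟨ solve 3 (λ g u y → (g :* u) :* y := g :* (y :* u)) refl (geometric (x ^ p) q) (x ^ p - 1#) (x - 1#) ⟩
    geometric (x ^ p) q * ((x - 1#) * (x ^ p - 1#))  ∎

-- Alexander polynomials of torus knots

module AlexanderPolynomial where
  open PolynomialRing
  open CommutativeRing commutativeRing using (sym; trans; +-congʳ; *-congˡ; *-cong; *-comm; setoid; reflexive)
  open RawSemiringDefinitions (Semiring.rawSemiring (CommutativeRing.semiring commutativeRing)) using (_^_)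
  open GeometricSum commutativeRing
  open SetoidReasoning setoid

  T : Poly
  T = 0ℤ ∷ 1ℤ ∷ []

  T-* : ∀ f → 0ℤ ∷ f ≋ T *ₚ f
  T-* f n = ≡.trans (∷-cong ≡.refl (λ n → ≡.sym (*ₚ-identityˡ f n)) n) (≡.sym (shift-* [ 1ℤ ] f n))

  monomial : ∀ n → replicate n 0ℤ ++ [ 1ℤ ] ≋ T ^ n
  monomial zero    = λ n → ≡.refl
  monomial (suc n) = begin
    0ℤ ∷ (replicate n 0ℤ ++ [ 1ℤ ])  ≈⟨ ∷-cong ≡.refl (monomial n) ⟩
    0ℤ ∷ T ^ n  ≈⟨ T-* (T ^ n) ⟩
    T *ₚ T ^ n  ∎

  t^n−1≋ : ∀ n → t^ n −1 ≋ T ^ n +ₚ -ₚ [ 1ℤ ]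
  t^n−1≋ n = +-congʳ { -ₚ [ 1ℤ ]} {replicate n 0ℤ ++ [ 1ℤ ]} {T ^ n} (monomial n)

  t^1−1≋ : t^ 1 −1 ≋ T +ₚ -ₚ [ 1ℤ ]
  t^1−1≋ n = ≡.refl

  denominator≋ : ∀ p q → (t^ p −1) *ₚ (t^ q −1) ≋ (T ^ p +ₚ -ₚ [ 1ℤ ]) *ₚ (T ^ q +ₚ -ₚ [ 1ℤ ])
  denominator≋ p q = *-cong {t^ p −1} {T ^ p +ₚ -ₚ [ 1ℤ ]} {t^ q −1} {T ^ q +ₚ -ₚ [ 1ℤ ]} (t^n−1≋ p) (t^n−1≋ q)

  numerator≋ : ∀ n → (t^ n −1) *ₚ (t^ 1 −1) ≋ (T ^ n +ₚ -ₚ [ 1ℤ ]) *ₚ (T +ₚ -ₚ [ 1ℤ ])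
  numerator≋ n = *-cong {t^ n −1} {T ^ n +ₚ -ₚ [ 1ℤ ]} {t^ 1 −1} {T +ₚ -ₚ [ 1ℤ ]} (t^n−1≋ n) t^1−1≋

  alexander-swap : ∀ p q {Δ} → IsAlexander p q Δ → IsAlexander q p Δ
  alexander-swap p q {Δ} isΔ = begin
    Δ *ₚ ((t^ q −1) *ₚ (t^ p −1))  ≈⟨ *ₚ-congˡ Δ (*-comm (t^ q −1) (t^ p −1)) ⟩
    Δ *ₚ ((t^ p −1) *ₚ (t^ q −1))  ≈⟨ isΔ ⟩
    (t^ (p ℕ.* q) −1) *ₚ (t^ 1 −1)  ≈⟨ reflexive (≡.cong (λ n → (t^ n −1) *ₚ (t^ 1 −1)) (ℕ.*-comm p q)) ⟩
    (t^ (q ℕ.* p) −1) *ₚ (t^ 1 −1)  ∎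

  bézout⇒alexander : ∀ p q a b → 1 ℕ.+ b ℕ.* q ≡ a ℕ.* p → IsAlexander p q (bézoutQuotient T p q a b)
  bézout⇒alexander p q a b eq = begin
    bézoutQuotient T p q a b *ₚ ((t^ p −1) *ₚ (t^ q −1))  ≈⟨ *ₚ-congˡ (bézoutQuotient T p q a b) (denominator≋ p q) ⟩
    bézoutQuotient T p q a b *ₚ ((T ^ p +ₚ -ₚ [ 1ℤ ]) *ₚ (T ^ q +ₚ -ₚ [ 1ℤ ]))  ≈⟨ bézoutQuotient-divides T p q a b eq ⟩
    (T ^ (p ℕ.* q) +ₚ -ₚ [ 1ℤ ]) *ₚ (T +ₚ -ₚ [ 1ℤ ])  ≈⟨ numerator≋ (p ℕ.* q) ⟨
    (t^ (p ℕ.* q) −1) *ₚ (t^ 1 −1)  ∎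

  -- Bézout's identity has the extra 1 on the side of p or on that of q; exchanging p and q reduces
  -- the second form to the first.
  alexander-exists : ∀ p q → Coprime p q → ∃ λ Δ → IsAlexander p q Δ
  alexander-exists p q coprime with coprime-Bézout coprime
  ... | Bézout.+- a b eq = bézoutQuotient T p q a b , bézout⇒alexander p q a b eq
  ... | Bézout.-+ a b eq = bézoutQuotient T q p b a , alexander-swap q p {bézoutQuotient T q p b a} (bézout⇒alexander q p b a eq)

  -- The factor (t - 1)(t^p - 1) is cancelled among polynomials because it vanishes at every α with
  -- α^p = 1, which is where the identity will be evaluated. Its constant coefficient is (-1)(-1) =
  -- 1, by computation once p is a successor.
  alexander-quotient : ∀ p q Δ → 0 ℕ.< p → IsAlexander p q Δ → Δ *ₚ geometric T q ≋ geometric (T ^ p) q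
  alexander-quotient (suc p) q Δ _ isΔ = *ₚ-cancelʳ (Δ *ₚ geometric T q) (geometric (T ^ suc p) q) ((t^ 1 −1) *ₚ (t^ suc p −1)) ≡.refl (begin
    (Δ *ₚ geometric T q) *ₚ ((t^ 1 −1) *ₚ (t^ suc p −1))  ≈⟨ *ₚ-congˡ (Δ *ₚ geometric T q) factors ⟩
    (Δ *ₚ geometric T q) *ₚ ((T +ₚ -ₚ [ 1ℤ ]) *ₚ (T ^ suc p +ₚ -ₚ [ 1ℤ ]))  ≈⟨ quotient-comparison Δ T (suc p) q equation ⟩
    geometric (T ^ suc p) q *ₚ ((T +ₚ -ₚ [ 1ℤ ]) *ₚ (T ^ suc p +ₚ -ₚ [ 1ℤ ]))  ≈⟨ *ₚ-congˡ (geometric (T ^ suc p) q) factors ⟨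
    geometric (T ^ suc p) q *ₚ ((t^ 1 −1) *ₚ (t^ suc p −1))  ∎)
    where
    factors : (t^ 1 −1) *ₚ (t^ suc p −1) ≋ (T +ₚ -ₚ [ 1ℤ ]) *ₚ (T ^ suc p +ₚ -ₚ [ 1ℤ ])
    factors = *-cong {t^ 1 −1} {T +ₚ -ₚ [ 1ℤ ]} {t^ suc p −1} {T ^ suc p +ₚ -ₚ [ 1ℤ ]} t^1−1≋ (t^n−1≋ (suc p))
    equation : Δ *ₚ ((T ^ suc p +ₚ -ₚ [ 1ℤ ]) *ₚ (T ^ q +ₚ -ₚ [ 1ℤ ])) ≋ (T ^ (suc p ℕ.* q) +ₚ -ₚ [ 1ℤ ]) *ₚ (T +ₚ -ₚ [ 1ℤ ])
    equation = begin
      Δ *ₚ ((T ^ suc p +ₚ -ₚ [ 1ℤ ]) *ₚ (T ^ q +ₚ -ₚ [ 1ℤ ]))  ≈⟨ *ₚ-congˡ Δ (denominator≋ (suc p) q) ⟨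
      Δ *ₚ ((t^ suc p −1) *ₚ (t^ q −1))  ≈⟨ isΔ ⟩
      (t^ (suc p ℕ.* q) −1) *ₚ (t^ 1 −1)  ≈⟨ numerator≋ (suc p ℕ.* q) ⟩
      (T ^ (suc p ℕ.* q) +ₚ -ₚ [ 1ℤ ]) *ₚ (T +ₚ -ₚ [ 1ℤ ])  ∎

-- Evaluation of polynomials is a ring homomorphism

module Evaluation {c ℓ : Level} (R : CommutativeRing c ℓ) where
  open CommutativeRing R
  open RawSemiringDefinitions (Semiring.rawSemiring semiring) using (_^_) renaming (_×_ to _·_)
  open Algebra.Properties.CommutativeSemiring.Exp commutativeSemiring using (^-congˡ)
  open IntegerImage R
  open PolynomialRing using (∷-cong; *ₚ-congˡ)
  open AlexanderPolynomial using (T; T-*; t^n−1≋)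
  open GeometricSum R
  open SetoidReasoning setoid
  private
    module P = CommutativeRing PolynomialRing.commutativeRing
    module PG = GeometricSum PolynomialRing.commutativeRing
    open RawSemiringDefinitions (Semiring.rawSemiring P.semiring) using () renaming (_^_ to _^ₚ_)

  ev : Poly → Carrier → Carrier
  ev []      x = 0#
  ev (a ∷ f) x = image a + x * ev f x

  ev-≋0 : ∀ f x → f ≋ [] → ev f x ≈ 0#
  ev-≋0 []      x f≋0 = refl
  ev-≋0 (a ∷ f) x f≋0 = begin
    image a + x * ev f x  ≈⟨ +-cong (reflexive (≡.cong image (f≋0 0))) (*-congˡ (ev-≋0 f x (f≋0 ∘ suc))) ⟩
    0# + x * 0#  ≈⟨ trans (+-identityˡ _) (zeroʳ x) ⟩
    0#  ∎

  ev-cong : ∀ f g x → f ≋ g → ev f x ≈ ev g x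
  ev-cong []      g       x f≋g = sym (ev-≋0 g x (≡.sym ∘ f≋g))
  ev-cong (a ∷ f) []      x f≋g = ev-≋0 (a ∷ f) x f≋g
  ev-cong (a ∷ f) (b ∷ g) x f≋g = +-cong (reflexive (≡.cong image (f≋g 0))) (*-congˡ (ev-cong f g x (f≋g ∘ suc)))

  ev-+ : ∀ f g x → ev (f +ₚ g) x ≈ ev f x + ev g x
  ev-+ []      g       x = sym (+-identityˡ _)
  ev-+ (a ∷ f) []      x = sym (+-identityʳ _)
  ev-+ (a ∷ f) (b ∷ g) x = begin
    image (a ℤ.+ b) + x * ev (f +ₚ g) x  ≈⟨ +-cong (image-+ a b) (*-congˡ (ev-+ f g x)) ⟩
    image a + image b + x * (ev f x + ev g x)  ≈⟨ solve 5 (λ a b x u v → a :+ b :+ x :* (u :+ v) := (a :+ x :* u) :+ (b :+ x :* v)) refl _ _ _ _ _ ⟩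
    (image a + x * ev f x) + (image b + x * ev g x)  ∎

  ev-scale : ∀ a f x → ev (map (a ℤ.*_) f) x ≈ image a * ev f x
  ev-scale a []      x = sym (zeroʳ _)
  ev-scale a (b ∷ f) x = begin
    image (a ℤ.* b) + x * ev (map (a ℤ.*_) f) x  ≈⟨ +-cong (image-* a b) (*-congˡ (ev-scale a f x)) ⟩
    image a * image b + x * (image a * ev f x)  ≈⟨ solve 4 (λ a b x u → a :* b :+ x :* (a :* u) := a :* (b :+ x :* u)) refl _ _ _ _ ⟩
    image a * (image b + x * ev f x)  ∎

  ev-* : ∀ f g x → ev (f *ₚ g) x ≈ ev f x * ev g x
  ev-* []      g x = sym (zeroˡ _)
  ev-* (a ∷ f) g x = begin
    ev (map (a ℤ.*_) g +ₚ (0ℤ ∷ (f *ₚ g))) x  ≈⟨ ev-+ (map (a ℤ.*_) g) (0ℤ ∷ (f *ₚ g)) x ⟩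
    ev (map (a ℤ.*_) g) x + (0# + x * ev (f *ₚ g) x)  ≈⟨ +-cong (ev-scale a g x) (trans (+-identityˡ _) (*-congˡ (ev-* f g x))) ⟩
    image a * ev g x + x * (ev f x * ev g x)  ≈⟨ solve 4 (λ a x u v → a :* v :+ x :* (u :* v) := (a :+ x :* u) :* v) refl _ _ _ _ ⟩
    (image a + x * ev f x) * ev g x  ∎

  ev-1 : ∀ x → ev [ 1ℤ ] x ≈ 1#
  ev-1 x = trans (+-cong (+-identityʳ 1#) (zeroʳ x)) (+-identityʳ 1#)

  ev-T : ∀ x → ev T x ≈ x
  ev-T x = trans (+-identityˡ _) (trans (*-congˡ (ev-1 x)) (*-identityʳ x))

  ev-^ : ∀ f x n → ev (f ^ₚ n) x ≈ ev f x ^ n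
  ev-^ f x zero    = ev-1 x
  ev-^ f x (suc n) = trans (ev-* f (f ^ₚ n) x) (*-congˡ (ev-^ f x n))

  ev-t^n−1 : ∀ n x → ev (t^ n −1) x ≈ x ^ n - 1#
  ev-t^n−1 n x = begin
    ev (t^ n −1) x  ≈⟨ ev-cong (t^ n −1) (T ^ₚ n +ₚ [ -1ℤ ]) x (t^n−1≋ n) ⟩
    ev (T ^ₚ n +ₚ [ -1ℤ ]) x  ≈⟨ ev-+ (T ^ₚ n) [ -1ℤ ] x ⟩
    ev (T ^ₚ n) x + (- (1 · 1#) + x * 0#)  ≈⟨ +-cong (trans (ev-^ T x n) (^-congˡ n (ev-T x)))
                                                 (trans (+-cong (-‿cong (+-identityʳ 1#)) (zeroʳ x)) (+-identityʳ _)) ⟩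
    x ^ n - 1#  ∎

  ev-geometric : ∀ f x n → ev (PG.geometric f n) x ≈ geometric (ev f x) n
  ev-geometric f x zero    = refl
  ev-geometric f x (suc n) = begin
    ev ([ 1ℤ ] +ₚ f *ₚ PG.geometric f n) x  ≈⟨ ev-+ [ 1ℤ ] (f *ₚ PG.geometric f n) x ⟩
    ev [ 1ℤ ] x + ev (f *ₚ PG.geometric f n) x  ≈⟨ +-cong (ev-1 x) (trans (ev-* f (PG.geometric f n) x) (*-congˡ (ev-geometric f x n))) ⟩
    1# + ev f x * geometric (ev f x) n  ∎

  geometric-cong : ∀ {x y} n → x ≈ y → geometric x n ≈ geometric y n
  geometric-cong zero    x≈y = refl
  geometric-cong (suc n) x≈y = +-congˡ (*-cong x≈y (geometric-cong n x≈y))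

  ev-alexander : ∀ p q Δ x → IsAlexander p q Δ → ev Δ x * ((x ^ p - 1#) * (x ^ q - 1#)) ≈ (x ^ (p ℕ.* q) - 1#) * (x - 1#)
  ev-alexander p q Δ x isΔ = begin
    ev Δ x * ((x ^ p - 1#) * (x ^ q - 1#))  ≈⟨ *-congˡ (*-cong (ev-t^n−1 p x) (ev-t^n−1 q x)) ⟨
    ev Δ x * (ev (t^ p −1) x * ev (t^ q −1) x)  ≈⟨ *-congˡ (ev-* (t^ p −1) (t^ q −1) x) ⟨
    ev Δ x * ev ((t^ p −1) *ₚ (t^ q −1)) x  ≈⟨ ev-* Δ ((t^ p −1) *ₚ (t^ q −1)) x ⟨
    ev (Δ *ₚ ((t^ p −1) *ₚ (t^ q −1))) x  ≈⟨ ev-cong (Δ *ₚ ((t^ p −1) *ₚ (t^ q −1))) ((t^ (p ℕ.* q) −1) *ₚ (t^ 1 −1)) x isΔ ⟩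
    ev ((t^ (p ℕ.* q) −1) *ₚ (t^ 1 −1)) x  ≈⟨ ev-* (t^ (p ℕ.* q) −1) (t^ 1 −1) x ⟩
    ev (t^ (p ℕ.* q) −1) x * ev (t^ 1 −1) x  ≈⟨ *-cong (ev-t^n−1 (p ℕ.* q) x) (trans (ev-t^n−1 1 x) (+-congʳ (*-identityʳ x))) ⟩
    (x ^ (p ℕ.* q) - 1#) * (x - 1#)  ∎

  ev-alexander-quotient : ∀ p q Δ x → 0 ℕ.< p → IsAlexander p q Δ → x ^ p ≈ 1# → ev Δ x * geometric x q ≈ q · 1#
  ev-alexander-quotient p q Δ x 0<p isΔ x^p≈1 = begin
    ev Δ x * geometric x q  ≈⟨ *-congˡ (trans (ev-geometric T x q) (geometric-cong q (ev-T x))) ⟨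
    ev Δ x * ev (PG.geometric T q) x  ≈⟨ ev-* Δ (PG.geometric T q) x ⟨
    ev (Δ *ₚ PG.geometric T q) x  ≈⟨ ev-cong (Δ *ₚ PG.geometric T q) (PG.geometric (T ^ₚ p) q) x (AlexanderPolynomial.alexander-quotient p q Δ 0<p isΔ) ⟩
    ev (PG.geometric (T ^ₚ p) q) x  ≈⟨ ev-geometric (T ^ₚ p) x q ⟩
    geometric (ev (T ^ₚ p) x) q  ≈⟨ geometric-one q (trans (ev-^ T x p) (trans (^-congˡ p (ev-T x)) x^p≈1)) ⟩
    q · 1#  ∎

-- Numbers without divisors between 2 and a bound

module Roughness where

  rough-weaken : ∀ {y m} → suc y Rough m → y Rough m
  rough-weaken rough (hasNonTrivialDivisor d<y d∣m) = rough (hasNonTrivialDivisor (ℕ.m<n⇒m<1+n d<y) d∣m)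

  rough-suc⇒∤ : ∀ {y m} .{{_ : NonTrivial y}} → suc y Rough m → y ∤ m
  rough-suc⇒∤ {y} rough y∣m = rough (hasNonTrivialDivisor (ℕ.n<1+n y) y∣m)

  rough? : ∀ y m → Dec (y Rough m)
  rough? 0      m = yes 0-rough
  rough? 1      m = yes 1-rough
  rough? 2      m = yes 2-rough
  rough? (suc y@(2+ _)) m with y ∣? m | rough? y m
  ... | yes y∣m | _         = no λ rough → rough-suc⇒∤ rough y∣m
  ... | no  y∤m | yes rough = yes (∤⇒rough-suc y∤m rough)
  ... | no  y∤m | no ¬rough = no (¬rough ∘ rough-weaken)

  -- If y divided a y-rough m, then any smaller nontrivial divisor of y would also divide m; so y
  -- would be prime.
  ¬prime⇒rough-suc : ∀ {y m} → ¬ Prime y → y Rough m → suc y Rough m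
  ¬prime⇒rough-suc {0}    _      _     = 1-rough
  ¬prime⇒rough-suc {1}    _      _     = 2-rough
  ¬prime⇒rough-suc {2+ _} ¬y-prime rough = ∤⇒rough-suc (λ y∣m → ¬y-prime (rough∧∣⇒prime rough y∣m)) rough

  -- A divisor d with 1 < d < y is coprime to the prime y, so if it divides y m it already divides
  -- m.
  rough-* : ∀ {y m} → Prime y → y Rough m → y Rough (y ℕ.* m)
  rough-* {y} {m} y-prime rough (hasNonTrivialDivisor {d} d<y d∣ym) =
    rough (hasNonTrivialDivisor d<y (coprime-divisor (λ (e∣d , e∣y) → prime⇒coprime y-prime {{ℕ.nonTrivial⇒nonZero d}} d<y (e∣y , e∣d)) d∣ym))

  -- Any m with 1 < m ≤ n would be its own forbidden divisor.
  rough⇒≡1 : ∀ {n m} → 0 ℕ.< m → m ℕ.≤ n → suc n Rough m → m ≡ 1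
  rough⇒≡1 {m = 1}    _ _   _     = ≡.refl
  rough⇒≡1 {m = 2+ m} _ m≤n rough = contradiction (hasNonTrivialDivisor (ℕ.s≤s m≤n) ∣-refl) rough

-- Cardinality from a list without repetitions

module Enumeration {a s ℓ : Level} {A : Set a} (S : Setoid s ℓ) where
  open Setoid S using (_≈_) renaming (Carrier to ∣S∣; reflexive to ≈-reflexive; trans to ≈-trans; sym to ≈-sym; refl to ≈-refl)

  lookup-injective : ∀ {xs : List A} → Unique xs → ∀ i j → lookup xs i ≡ lookup xs j → i ≡ j
  lookup-injective (x≢ ∷ u) Fin.zero    Fin.zero    eq = ≡.refl
  lookup-injective (x≢ ∷ u) Fin.zero    (Fin.suc j) eq = contradiction eq (All.lookup x≢ (∈-lookup j))
  lookup-injective (x≢ ∷ u) (Fin.suc i) Fin.zero    eq = contradiction (≡.sym eq) (All.lookup x≢ (∈-lookup i))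
  lookup-injective (x≢ ∷ u) (Fin.suc i) (Fin.suc j) eq = ≡.cong Fin.suc (lookup-injective u i j eq)

  -- `element` depends on the membership proof, and its values are compared only by ≈. Injectivity
  -- is therefore obtained on the codes, which are compared by ≡; the last hypothesis says that an
  -- element is determined by its code.
  enumerated : ∀ {xs : List A} → Unique xs →
    (element : ∀ {x} → x ∈ xs → ∣S∣) (code : ∣S∣ → A) →
    (∀ y → code y ∈ xs) →
    (∀ {y z} → y ≈ z → code y ≡ code z) →
    (∀ {x} (x∈ : x ∈ xs) → code (element x∈) ≡ x) →
    (∀ {x} (x∈ : x ∈ xs) y → x ≡ code y → element x∈ ≈ y) →
    HasCardinality S (length xs)
  enumerated {xs} unique element code code∈ code-cong code-element element-code = record
    { to        = to
    ; from      = from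
    ; to-cong   = λ i≡j → ≈-reflexive (≡.cong to i≡j)
    ; from-cong = λ {y} {z} y≈z → lookup-injective unique (from y) (from z) (≡.trans (lookup-from y) (≡.trans (code-cong y≈z) (≡.sym (lookup-from z))))
    ; inverse   = (λ { {y} ≡.refl → element-code (∈-lookup (from y)) y (lookup-from y) })
                , (λ {i} {y} y≈ → lookup-injective unique (from y) i (≡.trans (lookup-from y) (≡.trans (code-cong y≈) (code-element (∈-lookup i)))))
    }
    where
    to : Fin (length xs) → ∣S∣
    to i = element (∈-lookup i)
    from : ∣S∣ → Fin (length xs)
    from y = Any.index (code∈ y)
    lookup-from : ∀ y → lookup xs (from y) ≡ code y
    lookup-from y = ≡.sym (Any.lookup-index (code∈ y))

module RootAsymptotics {c ℓ₁ ℓ₂ : Level} (ℝ : RealField c ℓ₁ ℓ₂) where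
  open Analysis ℝ
  open IntegerImage commutativeRing using (solve; con; _:+_; _:*_; _:-_; _:^_; :-_; _:=_)
  open Algebra.Properties.Ring ring using (-0#≈0#; -‿involutive)
  open Algebra.Properties.Semiring.Mult semiring using (×-homo-+; ×1-homo-*)
  open Algebra.Properties.CommutativeSemiring.Exp commutativeSemiring public
    using (^-congˡ)

  private
    module STO = IsStrictTotalOrder isStrictTotalOrder
    module DTO = IsDecTotalOrder (StrictToNonStrict.isDecTotalOrder _≈_ _<_ isStrictTotalOrder)

  -- Order and absolute value in the real field

  strictPartialOrder : StrictPartialOrder c ℓ₁ ℓ₂
  strictPartialOrder = record { isStrictPartialOrder = STO.isStrictPartialOrder }

  open Relation.Binary.Reasoning.StrictPartialOrder strictPartialOrder

  open DTO public using (_≤?_) renaming (trans to ≤-trans; reflexive to ≤-reflexive; refl to ≤-refl; antisym to ≤-antisym; total to ≤-total; _≟_ to _≈?_)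
  open STO public using () renaming (trans to <-trans; irrefl to <-irrefl)

  <⇒≤ : ∀ {x y} → x < y → x ≤ y
  <⇒≤ = inj₁

  <-≤-trans : ∀ {x y z} → x < y → y ≤ z → x < z
  <-≤-trans {x} {y} {z} x<y y≤z = begin-strict x <⟨ x<y ⟩ y ≤⟨ y≤z ⟩ z ∎

  ≤-<-trans : ∀ {x y z} → x ≤ y → y < z → x < z
  ≤-<-trans {x} {y} {z} x≤y y<z = begin-strict x ≤⟨ x≤y ⟩ y <⟨ y<z ⟩ z ∎

  <⇒≱ : ∀ {x y} → x < y → ¬ y ≤ x
  <⇒≱ x<y y≤x = <-irrefl refl (<-≤-trans x<y y≤x)

  ≮⇒≥ : ∀ {x y} → ¬ x < y → y ≤ x
  ≮⇒≥ {x} {y} x≮y with compare x y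
  ... | tri< x<y _ _ = contradiction x<y x≮y
  ... | tri≈ _ x≈y _ = inj₂ (sym x≈y)
  ... | tri> _ _ y<x = inj₁ y<x

  ≰⇒> : ∀ {x y} → ¬ x ≤ y → y < x
  ≰⇒> {x} {y} x≰y with compare x y
  ... | tri< x<y _ _ = contradiction (inj₁ x<y) x≰y
  ... | tri≈ _ x≈y _ = contradiction (inj₂ x≈y) x≰y
  ... | tri> _ _ y<x = y<x

  <-≤-dichotomy : ∀ x y → x < y ⊎ y ≤ x
  <-≤-dichotomy x y with x <? y
  ... | yes x<y = inj₁ x<y
  ... | no  x≮y = inj₂ (≮⇒≥ x≮y)

  +-monoˡ-≤ : ∀ {x y} z → x ≤ y → x + z ≤ y + z
  +-monoˡ-≤ z (inj₁ x<y) = inj₁ (+-monoˡ-< z x<y)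
  +-monoˡ-≤ z (inj₂ x≈y) = inj₂ (+-congʳ x≈y)

  +-monoʳ-≤ : ∀ {x y} z → x ≤ y → z + x ≤ z + y
  +-monoʳ-≤ {x} {y} z x≤y = begin
    z + x ≈⟨ +-comm _ _ ⟩ x + z ≤⟨ +-monoˡ-≤ z x≤y ⟩ y + z ≈⟨ +-comm _ _ ⟩ z + y ∎

  +-mono-≤ : ∀ {x y u v} → x ≤ y → u ≤ v → x + u ≤ y + v
  +-mono-≤ x≤y u≤v = ≤-trans (+-monoˡ-≤ _ x≤y) (+-monoʳ-≤ _ u≤v)

  +-mono-<-≤ : ∀ {x y u v} → x < y → u ≤ v → x + u < y + v
  +-mono-<-≤ x<y u≤v = <-≤-trans (+-monoˡ-< _ x<y) (+-monoʳ-≤ _ u≤v)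

  +-nonneg : ∀ {x y} → 0# ≤ x → 0# ≤ y → 0# ≤ x + y
  +-nonneg {x} {y} 0≤x 0≤y = begin
    0# ≈⟨ +-identityˡ 0# ⟨ 0# + 0# ≤⟨ +-mono-≤ 0≤x 0≤y ⟩ x + y ∎

  +-pos : ∀ {x y} → 0# < x → 0# ≤ y → 0# < x + y
  +-pos {x} {y} 0<x 0≤y = begin-strict
    0# ≈⟨ +-identityˡ 0# ⟨ 0# + 0# <⟨ +-mono-<-≤ 0<x 0≤y ⟩ x + y ∎

  *-nonneg : ∀ {x y} → 0# ≤ x → 0# ≤ y → 0# ≤ x * y
  *-nonneg (inj₁ 0<x) (inj₁ 0<y) = inj₁ (*-pos 0<x 0<y)
  *-nonneg (inj₁ _)   (inj₂ 0≈y) = inj₂ (sym (trans (*-congˡ (sym 0≈y)) (zeroʳ _)))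
  *-nonneg (inj₂ 0≈x) _          = inj₂ (sym (trans (*-congʳ (sym 0≈x)) (zeroˡ _)))

  -- Turns an inequality into an identity with an explicit slack e, which the ring solver can then
  -- check.
  ≤-by : ∀ {x y} e → 0# ≤ e → y ≈ x + e → x ≤ y
  ≤-by {x} {y} e 0≤e y≈x+e = begin
    x ≈⟨ +-identityʳ x ⟨ x + 0# ≤⟨ +-monoʳ-≤ x 0≤e ⟩ x + e ≈⟨ y≈x+e ⟨ y ∎

  <-by : ∀ {x y} e → 0# < e → y ≈ x + e → x < y
  <-by {x} {y} e 0<e y≈x+e = begin-strict
    x ≈⟨ +-identityˡ x ⟨ 0# + x <⟨ +-monoˡ-< x 0<e ⟩ e + x ≈⟨ +-comm e x ⟩ x + e ≈⟨ y≈x+e ⟨ y ∎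

  x≤y⇒0≤y-x : ∀ {x y} → x ≤ y → 0# ≤ y - x
  x≤y⇒0≤y-x {x} {y} x≤y = begin
    0# ≈⟨ -‿inverseʳ x ⟨ x - x ≤⟨ +-monoˡ-≤ (- x) x≤y ⟩ y - x ∎

  x<y⇒0<y-x : ∀ {x y} → x < y → 0# < y - x
  x<y⇒0<y-x {x} {y} x<y = begin-strict
    0# ≈⟨ -‿inverseʳ x ⟨ x - x <⟨ +-monoˡ-< (- x) x<y ⟩ y - x ∎

  neg-mono-≤ : ∀ {x y} → x ≤ y → - y ≤ - x
  neg-mono-≤ {x} {y} x≤y =
    ≤-by (y - x) (x≤y⇒0≤y-x x≤y) (solve 2 (λ x y → :- x := :- y :+ (y :- x)) refl x y)

  neg-pos : ∀ {x} → x < 0# → 0# < - x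
  neg-pos {x} x<0 = begin-strict
    0# <⟨ x<y⇒0<y-x x<0 ⟩ 0# - x ≈⟨ +-identityˡ _ ⟩ - x ∎

  *-monoˡ-≤ : ∀ {x y} z → 0# ≤ z → x ≤ y → z * x ≤ z * y
  *-monoˡ-≤ {x} {y} z 0≤z x≤y =
    ≤-by (z * (y - x)) (*-nonneg 0≤z (x≤y⇒0≤y-x x≤y)) (solve 3 (λ x y z → z :* y := z :* x :+ z :* (y :- x)) refl x y z)

  *-monoʳ-≤ : ∀ {x y} z → 0# ≤ z → x ≤ y → x * z ≤ y * z
  *-monoʳ-≤ {x} {y} z 0≤z x≤y = begin
    x * z ≈⟨ *-comm x z ⟩ z * x ≤⟨ *-monoˡ-≤ z 0≤z x≤y ⟩ z * y ≈⟨ *-comm z y ⟩ y * z ∎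

  *-mono-≤ : ∀ {x y u v} → 0# ≤ x → 0# ≤ u → x ≤ y → u ≤ v → x * u ≤ y * v
  *-mono-≤ 0≤x 0≤u x≤y u≤v = ≤-trans (*-monoʳ-≤ _ 0≤u x≤y) (*-monoˡ-≤ _ (≤-trans 0≤x x≤y) u≤v)

  *-monoˡ-< : ∀ {x y} z → 0# < z → x < y → z * x < z * y
  *-monoˡ-< {x} {y} z 0<z x<y =
    <-by (z * (y - x)) (*-pos 0<z (x<y⇒0<y-x x<y)) (solve 3 (λ x y z → z :* y := z :* x :+ z :* (y :- x)) refl x y z)

  *-cancelˡ-≤ : ∀ {x y} z → 0# < z → z * x ≤ z * y → x ≤ y
  *-cancelˡ-≤ z 0<z zx≤zy = ≮⇒≥ λ y<x → <⇒≱ (*-monoˡ-< z 0<z y<x) zx≤zy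

  square-nonneg : ∀ x → 0# ≤ x * x
  square-nonneg x with ≤-total 0# x
  ... | inj₁ 0≤x = *-nonneg 0≤x 0≤x
  ... | inj₂ x≤0 = begin
    0#  ≤⟨ *-nonneg 0≤-x 0≤-x ⟩
    - x * - x  ≈⟨ solve 1 (λ x → :- x :* :- x := x :* x) refl x ⟩
    x * x  ∎
    where
    0≤-x : 0# ≤ - x
    0≤-x = begin 0# ≈⟨ -0#≈0# ⟨ - 0# ≤⟨ neg-mono-≤ x≤0 ⟩ - x ∎

  0<1 : 0# < 1#
  0<1 with compare 0# 1#
  ... | tri< 0<1 _ _ = 0<1
  ... | tri≈ _ 0≈1 _ = contradiction 0≈1 0≉1
  ... | tri> _ _ 1<0 = contradiction 1<0 λ 1<0 → <⇒≱ 1<0 (≤-trans (square-nonneg 1#) (≤-reflexive (*-identityˡ 1#)))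

  0≤1 : 0# ≤ 1#
  0≤1 = <⇒≤ 0<1

  <⇒≉ : ∀ {x y} → x < y → ¬ y ≈ x
  <⇒≉ x<y y≈x = <-irrefl (sym y≈x) x<y

  ^-nonneg : ∀ {x} n → 0# ≤ x → 0# ≤ x ^ n
  ^-nonneg zero    0≤x = 0≤1
  ^-nonneg (suc n) 0≤x = *-nonneg 0≤x (^-nonneg n 0≤x)

  ^-pos : ∀ {x} n → 0# < x → 0# < x ^ n
  ^-pos zero    0<x = 0<1
  ^-pos (suc n) 0<x = *-pos 0<x (^-pos n 0<x)

  ^-mono-≤ : ∀ {x y} n → 0# ≤ x → x ≤ y → x ^ n ≤ y ^ n
  ^-mono-≤ zero    0≤x x≤y = ≤-refl
  ^-mono-≤ (suc n) 0≤x x≤y = *-mono-≤ 0≤x (^-nonneg n 0≤x) x≤y (^-mono-≤ n 0≤x x≤y)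

  ι-+ : ∀ m n → ι (m ℕ.+ n) ≈ ι m + ι n
  ι-+ = ×-homo-+ 1#

  ι-* : ∀ m n → ι (m ℕ.* n) ≈ ι m * ι n
  ι-* = ×1-homo-*

  ι-^ : ∀ m n → ι (m ℕ.^ n) ≈ ι m ^ n
  ι-^ m zero    = +-identityʳ 1#
  ι-^ m (suc n) = trans (ι-* m (m ℕ.^ n)) (*-congˡ (ι-^ m n))

  ι-1 : ι 1 ≈ 1#
  ι-1 = +-identityʳ 1#

  0≤ι : ∀ n → 0# ≤ ι n
  0≤ι zero    = ≤-refl
  0≤ι (suc n) = +-nonneg 0≤1 (0≤ι n)

  ι-mono-≤ : ∀ {m n} → m ℕ.≤ n → ι m ≤ ι n
  ι-mono-≤ {n = n} ℕ.z≤n = 0≤ι n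
  ι-mono-≤ (ℕ.s≤s m≤n) = +-monoʳ-≤ 1# (ι-mono-≤ m≤n)

  0<ι-suc : ∀ n → 0# < ι (suc n)
  0<ι-suc n = +-pos 0<1 (0≤ι n)

  0<ι : ∀ {n} → 0 ℕ.< n → 0# < ι n
  0<ι {suc n} _ = 0<ι-suc n

  1≤ι : ∀ {n} → 0 ℕ.< n → 1# ≤ ι n
  1≤ι 0<n = ≤-trans (≤-reflexive (sym ι-1)) (ι-mono-≤ 0<n)

  ι-mono-< : ∀ {m n} → m ℕ.< n → ι m < ι n
  ι-mono-< {m} {n} m<n = begin-strict
    ι m  ≈⟨ +-identityˡ _ ⟨
    0# + ι m  <⟨ +-monoˡ-< (ι m) 0<1 ⟩
    ι (suc m)  ≤⟨ ι-mono-≤ m<n ⟩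
    ι n  ∎

  ι-cancel-≤ : ∀ {m n} → ι m ≤ ι n → m ℕ.≤ n
  ι-cancel-≤ ιm≤ιn = ℕ.≮⇒≥ λ n<m → <⇒≱ (ι-mono-< n<m) ιm≤ιn

  ι-cancel-< : ∀ {m n} → ι m < ι n → m ℕ.< n
  ι-cancel-< ιm<ιn = ℕ.≰⇒> λ n≤m → <⇒≱ ιm<ιn (ι-mono-≤ n≤m)

  ι-injective : ∀ {m n} → ι m ≈ ι n → m ≡ n
  ι-injective ιm≈ιn = ℕ.≤-antisym (ι-cancel-≤ (≤-reflexive ιm≈ιn)) (ι-cancel-≤ (≤-reflexive (sym ιm≈ιn)))

  ⁻¹-inverseˡ : ∀ {x} → ¬ x ≈ 0# → x ⁻¹ * x ≈ 1#
  ⁻¹-inverseˡ x≉0 = trans (*-comm _ _) (⁻¹-inverseʳ x≉0)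

  pos⇒≉0 : ∀ {x} → 0# < x → ¬ x ≈ 0#
  pos⇒≉0 = <⇒≉

  *-cancelˡ : ∀ {x y z} → ¬ x ≈ 0# → x * y ≈ x * z → y ≈ z
  *-cancelˡ {x} {y} {z} x≉0 xy≈xz = begin-equality
    y  ≈⟨ *-identityˡ y ⟨
    1# * y  ≈⟨ *-congʳ (⁻¹-inverseˡ x≉0) ⟨
    x ⁻¹ * x * y  ≈⟨ *-assoc _ _ _ ⟩
    x ⁻¹ * (x * y)  ≈⟨ *-congˡ xy≈xz ⟩
    x ⁻¹ * (x * z)  ≈⟨ *-assoc _ _ _ ⟨
    x ⁻¹ * x * z  ≈⟨ *-congʳ (⁻¹-inverseˡ x≉0) ⟩
    1# * z  ≈⟨ *-identityˡ z ⟩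
    z  ∎

  ⁻¹-unique : ∀ {x y} → ¬ x ≈ 0# → x * y ≈ 1# → y ≈ x ⁻¹
  ⁻¹-unique x≉0 xy≈1 = *-cancelˡ x≉0 (trans xy≈1 (sym (⁻¹-inverseʳ x≉0)))

  *≈0⇒≈0 : ∀ {x y} → ¬ x ≈ 0# → x * y ≈ 0# → y ≈ 0#
  *≈0⇒≈0 x≉0 xy≈0 = *-cancelˡ x≉0 (trans xy≈0 (sym (zeroʳ _)))

  ⁻¹-pos : ∀ {x} → 0# < x → 0# < x ⁻¹
  ⁻¹-pos {x} 0<x = ≰⇒> λ x⁻¹≤0 → <⇒≱ 0<1 (begin
    1#  ≈⟨ ⁻¹-inverseʳ (pos⇒≉0 0<x) ⟨
    x * x ⁻¹  ≤⟨ *-monoˡ-≤ x (<⇒≤ 0<x) x⁻¹≤0 ⟩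
    x * 0#  ≈⟨ zeroʳ x ⟩
    0#  ∎)

  ⁻¹-nonneg : ∀ {x} → 0# < x → 0# ≤ x ⁻¹
  ⁻¹-nonneg 0<x = <⇒≤ (⁻¹-pos 0<x)

  ⁻¹-anti-≤ : ∀ {x y} → 0# < x → x ≤ y → y ⁻¹ ≤ x ⁻¹
  ⁻¹-anti-≤ {x} {y} 0<x x≤y = *-cancelˡ-≤ y 0<y (begin
    y * y ⁻¹  ≈⟨ ⁻¹-inverseʳ (pos⇒≉0 0<y) ⟩
    1#  ≈⟨ ⁻¹-inverseʳ (pos⇒≉0 0<x) ⟨
    x * x ⁻¹  ≤⟨ *-monoʳ-≤ _ (⁻¹-nonneg 0<x) x≤y ⟩
    y * x ⁻¹  ∎)
    where
    0<y : 0# < y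
    0<y = <-≤-trans 0<x x≤y

  ⁻¹-distrib-* : ∀ {x y} → 0# < x → 0# < y → (x * y) ⁻¹ ≈ x ⁻¹ * y ⁻¹
  ⁻¹-distrib-* {x} {y} 0<x 0<y = sym (⁻¹-unique (pos⇒≉0 (*-pos 0<x 0<y)) (begin-equality
    x * y * (x ⁻¹ * y ⁻¹)  ≈⟨ solve 4 (λ x y u v → x :* y :* (u :* v) := (x :* u) :* (y :* v)) refl x y (x ⁻¹) (y ⁻¹) ⟩
    (x * x ⁻¹) * (y * y ⁻¹)  ≈⟨ *-cong (⁻¹-inverseʳ (pos⇒≉0 0<x)) (⁻¹-inverseʳ (pos⇒≉0 0<y)) ⟩
    1# * 1#  ≈⟨ *-identityˡ 1# ⟩
    1#  ∎))

  1⁻¹≈1 : 1# ⁻¹ ≈ 1#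
  1⁻¹≈1 = sym (⁻¹-unique (0≉1 ∘ sym) (*-identityˡ 1#))

  ι1⁻¹≈1 : (ι 1) ⁻¹ ≈ 1#
  ι1⁻¹≈1 = trans (⁻¹-cong ι-1) 1⁻¹≈1

  ½ : Carrier
  ½ = (ι 2) ⁻¹

  0<½ : 0# < ½
  0<½ = ⁻¹-pos (0<ι-suc 1)

  ½+½ : ∀ x → ½ * x + ½ * x ≈ x
  ½+½ x = begin-equality
    ½ * x + ½ * x  ≈⟨ solve 2 (λ h x → h :* x :+ h :* x := (con (+ 2) :* h) :* x) refl ½ x ⟩
    ι 2 * ½ * x  ≈⟨ *-congʳ (⁻¹-inverseʳ (pos⇒≉0 (0<ι-suc 1))) ⟩
    1# * x  ≈⟨ *-identityˡ x ⟩
    x  ∎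

  ∣∣-cases : ∀ x → (0# ≤ x × ∣ x ∣ ≈ x) ⊎ (x < 0# × ∣ x ∣ ≈ - x)
  ∣∣-cases x with x <? 0#
  ... | yes x<0 = inj₂ (x<0 , refl)
  ... | no  x≮0 = inj₁ (≮⇒≥ x≮0 , refl)

  ∣∣-nonneg : ∀ x → 0# ≤ ∣ x ∣
  ∣∣-nonneg x with ∣∣-cases x
  ... | inj₁ (0≤x , eq) = ≤-trans 0≤x (≤-reflexive (sym eq))
  ... | inj₂ (x<0 , eq) = ≤-trans (<⇒≤ (neg-pos x<0)) (≤-reflexive (sym eq))

  x≤∣x∣ : ∀ x → x ≤ ∣ x ∣
  x≤∣x∣ x with ∣∣-cases x
  ... | inj₁ (0≤x , eq) = ≤-reflexive (sym eq)
  ... | inj₂ (x<0 , eq) = ≤-trans (<⇒≤ x<0) (∣∣-nonneg x)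

  -x≤∣x∣ : ∀ x → - x ≤ ∣ x ∣
  -x≤∣x∣ x with ∣∣-cases x
  ... | inj₂ (x<0 , eq) = ≤-reflexive (sym eq)
  ... | inj₁ (0≤x , eq) = begin
    - x ≤⟨ neg-mono-≤ 0≤x ⟩ - 0# ≈⟨ -0#≈0# ⟩ 0# ≤⟨ ∣∣-nonneg x ⟩ ∣ x ∣ ∎

  ∣∣≤ : ∀ {x y} → x ≤ y → - x ≤ y → ∣ x ∣ ≤ y
  ∣∣≤ {x} x≤y -x≤y with ∣∣-cases x
  ... | inj₁ (_ , eq) = ≤-trans (≤-reflexive eq) x≤y
  ... | inj₂ (_ , eq) = ≤-trans (≤-reflexive eq) -x≤y

  ∣∣-cong : ∀ {x y} → x ≈ y → ∣ x ∣ ≈ ∣ y ∣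
  ∣∣-cong {x} {y} x≈y = ≤-antisym
    (∣∣≤ (≤-trans (≤-reflexive x≈y) (x≤∣x∣ y)) (≤-trans (≤-reflexive (-‿cong x≈y)) (-x≤∣x∣ y)))
    (∣∣≤ (≤-trans (≤-reflexive (sym x≈y)) (x≤∣x∣ x)) (≤-trans (≤-reflexive (-‿cong (sym x≈y))) (-x≤∣x∣ x)))

  nonneg⇒∣x∣≈x : ∀ {x} → 0# ≤ x → ∣ x ∣ ≈ x
  nonneg⇒∣x∣≈x {x} 0≤x with ∣∣-cases x
  ... | inj₁ (_ , eq)   = eq
  ... | inj₂ (x<0 , eq) = contradiction 0≤x (<⇒≱ x<0)

  ∣-x∣≈∣x∣ : ∀ x → ∣ - x ∣ ≈ ∣ x ∣
  ∣-x∣≈∣x∣ x = ≤-antisym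
    (∣∣≤ (-x≤∣x∣ x) (≤-trans (≤-reflexive (-‿involutive x)) (x≤∣x∣ x)))
    (∣∣≤ (≤-trans (≤-reflexive (sym (-‿involutive x))) (-x≤∣x∣ (- x))) (x≤∣x∣ (- x)))

  ∣x-y∣≈∣y-x∣ : ∀ x y → ∣ x - y ∣ ≈ ∣ y - x ∣
  ∣x-y∣≈∣y-x∣ x y = trans (∣∣-cong (solve 2 (λ x y → x :- y := :- (y :- x)) refl x y)) (∣-x∣≈∣x∣ (y - x))

  ∣∣-triangle : ∀ x y → ∣ x + y ∣ ≤ ∣ x ∣ + ∣ y ∣
  ∣∣-triangle x y = ∣∣≤ (+-mono-≤ (x≤∣x∣ x) (x≤∣x∣ y))
    (≤-trans (≤-reflexive (solve 2 (λ x y → :- (x :+ y) := :- x :+ :- y) refl x y)) (+-mono-≤ (-x≤∣x∣ x) (-x≤∣x∣ y)))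

  ∣∣-* : ∀ x y → ∣ x * y ∣ ≈ ∣ x ∣ * ∣ y ∣
  ∣∣-* x y with ∣∣-cases x | ∣∣-cases y
  ... | inj₁ (0≤x , p) | inj₁ (0≤y , q) = trans (nonneg⇒∣x∣≈x (*-nonneg 0≤x 0≤y)) (sym (*-cong p q))
  ... | inj₁ (0≤x , p) | inj₂ (y<0 , q) = begin-equality
    ∣ x * y ∣  ≈⟨ ∣-x∣≈∣x∣ (x * y) ⟨
    ∣ - (x * y) ∣  ≈⟨ ∣∣-cong (solve 2 (λ x y → :- (x :* y) := x :* :- y) refl x y) ⟩
    ∣ x * - y ∣  ≈⟨ nonneg⇒∣x∣≈x (*-nonneg 0≤x (<⇒≤ (neg-pos y<0))) ⟩
    x * - y  ≈⟨ *-cong p q ⟨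
    ∣ x ∣ * ∣ y ∣  ∎
  ... | inj₂ (x<0 , p) | inj₁ (0≤y , q) = begin-equality
    ∣ x * y ∣  ≈⟨ ∣-x∣≈∣x∣ (x * y) ⟨
    ∣ - (x * y) ∣  ≈⟨ ∣∣-cong (solve 2 (λ x y → :- (x :* y) := :- x :* y) refl x y) ⟩
    ∣ - x * y ∣  ≈⟨ nonneg⇒∣x∣≈x (*-nonneg (<⇒≤ (neg-pos x<0)) 0≤y) ⟩
    - x * y  ≈⟨ *-cong p q ⟨
    ∣ x ∣ * ∣ y ∣  ∎
  ... | inj₂ (x<0 , p) | inj₂ (y<0 , q) = begin-equality
    ∣ x * y ∣  ≈⟨ ∣∣-cong (solve 2 (λ x y → x :* y := :- x :* :- y) refl x y) ⟩
    ∣ - x * - y ∣  ≈⟨ nonneg⇒∣x∣≈x (*-nonneg (<⇒≤ (neg-pos x<0)) (<⇒≤ (neg-pos y<0))) ⟩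
    - x * - y  ≈⟨ *-cong p q ⟨
    ∣ x ∣ * ∣ y ∣  ∎

  floor : ∀ x → 0# ≤ x → ∃ λ n → ι n ≤ x × x < ι (suc n)
  floor x 0≤x with archimedean x
  ... | N , x<N = go N x<N
    where
    go : ∀ N → x < ι N → ∃ λ n → ι n ≤ x × x < ι (suc n)
    go zero    x<0 = contradiction 0≤x (<⇒≱ x<0)
    go (suc N) x<N with <-≤-dichotomy x (ι N)
    ... | inj₁ x<N′ = go N x<N′
    ... | inj₂ N≤x  = N , N≤x , x<N

  -- Limits

  ⟶-cong : ∀ {s t l m} → (∀ n → s n ≈ t n) → l ≈ m → s ⟶ l → t ⟶ m
  ⟶-cong {s} {t} {l} {m} s≈t l≈m s⟶l ε 0<ε with s⟶l ε 0<ε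
  ... | N , close = N , λ n N≤n → begin-strict
    ∣ t n - m ∣  ≈⟨ ∣∣-cong (+-cong (sym (s≈t n)) (-‿cong (sym l≈m))) ⟩
    ∣ s n - l ∣  <⟨ close n N≤n ⟩
    ε  ∎

  ⟶-const : ∀ l → (λ _ → l) ⟶ l
  ⟶-const l ε 0<ε = 0 , λ _ _ → begin-strict
    ∣ l - l ∣  ≈⟨ ∣∣-cong (-‿inverseʳ l) ⟩
    ∣ 0# ∣  ≈⟨ nonneg⇒∣x∣≈x ≤-refl ⟩
    0#  <⟨ 0<ε ⟩
    ε  ∎

  ⟶-eventually-const : ∀ {s l} → (∀ n → s (suc n) ≈ l) → s ⟶ l
  ⟶-eventually-const {s} {l} s≈l ε 0<ε = 1 , λ { (suc n) _ → begin-strict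
    ∣ s (suc n) - l ∣  ≈⟨ ∣∣-cong (trans (+-congʳ (s≈l n)) (-‿inverseʳ l)) ⟩
    ∣ 0# ∣  ≈⟨ nonneg⇒∣x∣≈x ≤-refl ⟩
    0#  <⟨ 0<ε ⟩
    ε  ∎ }

  ⟶-+ : ∀ {s t l m} → s ⟶ l → t ⟶ m → (λ n → s n + t n) ⟶ (l + m)
  ⟶-+ {s} {t} {l} {m} s⟶l t⟶m ε 0<ε =
    let M , p = s⟶l (½ * ε) (*-pos 0<½ 0<ε)
        N , q = t⟶m (½ * ε) (*-pos 0<½ 0<ε)
    in M ℕ.⊔ N , λ n le → bound n (p n (ℕ.≤-trans (ℕ.m≤m⊔n M N) le)) (q n (ℕ.≤-trans (ℕ.m≤n⊔m M N) le))
    where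
    bound : ∀ n → ∣ s n - l ∣ < ½ * ε → ∣ t n - m ∣ < ½ * ε → ∣ s n + t n - (l + m) ∣ < ε
    bound n s-close t-close = begin-strict
      ∣ s n + t n - (l + m) ∣  ≈⟨ ∣∣-cong (solve 4 (λ s t l m → s :+ t :- (l :+ m) := (s :- l) :+ (t :- m)) refl (s n) (t n) l m) ⟩
      ∣ (s n - l) + (t n - m) ∣  ≤⟨ ∣∣-triangle _ _ ⟩
      ∣ s n - l ∣ + ∣ t n - m ∣  <⟨ +-mono-<-≤ s-close (<⇒≤ t-close) ⟩
      ½ * ε + ½ * ε  ≈⟨ ½+½ ε ⟩
      ε  ∎

  ⟶-*ˡ : ∀ {s l} k → s ⟶ l → (λ n → k * s n) ⟶ (k * l)
  ⟶-*ˡ {s} {l} k s⟶l ε 0<ε =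
    let N , close = s⟶l (K ⁻¹ * ε) (*-pos (⁻¹-pos 0<K) 0<ε) in N , λ n N≤n → bound n (close n N≤n)
    where
    K : Carrier
    K = ι 1 + ∣ k ∣
    0<K : 0# < K
    0<K = +-pos (0<ι-suc 0) (∣∣-nonneg k)
    bound : ∀ n → ∣ s n - l ∣ < K ⁻¹ * ε → ∣ k * s n - k * l ∣ < ε
    bound n close = begin-strict
      ∣ k * s n - k * l ∣  ≈⟨ ∣∣-cong (solve 3 (λ k s l → k :* s :- k :* l := k :* (s :- l)) refl k (s n) l) ⟩
      ∣ k * (s n - l) ∣  ≈⟨ ∣∣-* k _ ⟩
      ∣ k ∣ * ∣ s n - l ∣  ≤⟨ ≤-by ∣ s n - l ∣ (∣∣-nonneg _) (solve 2 (λ k d → (con (+ 1) :+ k) :* d := k :* d :+ d) refl ∣ k ∣ ∣ s n - l ∣) ⟩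
      K * ∣ s n - l ∣  <⟨ *-monoˡ-< K 0<K close ⟩
      K * (K ⁻¹ * ε)  ≈⟨ *-assoc _ _ _ ⟨
      K * K ⁻¹ * ε  ≈⟨ *-congʳ (⁻¹-inverseʳ (pos⇒≉0 0<K)) ⟩
      1# * ε  ≈⟨ *-identityˡ ε ⟩
      ε  ∎

  ⟶-neg : ∀ {s l} → s ⟶ l → (λ n → - s n) ⟶ (- l)
  ⟶-neg {s} {l} s⟶l = ⟶-cong (λ n → neg-one (s n)) (neg-one l) (⟶-*ˡ (- 1#) s⟶l)
    where
    neg-one : ∀ x → - 1# * x ≈ - x
    neg-one x = trans (*-congʳ (-‿cong (sym ι-1))) (solve 1 (λ x → :- con (+ 1) :* x := :- x) refl x)

  ⟶-minus : ∀ {s t l m} → s ⟶ l → t ⟶ m → (λ n → s n - t n) ⟶ (l - m)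
  ⟶-minus s⟶l t⟶m = ⟶-+ s⟶l (⟶-neg t⟶m)

  ⟶-difference : ∀ {s l} → s ⟶ l → (λ n → s n - l) ⟶ 0#
  ⟶-difference {s} {l} s⟶l = ⟶-cong (λ _ → refl) (-‿inverseʳ l) (⟶-minus s⟶l (⟶-const l))

  null-* : ∀ {s t} → s ⟶ 0# → t ⟶ 0# → (λ n → s n * t n) ⟶ 0#
  null-* {s} {t} s⟶0 t⟶0 ε 0<ε with s⟶0 1# 0<1 | t⟶0 ε 0<ε
  ... | M , p | N , q = M ℕ.⊔ N , λ n le → begin-strict
    ∣ s n * t n - 0# ∣  ≈⟨ ∣∣-cong (solve 2 (λ s t → s :* t :- con (+ 0) := (s :- con (+ 0)) :* (t :- con (+ 0))) refl (s n) (t n)) ⟩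
    ∣ (s n - 0#) * (t n - 0#) ∣  ≈⟨ ∣∣-* _ _ ⟩
    ∣ s n - 0# ∣ * ∣ t n - 0# ∣  ≤⟨ *-monoʳ-≤ _ (∣∣-nonneg _) (<⇒≤ (p n (ℕ.≤-trans (ℕ.m≤m⊔n M N) le))) ⟩
    1# * ∣ t n - 0# ∣  ≈⟨ *-identityˡ _ ⟩
    ∣ t n - 0# ∣  <⟨ q n (ℕ.≤-trans (ℕ.m≤n⊔m M N) le) ⟩
    ε  ∎

  -- Splitting off (s - l)(t - m), a product of two null sequences, leaves terms that are linear in
  -- s and t.
  ⟶-* : ∀ {s t l m} → s ⟶ l → t ⟶ m → (λ n → s n * t n) ⟶ (l * m)
  ⟶-* {s} {t} {l} {m} s⟶l t⟶m = ⟶-cong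
    (λ n → solve 4 (λ s t l m → (s :- l) :* (t :- m) :+ (l :* t :+ m :* s) :- l :* m := s :* t) refl (s n) (t n) l m)
    (solve 2 (λ l m → con (+ 0) :+ (l :* m :+ m :* l) :- l :* m := l :* m) refl l m)
    (⟶-minus (⟶-+ (null-* (⟶-difference s⟶l) (⟶-difference t⟶m)) (⟶-+ (⟶-*ˡ l t⟶m) (⟶-*ˡ m s⟶l))) (⟶-const (l * m)))

  squeeze : ∀ {s t u l} → (∀ n → ∣ s n - t n ∣ ≤ u n) → u ⟶ 0# → s ⟶ l → t ⟶ l
  squeeze {s} {t} {u} {l} bound u⟶0 s⟶l = ⟶-cong
    (λ n → solve 2 (λ s t → s :- (s :- t) := t) refl (s n) (t n))
    (solve 1 (λ l → l :- con (+ 0) := l) refl l)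
    (⟶-minus s⟶l null)
    where
    null : (λ n → s n - t n) ⟶ 0#
    null ε 0<ε with u⟶0 ε 0<ε
    ... | N , close = N , λ n N≤n → begin-strict
      ∣ s n - t n - 0# ∣  ≈⟨ ∣∣-cong (solve 1 (λ x → x :- con (+ 0) := x) refl (s n - t n)) ⟩
      ∣ s n - t n ∣  ≤⟨ bound n ⟩
      u n  ≈⟨ solve 1 (λ x → x := x :- con (+ 0)) refl (u n) ⟩
      u n - 0#  ≤⟨ x≤∣x∣ _ ⟩
      ∣ u n - 0# ∣  <⟨ close n N≤n ⟩
      ε  ∎

  limit-≤ : ∀ {s l b} N → (∀ n → N ℕ.≤ n → s n ≤ b) → s ⟶ l → l ≤ b
  limit-≤ {s} {l} {b} N s≤b s⟶l = ≮⇒≥ λ b<l →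
    let M , close = s⟶l (l - b) (x<y⇒0<y-x b<l)
        n = M ℕ.⊔ N
    in <⇒≱ (close n (ℕ.m≤m⊔n M N)) (begin
      l - b  ≤⟨ +-monoʳ-≤ l (neg-mono-≤ (s≤b n (ℕ.m≤n⊔m M N))) ⟩
      l - s n  ≤⟨ x≤∣x∣ _ ⟩
      ∣ l - s n ∣  ≈⟨ ∣x-y∣≈∣y-x∣ l (s n) ⟩
      ∣ s n - l ∣  ∎)

  limit-≥ : ∀ {s l b} N → (∀ n → N ℕ.≤ n → b ≤ s n) → s ⟶ l → b ≤ l
  limit-≥ {s} {l} {b} N b≤s s⟶l = ≮⇒≥ λ l<b →
    let M , close = s⟶l (b - l) (x<y⇒0<y-x l<b)
        n = M ℕ.⊔ N
    in <⇒≱ (close n (ℕ.m≤m⊔n M N)) (begin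
      b - l  ≤⟨ +-monoˡ-≤ (- l) (b≤s n (ℕ.m≤n⊔m M N)) ⟩
      s n - l  ≤⟨ x≤∣x∣ _ ⟩
      ∣ s n - l ∣  ∎)

  ⟶-unique : ∀ {s l m} → s ⟶ l → s ⟶ m → l ≈ m
  ⟶-unique {s} {l} {m} s⟶l s⟶m = begin-equality
    l  ≈⟨ solve 2 (λ l m → l := m :+ (l :- m)) refl l m ⟩
    m + (l - m)  ≈⟨ +-congˡ (≤-antisym (limit-≤ 0 (λ n _ → ≤-reflexive (-‿inverseʳ (s n))) diff)
                                       (limit-≥ 0 (λ n _ → ≤-reflexive (sym (-‿inverseʳ (s n)))) diff)) ⟩
    m + 0#  ≈⟨ +-identityʳ m ⟩
    m  ∎
    where
    diff : (λ n → s n - s n) ⟶ (l - m)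
    diff = ⟶-minus s⟶l s⟶m

  reciprocals-null : (λ n → (ι (suc n)) ⁻¹) ⟶ 0#
  reciprocals-null ε 0<ε with archimedean (ε ⁻¹)
  ... | N , ε⁻¹<N = N , λ n N≤n → begin-strict
    ∣ (ι (suc n)) ⁻¹ - 0# ∣  ≈⟨ ∣∣-cong (solve 1 (λ x → x :- con (+ 0) := x) refl _) ⟩
    ∣ (ι (suc n)) ⁻¹ ∣  ≈⟨ nonneg⇒∣x∣≈x (⁻¹-nonneg (0<ι-suc n)) ⟩
    (ι (suc n)) ⁻¹  ≈⟨ *-identityʳ _ ⟨
    (ι (suc n)) ⁻¹ * 1#  ≈⟨ *-congˡ (⁻¹-inverseʳ (pos⇒≉0 0<ε)) ⟨
    (ι (suc n)) ⁻¹ * (ε * ε ⁻¹)  <⟨ *-monoˡ-< _ (⁻¹-pos (0<ι-suc n)) (*-monoˡ-< ε 0<ε (<-≤-trans ε⁻¹<N (ι-mono-≤ (ℕ.m≤n⇒m≤1+n N≤n)))) ⟩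
    (ι (suc n)) ⁻¹ * (ε * ι (suc n))  ≈⟨ solve 3 (λ i e n → i :* (e :* n) := (i :* n) :* e) refl _ _ _ ⟩
    ((ι (suc n)) ⁻¹ * ι (suc n)) * ε  ≈⟨ *-congʳ (⁻¹-inverseˡ (pos⇒≉0 (0<ι-suc n))) ⟩
    1# * ε  ≈⟨ *-identityˡ ε ⟩
    ε  ∎

  -- Complex numbers

  ℂ-commutativeRing : CommutativeRing c ℓ₁
  ℂ-commutativeRing = record
    { Carrier = ℂ
    ; _≈_ = _≈ℂ_
    ; _+_ = _+ℂ_
    ; _*_ = _*ℂ_
    ; -_  = -ℂ_
    ; 0#  = 0ℂ
    ; 1#  = 1ℂ
    ; isCommutativeRing = record
      { isRing = record
        { +-isAbelianGroup = record
          { isGroup = record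
            { isMonoid = record
              { isSemigroup = record
                { isMagma = record
                  { isEquivalence = Setoid.isEquivalence ℂ-setoid
                  ; ∙-cong = λ (p , q) (p′ , q′) → +-cong p p′ , +-cong q q′
                  }
                ; assoc = λ _ _ _ → +-assoc _ _ _ , +-assoc _ _ _
                }
              ; identity = (λ _ → +-identityˡ _ , +-identityˡ _) , (λ _ → +-identityʳ _ , +-identityʳ _)
              }
            ; inverse = (λ _ → -‿inverseˡ _ , -‿inverseˡ _) , (λ _ → -‿inverseʳ _ , -‿inverseʳ _)
            ; ⁻¹-cong = λ (p , q) → -‿cong p , -‿cong q
            }
          ; comm = λ _ _ → +-comm _ _ , +-comm _ _
          }
        ; *-cong = λ (p , q) (p′ , q′) →
            +-cong (*-cong p p′) (-‿cong (*-cong q q′)) , +-cong (*-cong p q′) (*-cong q p′)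
        ; *-assoc = λ (a , b) (a′ , b′) (a″ , b″) →
            solve 6 (λ a b c d e f → (a :* c :- b :* d) :* e :- (a :* d :+ b :* c) :* f
                                  := a :* (c :* e :- d :* f) :- b :* (c :* f :+ d :* e)) refl a b a′ b′ a″ b″ ,
            solve 6 (λ a b c d e f → (a :* c :- b :* d) :* f :+ (a :* d :+ b :* c) :* e
                                  := a :* (c :* f :+ d :* e) :+ b :* (c :* e :- d :* f)) refl a b a′ b′ a″ b″
        ; *-identity =
            (λ (a , b) → trans (+-congʳ (*-identityˡ a)) (solve 2 (λ a b → a :- con (+ 0) :* b := a) refl a b) ,
                         trans (+-congʳ (*-identityˡ b)) (solve 2 (λ a b → b :+ con (+ 0) :* a := b) refl a b)) ,
            (λ (a , b) → trans (+-congʳ (*-identityʳ a)) (solve 2 (λ a b → a :- b :* con (+ 0) := a) refl a b) ,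
                         trans (+-congˡ (*-identityʳ b)) (solve 2 (λ a b → a :* con (+ 0) :+ b := b) refl a b))
        ; distrib =
            (λ (a , b) (a′ , b′) (a″ , b″) →
              solve 6 (λ a b c d e f → a :* (c :+ e) :- b :* (d :+ f)
                                    := (a :* c :- b :* d) :+ (a :* e :- b :* f)) refl a b a′ b′ a″ b″ ,
              solve 6 (λ a b c d e f → a :* (d :+ f) :+ b :* (c :+ e)
                                    := (a :* d :+ b :* c) :+ (a :* f :+ b :* e)) refl a b a′ b′ a″ b″) ,
            (λ (a , b) (a′ , b′) (a″ , b″) →
              solve 6 (λ a b c d e f → (c :+ e) :* a :- (d :+ f) :* b
                                    := (c :* a :- d :* b) :+ (e :* a :- f :* b)) refl a b a′ b′ a″ b″ ,
              solve 6 (λ a b c d e f → (c :+ e) :* b :+ (d :+ f) :* a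
                                    := (c :* b :+ d :* a) :+ (e :* b :+ f :* a)) refl a b a′ b′ a″ b″)
        }
      ; *-comm = λ (a , b) (a′ , b′) →
          solve 4 (λ a b c d → a :* c :- b :* d := c :* a :- d :* b) refl a b a′ b′ ,
          solve 4 (λ a b c d → a :* d :+ b :* c := c :* b :+ d :* a) refl a b a′ b′
      }
    }

  module ℂ = CommutativeRing ℂ-commutativeRing
  open Algebra.Properties.CommutativeSemiring.Exp ℂ.commutativeSemiring public
    using () renaming (^-congˡ to ^ℂ-congˡ)

  _≈ℂ?_ : ∀ z w → Dec (z ≈ℂ w)
  (a , b) ≈ℂ? (a′ , b′) = (a ≈? a′) ×-dec (b ≈? b′)

  private
    sum-of-squares-pos : ∀ a b → ¬ (a , b) ≈ℂ 0ℂ → 0# < a * a + b * b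
    sum-of-squares-pos a b z≉0 with compare 0# (a * a + b * b)
    ... | tri< 0<s _ _ = 0<s
    ... | tri> _ _ s<0 = contradiction (+-nonneg (square-nonneg a) (square-nonneg b)) (<⇒≱ s<0)
    ... | tri≈ _ 0≈s _ = contradiction (square≈0 a (≤-antisym (≤-trans (≤-by _ (square-nonneg b) refl) (≤-reflexive (sym 0≈s))) (square-nonneg a)) ,
                                        square≈0 b (≤-antisym (≤-trans (≤-by _ (square-nonneg a) (+-comm _ _)) (≤-reflexive (sym 0≈s))) (square-nonneg b))) z≉0
      where
      square≈0 : ∀ x → x * x ≈ 0# → x ≈ 0#
      square≈0 x xx≈0 with x ≈? 0#
      ... | yes x≈0 = x≈0
      ... | no  x≉0 = *≈0⇒≈0 x≉0 xx≈0

  -- Multiplying z w = 0 by the conjugate of z = a + bi gives (a² + b²) w = 0, written out here in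
  -- the two components.
  ℂ-*≈0⇒≈0 : ∀ {z w} → ¬ z ≈ℂ 0ℂ → z *ℂ w ≈ℂ 0ℂ → w ≈ℂ 0ℂ
  ℂ-*≈0⇒≈0 {a , b} {u , v} z≉0 (p , q) =
    *≈0⇒≈0 s≉0 (begin-equality
      (a * a + b * b) * u  ≈⟨ solve 4 (λ a b u v → (a :* a :+ b :* b) :* u := a :* (a :* u :- b :* v) :+ b :* (a :* v :+ b :* u)) refl a b u v ⟩
      a * (a * u - b * v) + b * (a * v + b * u)  ≈⟨ +-cong (*-congˡ p) (*-congˡ q) ⟩
      a * 0# + b * 0#  ≈⟨ solve 2 (λ a b → a :* con (+ 0) :+ b :* con (+ 0) := con (+ 0)) refl a b ⟩
      0#  ∎) ,
    *≈0⇒≈0 s≉0 (begin-equality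
      (a * a + b * b) * v  ≈⟨ solve 4 (λ a b u v → (a :* a :+ b :* b) :* v := a :* (a :* v :+ b :* u) :- b :* (a :* u :- b :* v)) refl a b u v ⟩
      a * (a * v + b * u) - b * (a * u - b * v)  ≈⟨ +-cong (*-congˡ q) (-‿cong (*-congˡ p)) ⟩
      a * 0# - b * 0#  ≈⟨ solve 2 (λ a b → a :* con (+ 0) :- b :* con (+ 0) := con (+ 0)) refl a b ⟩
      0#  ∎)
    where
    s≉0 : ¬ a * a + b * b ≈ 0#
    s≉0 = pos⇒≉0 (sum-of-squares-pos a b z≉0)

  ℂ-zero-product : ∀ {z w} → z *ℂ w ≈ℂ 0ℂ → z ≈ℂ 0ℂ ⊎ w ≈ℂ 0ℂ
  ℂ-zero-product {z} zw≈0 with z ≈ℂ? 0ℂ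
  ... | yes z≈0 = inj₁ z≈0
  ... | no  z≉0 = inj₂ (ℂ-*≈0⇒≈0 z≉0 zw≈0)

  -- The ℓ¹ norm is submultiplicative and needs no square roots.
  opaque
    ‖_‖ : ℂ → Carrier
    ‖ a , b ‖ = ∣ a ∣ + ∣ b ∣

    ‖‖-nonneg : ∀ z → 0# ≤ ‖ z ‖
    ‖‖-nonneg (a , b) = +-nonneg (∣∣-nonneg a) (∣∣-nonneg b)

    ‖‖-cong : ∀ {z w} → z ≈ℂ w → ‖ z ‖ ≈ ‖ w ‖
    ‖‖-cong (p , q) = +-cong (∣∣-cong p) (∣∣-cong q)

    ‖‖-triangle : ∀ z w → ‖ z +ℂ w ‖ ≤ ‖ z ‖ + ‖ w ‖
    ‖‖-triangle (a , b) (u , v) = begin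
      ∣ a + u ∣ + ∣ b + v ∣  ≤⟨ +-mono-≤ (∣∣-triangle a u) (∣∣-triangle b v) ⟩
      (∣ a ∣ + ∣ u ∣) + (∣ b ∣ + ∣ v ∣)  ≈⟨ solve 4 (λ a b u v → (a :+ u) :+ (b :+ v) := (a :+ b) :+ (u :+ v)) refl _ _ _ _ ⟩
      (∣ a ∣ + ∣ b ∣) + (∣ u ∣ + ∣ v ∣)  ∎

    ‖‖-* : ∀ z w → ‖ z *ℂ w ‖ ≤ ‖ z ‖ * ‖ w ‖
    ‖‖-* (a , b) (u , v) = begin
      ∣ a * u - b * v ∣ + ∣ a * v + b * u ∣  ≤⟨ +-mono-≤ (∣∣-triangle _ _) (∣∣-triangle _ _) ⟩
      (∣ a * u ∣ + ∣ - (b * v) ∣) + (∣ a * v ∣ + ∣ b * u ∣)  ≈⟨ +-cong (+-cong (∣∣-* a u) (trans (∣-x∣≈∣x∣ _) (∣∣-* b v))) (+-cong (∣∣-* a v) (∣∣-* b u)) ⟩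
      (∣ a ∣ * ∣ u ∣ + ∣ b ∣ * ∣ v ∣) + (∣ a ∣ * ∣ v ∣ + ∣ b ∣ * ∣ u ∣)  ≈⟨ solve 4 (λ a b u v → (a :* u :+ b :* v) :+ (a :* v :+ b :* u) := (a :+ b) :* (u :+ v)) refl _ _ _ _ ⟩
      (∣ a ∣ + ∣ b ∣) * (∣ u ∣ + ∣ v ∣)  ∎

    ∣re∣≤‖‖ : ∀ z → ∣ proj₁ z ∣ ≤ ‖ z ‖
    ∣re∣≤‖‖ (a , b) = ≤-by ∣ b ∣ (∣∣-nonneg b) refl

    ∣im∣≤‖‖ : ∀ z → ∣ proj₂ z ∣ ≤ ‖ z ‖
    ∣im∣≤‖‖ (a , b) = ≤-by ∣ a ∣ (∣∣-nonneg a) (+-comm _ _)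

    ‖ofℝ‖ : ∀ {x} → 0# ≤ x → ‖ ofℝ x ‖ ≈ x
    ‖ofℝ‖ {x} 0≤x = trans (+-cong (nonneg⇒∣x∣≈x 0≤x) (nonneg⇒∣x∣≈x ≤-refl)) (+-identityʳ x)

    ‖-‖-comm : ∀ z w → ‖ z ℂ.- w ‖ ≈ ‖ w ℂ.- z ‖
    ‖-‖-comm (a , b) (u , v) = +-cong (∣x-y∣≈∣y-x∣ a u) (∣x-y∣≈∣y-x∣ b v)

  ⟶ℂ-cong : ∀ {s t l m} → (∀ n → s n ≈ℂ t n) → l ≈ℂ m → s ⟶ℂ l → t ⟶ℂ m
  ⟶ℂ-cong s≈t (p , q) (s⟶a , s⟶b) = ⟶-cong (λ n → proj₁ (s≈t n)) p s⟶a , ⟶-cong (λ n → proj₂ (s≈t n)) q s⟶b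

  ⟶ℂ-unique : ∀ {s l m} → s ⟶ℂ l → s ⟶ℂ m → l ≈ℂ m
  ⟶ℂ-unique (p , q) (p′ , q′) = ⟶-unique p p′ , ⟶-unique q q′

  ⟶ℂ-* : ∀ {s t l m} → s ⟶ℂ l → t ⟶ℂ m → (λ n → s n *ℂ t n) ⟶ℂ (l *ℂ m)
  ⟶ℂ-* (p , q) (p′ , q′) = ⟶-minus (⟶-* p p′) (⟶-* q q′) , ⟶-+ (⟶-* p q′) (⟶-* q p′)

  ℂ-squeeze : ∀ {s t u l} → (∀ n → ‖ s n ℂ.- t n ‖ ≤ u n) → u ⟶ 0# → s ⟶ℂ l → t ⟶ℂ l
  ℂ-squeeze bound u⟶0 (p , q) =
    squeeze (λ n → ≤-trans (∣re∣≤‖‖ _) (bound n)) u⟶0 p ,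
    squeeze (λ n → ≤-trans (∣im∣≤‖‖ _) (bound n)) u⟶0 q

  ℂ-complete : ∀ s → (∀ ε → 0# < ε → ∃ λ N → ∀ m n → N ℕ.≤ m → N ℕ.≤ n → ‖ s m ℂ.- s n ‖ < ε) → ∃ λ l → s ⟶ℂ l
  ℂ-complete s cauchy =
    let a , s⟶a = complete (λ n → proj₁ (s n)) (λ ε 0<ε → let N , close = cauchy ε 0<ε in
                    N , λ m n N≤m N≤n → ≤-<-trans (∣re∣≤‖‖ _) (close m n N≤m N≤n))
        b , s⟶b = complete (λ n → proj₂ (s n)) (λ ε 0<ε → let N , close = cauchy ε 0<ε in
                    N , λ m n N≤m N≤n → ≤-<-trans (∣im∣≤‖‖ _) (close m n N≤m N≤n))
    in (a , b) , s⟶a , s⟶b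

  -- The exponential series

  open RangeSum commutativeRing
  private module ℂΣ = RangeSum ℂ-commutativeRing

  Σ<-mono : ∀ n {f g} → (∀ i → i ℕ.< n → f i ≤ g i) → Σ< n f ≤ Σ< n g
  Σ<-mono zero    {f} {g} f≤g = ≤-reflexive (trans (Σ<-empty f) (sym (Σ<-empty g)))
  Σ<-mono (suc n) {f} {g} f≤g = begin
    Σ< (suc n) f  ≈⟨ Σ<-snoc n f ⟩
    Σ< n f + f n  ≤⟨ +-mono-≤ (Σ<-mono n (λ i i<n → f≤g i (ℕ.m<n⇒m<1+n i<n))) (f≤g n ℕ.≤-refl) ⟩
    Σ< n g + g n  ≈⟨ Σ<-snoc n g ⟨
    Σ< (suc n) g  ∎

  Σ<-extend : ∀ {m n f} → (∀ i → 0# ≤ f i) → m ℕ.≤ n → Σ< m f ≤ Σ< n f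
  Σ<-extend {m} {n} {f} 0≤f m≤n = go (ℕ.≤⇒≤′ m≤n)
    where
    go : ∀ {n} → m ℕ.≤′ n → Σ< m f ≤ Σ< n f
    go ℕ.≤′-refl = ≤-refl
    go (ℕ.≤′-step {n} m≤n) = ≤-trans (go m≤n) (≤-by (f n) (0≤f n) (Σ<-snoc n f))

  ‖Σ<‖≤ : ∀ n {f g} → (∀ i → ‖ f i ‖ ≤ g i) → ‖ ℂΣ.Σ< n f ‖ ≤ Σ< n g
  ‖Σ<‖≤ zero {f} {g} f≤g = begin
    ‖ ℂΣ.Σ< 0 f ‖  ≈⟨ ‖‖-cong (ℂΣ.Σ<-empty f) ⟩
    ‖ 0ℂ ‖  ≈⟨ ‖ofℝ‖ ≤-refl ⟩
    0#  ≈⟨ Σ<-empty g ⟨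
    Σ< 0 g  ∎
  ‖Σ<‖≤ (suc n) {f} {g} f≤g = begin
    ‖ ℂΣ.Σ< (suc n) f ‖  ≈⟨ ‖‖-cong (ℂΣ.Σ<-snoc n f) ⟩
    ‖ ℂΣ.Σ< n f +ℂ f n ‖  ≤⟨ ‖‖-triangle _ _ ⟩
    ‖ ℂΣ.Σ< n f ‖ + ‖ f n ‖  ≤⟨ +-mono-≤ (‖Σ<‖≤ n f≤g) (f≤g n) ⟩
    Σ< n g + g n  ≈⟨ Σ<-snoc n g ⟨
    Σ< (suc n) g  ∎

  ‖Σ<-tail‖≤ : ∀ {m n f g} → (∀ i → ‖ f i ‖ ≤ g i) → m ℕ.≤ n → ‖ ℂΣ.Σ< n f ℂ.- ℂΣ.Σ< m f ‖ ≤ Σ< n g - Σ< m g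
  ‖Σ<-tail‖≤ {m} {n} {f} {g} f≤g m≤n = go (ℕ.≤⇒≤′ m≤n)
    where
    go : ∀ {n} → m ℕ.≤′ n → ‖ ℂΣ.Σ< n f ℂ.- ℂΣ.Σ< m f ‖ ≤ Σ< n g - Σ< m g
    go ℕ.≤′-refl = begin
      ‖ ℂΣ.Σ< m f ℂ.- ℂΣ.Σ< m f ‖  ≈⟨ ‖‖-cong (ℂ.-‿inverseʳ _) ⟩
      ‖ 0ℂ ‖  ≈⟨ ‖ofℝ‖ ≤-refl ⟩
      0#  ≈⟨ -‿inverseʳ _ ⟨
      Σ< m g - Σ< m g  ∎
    go (ℕ.≤′-step {n} m≤n) = begin
      ‖ ℂΣ.Σ< (suc n) f ℂ.- ℂΣ.Σ< m f ‖  ≈⟨ ‖‖-cong (ℂΣ.Σ<-tail-suc n f (ℂΣ.Σ< m f)) ⟩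
      ‖ (ℂΣ.Σ< n f ℂ.- ℂΣ.Σ< m f) +ℂ f n ‖  ≤⟨ ‖‖-triangle _ _ ⟩
      ‖ ℂΣ.Σ< n f ℂ.- ℂΣ.Σ< m f ‖ + ‖ f n ‖  ≤⟨ +-mono-≤ (go m≤n) (f≤g n) ⟩
      Σ< n g - Σ< m g + g n  ≈⟨ Σ<-tail-suc n g (Σ< m g) ⟨
      Σ< (suc n) g - Σ< m g  ∎

  κ : ℕ → Carrier
  κ n = (ι (n !)) ⁻¹

  0<ι! : ∀ n → 0# < ι (n !)
  0<ι! n = 0<ι (ℕ.1≤n! n)

  κ-zero : κ 0 ≈ 1#
  κ-zero = ι1⁻¹≈1

  κ-suc : ∀ n → ι (suc n) * κ (suc n) ≈ κ n
  κ-suc n = begin-equality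
    ι (suc n) * (ι (suc n ℕ.* n !)) ⁻¹  ≈⟨ *-congˡ (⁻¹-cong (ι-* (suc n) (n !))) ⟩
    ι (suc n) * (ι (suc n) * ι (n !)) ⁻¹  ≈⟨ *-congˡ (⁻¹-distrib-* (0<ι-suc n) (0<ι! n)) ⟩
    ι (suc n) * ((ι (suc n)) ⁻¹ * κ n)  ≈⟨ *-assoc _ _ _ ⟨
    ι (suc n) * (ι (suc n)) ⁻¹ * κ n  ≈⟨ *-congʳ (⁻¹-inverseʳ (pos⇒≉0 (0<ι-suc n))) ⟩
    1# * κ n  ≈⟨ *-identityˡ _ ⟩
    κ n  ∎

  ν : ℕ → Carrier
  ν n = (ι (suc n)) ⁻¹

  ν-inverse : ∀ n → ν n * ι (suc n) ≈ 1#
  ν-inverse n = ⁻¹-inverseˡ (pos⇒≉0 (0<ι-suc n))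

  ofℝ-* : ∀ x y → ofℝ x *ℂ ofℝ y ≈ℂ ofℝ (x * y)
  ofℝ-* x y = solve 2 (λ x y → x :* y :- con (+ 0) :* con (+ 0) := x :* y) refl x y ,
              solve 2 (λ x y → x :* con (+ 0) :+ con (+ 0) :* y := con (+ 0)) refl x y

  ofℝ-cong : ∀ {x y} → x ≈ y → ofℝ x ≈ℂ ofℝ y
  ofℝ-cong x≈y = x≈y , refl

  ofℝ-+ : ∀ x y → ofℝ x +ℂ ofℝ y ≈ℂ ofℝ (x + y)
  ofℝ-+ x y = refl , +-identityˡ 0#

  ·ℂ-ofℝ : ∀ n → n ·ℂ 1ℂ ≈ℂ ofℝ (ι n)
  ·ℂ-ofℝ zero    = refl , refl
  ·ℂ-ofℝ (suc n) = ℂ.trans (ℂ.+-congˡ (·ℂ-ofℝ n)) (ofℝ-+ 1# (ι n))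

  open Exponential.Terms commutativeRing κ ν κ-zero κ-suc ν-inverse
  private
    module ℂE = Exponential.Terms ℂ-commutativeRing (ofℝ ∘ κ) (ofℝ ∘ ν) (ofℝ-cong κ-zero)
      (λ n → ℂ.trans (ℂ.*-congʳ (·ℂ-ofℝ (suc n))) (ℂ.trans (ofℝ-* _ _) (ofℝ-cong (κ-suc n))))
      (λ n → ℂ.trans (ℂ.*-congˡ (·ℂ-ofℝ (suc n))) (ℂ.trans (ofℝ-* _ _) (ofℝ-cong (ν-inverse n))))

  0≤κ : ∀ n → 0# ≤ κ n
  0≤κ n = ⁻¹-nonneg (0<ι! n)

  term-nonneg : ∀ {x} → 0# ≤ x → ∀ n → 0# ≤ term x n
  term-nonneg 0≤x n = *-nonneg (0≤κ n) (^-nonneg n 0≤x)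

  ‖^‖≤ : ∀ z n → ‖ z ^ℂ n ‖ ≤ ‖ z ‖ ^ n
  ‖^‖≤ z zero    = ≤-reflexive (‖ofℝ‖ 0≤1)
  ‖^‖≤ z (suc n) = ≤-trans (‖‖-* z (z ^ℂ n)) (*-monoˡ-≤ _ (‖‖-nonneg z) (‖^‖≤ z n))

  ‖term‖≤ : ∀ z n → ‖ ℂE.term z n ‖ ≤ term ‖ z ‖ n
  ‖term‖≤ z n = begin
    ‖ ofℝ (κ n) *ℂ z ^ℂ n ‖  ≤⟨ ‖‖-* _ _ ⟩
    ‖ ofℝ (κ n) ‖ * ‖ z ^ℂ n ‖  ≈⟨ *-congʳ (‖ofℝ‖ (0≤κ n)) ⟩
    κ n * ‖ z ^ℂ n ‖  ≤⟨ *-monoˡ-≤ _ (0≤κ n) (‖^‖≤ z n) ⟩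
    κ n * ‖ z ‖ ^ n  ∎

  triangle-term : ∀ x y n → triangle (term x) (term y) n ≈ Σ< n (term (x + y))
  triangle-term x y n = trans (triangle≈Σ-convolution (term x) (term y) n) (Σ<-cong n (λ i _ → sym (term-+ x y i)))

  -- The square i, j < n lies inside the triangle i + j < 2n.
  square≤triangle : ∀ {a b} → (∀ i → 0# ≤ a i) → (∀ i → 0# ≤ b i) → ∀ n → Σ< n a * Σ< n b ≤ triangle a b (n ℕ.+ n)
  square≤triangle {a} {b} 0≤a 0≤b n = begin
    Σ< n a * Σ< n b  ≈⟨ Σ<-*ʳ n _ a ⟩
    Σ< n (λ i → a i * Σ< n b)  ≤⟨ Σ<-mono n (λ i i<n → *-monoˡ-≤ _ (0≤a i) (Σ<-extend 0≤b
                                                            (ℕ.≤-trans (ℕ.≤-reflexive (≡.sym (ℕ.m+n∸n≡m n n))) (ℕ.∸-monoʳ-≤ (n ℕ.+ n) (ℕ.<⇒≤ i<n))))) ⟩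
    Σ< n (λ i → a i * Σ< (n ℕ.+ n ℕ.∸ i) b)  ≤⟨ Σ<-extend (λ i → *-nonneg (0≤a i) (≤-trans (≤-reflexive (sym (Σ<-empty b))) (Σ<-extend 0≤b ℕ.z≤n))) (ℕ.m≤m+n n n) ⟩
    triangle a b (n ℕ.+ n)  ∎

  -- By submultiplicativity the error is at most that of the real series at ‖z‖ and ‖w‖. There the
  -- square lies between the triangles of sizes n and 2n, whose sums are partial sums of the series
  -- at r.
  ‖product-error‖≤ : ∀ z w n → let r = ‖ z ‖ + ‖ w ‖ in
    ‖ ℂΣ.Σ< n (ℂE.term z) *ℂ ℂΣ.Σ< n (ℂE.term w) ℂ.- ℂΣ.Σ< n (ℂE.term (z +ℂ w)) ‖ ≤ Σ< (n ℕ.+ n) (term r) - Σ< n (term r)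
  ‖product-error‖≤ z w n = begin
    ‖ ℂΣ.Σ< n (ℂE.term z) *ℂ ℂΣ.Σ< n (ℂE.term w) ℂ.- ℂΣ.Σ< n (ℂE.term (z +ℂ w)) ‖
      ≈⟨ ‖‖-cong (ℂE.product-error z w n) ⟩
    ‖ ℂΣ.Σ< n (λ i → ℂE.term z i *ℂ (ℂΣ.Σ< n (ℂE.term w) ℂ.- ℂΣ.Σ< (n ℕ.∸ i) (ℂE.term w))) ‖
      ≤⟨ ‖Σ<‖≤ n (λ i → ≤-trans (‖‖-* _ _) (*-mono-≤ (‖‖-nonneg (ℂE.term z i)) (‖‖-nonneg _) (‖term‖≤ z i) (‖Σ<-tail‖≤ (‖term‖≤ w) (ℕ.m∸n≤m n i)))) ⟩
    Σ< n (λ i → term ‖ z ‖ i * (Σ< n (term ‖ w ‖) - Σ< (n ℕ.∸ i) (term ‖ w ‖)))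
      ≈⟨ square-triangle _ _ n ⟨
    Σ< n (term ‖ z ‖) * Σ< n (term ‖ w ‖) - triangle (term ‖ z ‖) (term ‖ w ‖) n
      ≤⟨ +-monoˡ-≤ _ (square≤triangle (term-nonneg (‖‖-nonneg z)) (term-nonneg (‖‖-nonneg w)) n) ⟩
    triangle (term ‖ z ‖) (term ‖ w ‖) (n ℕ.+ n) - triangle (term ‖ z ‖) (term ‖ w ‖) n
      ≈⟨ +-cong (triangle-term _ _ (n ℕ.+ n)) (-‿cong (triangle-term _ _ n)) ⟩
    Σ< (n ℕ.+ n) (term (‖ z ‖ + ‖ w ‖)) - Σ< n (term (‖ z ‖ + ‖ w ‖))
      ∎

  module _ (r : Carrier) (0≤r : 0# ≤ r) where
    private
      K = proj₁ (archimedean (ι 2 * r))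
      2r<K : ι 2 * r < ι K
      2r<K = proj₂ (archimedean (ι 2 * r))

      t : ℕ → Carrier
      t = term r

      0≤t : ∀ n → 0# ≤ t n
      0≤t = term-nonneg 0≤r

      -- Consecutive terms have the ratio r/(n + 1), which is below 1/2 because K > 2r.
      halving : ∀ n → K ℕ.≤ n → ι 2 * t (suc n) ≤ t n
      halving n K≤n = *-cancelˡ-≤ (ι (suc n)) (0<ι-suc n) (begin
        ι (suc n) * (ι 2 * t (suc n))  ≈⟨ solve 3 (λ m a b → m :* (a :* b) := a :* (m :* b)) refl _ _ _ ⟩
        ι 2 * (ι (suc n) * t (suc n))  ≈⟨ *-congˡ (term-suc r n) ⟩
        ι 2 * (r * t n)  ≈⟨ *-assoc _ _ _ ⟨
        ι 2 * r * t n  ≤⟨ *-monoʳ-≤ (t n) (0≤t n) (≤-trans (<⇒≤ 2r<K) (ι-mono-≤ (ℕ.m≤n⇒m≤1+n K≤n))) ⟩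
        ι (suc n) * t n  ∎)

      -- The partial sum together with 2 t n, the bound on the remainder given by a geometric series
      -- of ratio 1/2. As Φ decreases from K on, it dominates all later partial sums.
      Φ : ℕ → Carrier
      Φ n = Σ< n t + ι 2 * t n

      Φ-anti : ∀ {m n} → K ℕ.≤ m → m ℕ.≤ n → Φ n ≤ Φ m
      Φ-anti {m} K≤m m≤n = go (ℕ.≤⇒≤′ m≤n)
        where
        go : ∀ {n} → m ℕ.≤′ n → Φ n ≤ Φ m
        go ℕ.≤′-refl = ≤-refl
        go (ℕ.≤′-step {n} m≤n) = begin
          Σ< (suc n) t + ι 2 * t (suc n)  ≈⟨ +-congʳ (Σ<-snoc n t) ⟩
          Σ< n t + t n + ι 2 * t (suc n)  ≤⟨ +-monoʳ-≤ _ (halving n (ℕ.≤-trans K≤m (ℕ.≤′⇒≤ m≤n))) ⟩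
          Σ< n t + t n + t n  ≈⟨ solve 2 (λ s t → s :+ t :+ t := s :+ con (+ 2) :* t) refl _ _ ⟩
          Φ n  ≤⟨ go m≤n ⟩
          Φ m  ∎

      t-bound : ∀ n → K ℕ.≤ n → t n ≤ t K
      t-bound n K≤n = go (ℕ.≤⇒≤′ K≤n)
        where
        go : ∀ {n} → K ℕ.≤′ n → t n ≤ t K
        go ℕ.≤′-refl = ≤-refl
        go (ℕ.≤′-step {n} K≤n) = begin
          t (suc n)  ≤⟨ ≤-by (t (suc n)) (0≤t (suc n)) (solve 1 (λ t → con (+ 2) :* t := t :+ t) refl _) ⟩
          ι 2 * t (suc n)  ≤⟨ halving n (ℕ.≤′⇒≤ K≤n) ⟩
          t n  ≤⟨ go K≤n ⟩
          t K  ∎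

      -- Since t (n + 1) = r t n / (n + 1) and t n stays below t K, the bound on the remainder is
      -- O(1/n), and `reciprocals-null` applies.
      t-decay : ∀ n → K ℕ.≤ n → ι 2 * t (suc n) ≤ ι 2 * r * t K * (ι (suc n)) ⁻¹
      t-decay n K≤n = begin
        ι 2 * t (suc n)  ≈⟨ *-identityˡ _ ⟨
        1# * (ι 2 * t (suc n))  ≈⟨ *-congʳ (ν-inverse n) ⟨
        ν n * ι (suc n) * (ι 2 * t (suc n))  ≈⟨ solve 4 (λ v m a t → v :* m :* (a :* t) := a :* (m :* t) :* v) refl _ _ _ _ ⟩
        ι 2 * (ι (suc n) * t (suc n)) * ν n  ≈⟨ *-congʳ (*-congˡ (term-suc r n)) ⟩
        ι 2 * (r * t n) * ν n  ≤⟨ *-monoʳ-≤ _ (⁻¹-nonneg (0<ι-suc n)) (*-monoˡ-≤ _ (0≤ι 2) (*-monoˡ-≤ r 0≤r (t-bound n K≤n))) ⟩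
        ι 2 * (r * t K) * ν n  ≈⟨ *-congʳ (*-assoc _ _ _) ⟨
        ι 2 * r * t K * ν n  ∎

    exp-tail-small : ∀ ε → 0# < ε → ∃ λ N → ∀ m n → N ℕ.≤ m → m ℕ.≤ n → Σ< n (term r) - Σ< m (term r) < ε
    exp-tail-small ε 0<ε =
      let N , close = bound⟶0 ε 0<ε in
      -- The successor is there because `t-decay` bounds a term of index m + 1 by a multiple of 1/(m
      -- + 1) = ν m.
      suc (N ℕ.⊔ K) , λ { (suc m) n (ℕ.s≤s N⊔K≤m) m<n →
        ≤-<-trans (tail-bound m n (ℕ.≤-trans (ℕ.m≤n⊔m N K) N⊔K≤m) m<n)
                  (≤-<-trans (x≤∣x-0∣ _) (close m (ℕ.≤-trans (ℕ.m≤m⊔n N K) N⊔K≤m))) }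
      where
      C : Carrier
      C = ι 2 * r * t K

      bound⟶0 : (λ n → C * ν n) ⟶ 0#
      bound⟶0 = ⟶-cong (λ _ → refl) (zeroʳ C) (⟶-*ˡ C reciprocals-null)

      x≤∣x-0∣ : ∀ x → x ≤ ∣ x - 0# ∣
      x≤∣x-0∣ x = ≤-trans (≤-reflexive (solve 1 (λ x → x := x :- con (+ 0)) refl x)) (x≤∣x∣ _)

      tail-bound : ∀ m n → K ℕ.≤ m → m ℕ.< n → Σ< n t - Σ< (suc m) t ≤ C * ν m
      tail-bound m n K≤m m<n = begin
        Σ< n t - Σ< (suc m) t  ≤⟨ +-monoˡ-≤ _ (≤-by (ι 2 * t n) (*-nonneg (0≤ι 2) (0≤t n)) refl) ⟩
        Φ n - Σ< (suc m) t  ≤⟨ +-monoˡ-≤ _ (Φ-anti (ℕ.m≤n⇒m≤1+n K≤m) m<n) ⟩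
        Φ (suc m) - Σ< (suc m) t  ≈⟨ solve 2 (λ s t → s :+ t :- s := t) refl (Σ< (suc m) t) (ι 2 * t (suc m)) ⟩
        ι 2 * t (suc m)  ≤⟨ t-decay m K≤m ⟩
        C * ν m  ∎

  toExpℂ : ∀ {z w} → (λ n → ℂΣ.Σ< n (ℂE.term z)) ⟶ℂ w → IsExpℂ z w
  toExpℂ {z} = ⟶ℂ-cong (λ n → ℂ.reflexive (ℂΣ.Σ<≡sum n (ℂE.term z))) ℂ.refl

  fromExpℂ : ∀ {z w} → IsExpℂ z w → (λ n → ℂΣ.Σ< n (ℂE.term z)) ⟶ℂ w
  fromExpℂ {z} = ⟶ℂ-cong (λ n → ℂ.reflexive (≡.sym (ℂΣ.Σ<≡sum n (ℂE.term z)))) ℂ.refl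

  opaque
    expℂ-exists : ∀ z → ∃ λ w → IsExpℂ z w
    expℂ-exists z = let w , lim = ℂ-complete (λ n → ℂΣ.Σ< n (ℂE.term z)) cauchy in w , toExpℂ {z} {w} lim
      where
      cauchy : ∀ ε → 0# < ε → ∃ λ N → ∀ m n → N ℕ.≤ m → N ℕ.≤ n → ‖ ℂΣ.Σ< m (ℂE.term z) ℂ.- ℂΣ.Σ< n (ℂE.term z) ‖ < ε
      cauchy ε 0<ε = let N , small = exp-tail-small ‖ z ‖ (‖‖-nonneg z) ε 0<ε in N , bound N small
        where
        bound : ∀ N → (∀ m n → N ℕ.≤ m → m ℕ.≤ n → Σ< n (term ‖ z ‖) - Σ< m (term ‖ z ‖) < ε) →
                ∀ m n → N ℕ.≤ m → N ℕ.≤ n → ‖ ℂΣ.Σ< m (ℂE.term z) ℂ.- ℂΣ.Σ< n (ℂE.term z) ‖ < ε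
        bound N small m n N≤m N≤n with ℕ.≤-total n m
        ... | inj₁ n≤m = ≤-<-trans (‖Σ<-tail‖≤ (‖term‖≤ z) n≤m) (small n m N≤n n≤m)
        ... | inj₂ m≤n = ≤-<-trans
          (≤-trans (≤-reflexive (‖-‖-comm (ℂΣ.Σ< m (ℂE.term z)) (ℂΣ.Σ< n (ℂE.term z)))) (‖Σ<-tail‖≤ (‖term‖≤ z) m≤n)) (small m n N≤m m≤n)

  expℂ-unique : ∀ {z w w′} → IsExpℂ z w → IsExpℂ z w′ → w ≈ℂ w′
  expℂ-unique = ⟶ℂ-unique

  expℂ-cong : ∀ {z z′ w w′} → z ≈ℂ z′ → w ≈ℂ w′ → IsExpℂ z w → IsExpℂ z′ w′
  expℂ-cong z≈z′ w≈w′ e = toExpℂ (⟶ℂ-cong (λ n → ℂΣ.Σ<-cong n (λ i _ → ℂ.*-congˡ (^ℂ-congˡ i z≈z′))) w≈w′ (fromExpℂ e))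

  -- The product of the partial sums differs from the partial sum at z + w by at most the block from
  -- n to 2n of the series of e^r, and this block tends to 0.
  expℂ-+ : ∀ {z w u v} → IsExpℂ z u → IsExpℂ w v → IsExpℂ (z +ℂ w) (u *ℂ v)
  expℂ-+ {z} {w} {u} {v} ez ew = toExpℂ (ℂ-squeeze (‖product-error‖≤ z w) small (⟶ℂ-* (fromExpℂ ez) (fromExpℂ ew)))
    where
    r = ‖ z ‖ + ‖ w ‖
    0≤r : 0# ≤ r
    0≤r = +-nonneg (‖‖-nonneg z) (‖‖-nonneg w)
    small : (λ n → Σ< (n ℕ.+ n) (term r) - Σ< n (term r)) ⟶ 0#
    small ε 0<ε = let N , tail = exp-tail-small r 0≤r ε 0<ε in N , λ n N≤n → begin-strict
      ∣ Σ< (n ℕ.+ n) (term r) - Σ< n (term r) - 0# ∣  ≈⟨ ∣∣-cong (solve 1 (λ x → x :- con (+ 0) := x) refl (Σ< (n ℕ.+ n) (term r) - Σ< n (term r))) ⟩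
      ∣ Σ< (n ℕ.+ n) (term r) - Σ< n (term r) ∣  ≈⟨ nonneg⇒∣x∣≈x (x≤y⇒0≤y-x (Σ<-extend (term-nonneg 0≤r) (ℕ.m≤m+n n n))) ⟩
      Σ< (n ℕ.+ n) (term r) - Σ< n (term r)  <⟨ tail n (n ℕ.+ n) N≤n (ℕ.m≤m+n n n) ⟩
      ε  ∎

  term-0 : ∀ n → 0 ℕ.< n → ℂE.term 0ℂ n ≈ℂ 0ℂ
  term-0 (suc n) _ = ℂ.trans (ℂ.*-congˡ (ℂ.zeroˡ _)) (ℂ.zeroʳ _)

  expℂ-0 : IsExpℂ 0ℂ 1ℂ
  expℂ-0 = toExpℂ (⟶-eventually-const (λ n → proj₁ (value n)) , ⟶-eventually-const (λ n → proj₂ (value n)))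
    where
    value : ∀ n → ℂΣ.Σ< (suc n) (ℂE.term 0ℂ) ≈ℂ 1ℂ
    value zero = ℂ.trans (ℂΣ.Σ<-snoc 0 _) (ℂ.trans (ℂ.+-congʳ (ℂΣ.Σ<-empty _)) (ℂ.trans (ℂ.+-identityˡ _) (ℂ.trans (ℂ.*-identityʳ _) (ofℝ-cong κ-zero))))
    value (suc n) = ℂ.trans (ℂΣ.Σ<-snoc (suc n) _) (ℂ.trans (ℂ.+-cong (value n) (term-0 (suc n) ℕ.z<s)) (ℂ.+-identityʳ _))

  ofℝ-^ : ∀ x n → ofℝ x ^ℂ n ≈ℂ ofℝ (x ^ n)
  ofℝ-^ x zero    = ℂ.refl
  ofℝ-^ x (suc n) = ℂ.trans (ℂ.*-congˡ (ofℝ-^ x n)) (ofℝ-* x (x ^ n))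

  ofℝ-Σ< : ∀ n f → ℂΣ.Σ< n (ofℝ ∘ f) ≈ℂ ofℝ (Σ< n f)
  ofℝ-Σ< zero    f = ℂ.trans (ℂΣ.Σ<-empty (ofℝ ∘ f)) (ofℝ-cong (sym (Σ<-empty f)))
  ofℝ-Σ< (suc n) f = ℂ.trans (ℂΣ.Σ<-snoc n (ofℝ ∘ f)) (ℂ.trans (ℂ.+-congʳ (ofℝ-Σ< n f))
    (ℂ.trans (ofℝ-+ _ _) (ofℝ-cong (sym (Σ<-snoc n f)))))

  expSum : Carrier → ℕ → Carrier
  expSum x n = Σ< n (λ i → κ i * x ^ i)

  ofℝ-expSum : ∀ x n → ℂΣ.Σ< n (λ i → ofℝ (κ i) *ℂ ofℝ x ^ℂ i) ≈ℂ ofℝ (expSum x n)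
  ofℝ-expSum x n = ℂ.trans
    (ℂΣ.Σ<-cong n (λ i _ → ℂ.trans (ℂ.*-congˡ (ofℝ-^ x i)) (ofℝ-* (κ i) (x ^ i))))
    (ofℝ-Σ< n (λ i → κ i * x ^ i))

  -- Real exponentials are handled as complex ones with imaginary part 0, so that existence and the
  -- functional equation carry over from the complex case.
  exp⇒expℂ : ∀ {x y} → IsExp x y → IsExpℂ (ofℝ x) (ofℝ y)
  exp⇒expℂ {x} {y} e = toExpℂ {ofℝ x} {ofℝ y}
    ( ⟶-cong (λ n → trans (reflexive (≡.sym (Σ<≡sum n (λ i → κ i * x ^ i)))) (sym (proj₁ (ofℝ-expSum x n)))) refl e
    , ⟶-cong (λ n → sym (proj₂ (ofℝ-expSum x n))) refl (⟶-const 0#))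

  expSum⟶ : ∀ {x w} → IsExpℂ (ofℝ x) w → expSum x ⟶ proj₁ w
  expSum⟶ {x} {w} e = ⟶-cong (λ n → proj₁ (ofℝ-expSum x n)) refl (proj₁ (fromExpℂ {ofℝ x} {w} e))

  opaque
    expℂ-real-exists : ∀ x → ∃ λ y → IsExpℂ (ofℝ x) (ofℝ y)
    expℂ-real-exists x =
      let w , e = expℂ-exists (ofℝ x)
          im≈0 = ⟶-unique (⟶-cong (λ n → proj₂ (ofℝ-expSum x n)) refl (proj₂ (fromExpℂ {ofℝ x} {w} e))) (⟶-const 0#)
      in proj₁ w , expℂ-cong {ofℝ x} {ofℝ x} {w} {ofℝ (proj₁ w)} ℂ.refl (refl , im≈0) e

  expℂ-real-+ : ∀ {x y u v} → IsExpℂ (ofℝ x) (ofℝ u) → IsExpℂ (ofℝ y) (ofℝ v) → IsExpℂ (ofℝ (x + y)) (ofℝ (u * v))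
  expℂ-real-+ {x} {y} {u} {v} ex ey =
    expℂ-cong {ofℝ x +ℂ ofℝ y} {ofℝ (x + y)} {ofℝ u *ℂ ofℝ v} {ofℝ (u * v)} (ofℝ-+ x y) (ofℝ-* u v)
      (expℂ-+ {ofℝ x} {ofℝ y} {ofℝ u} {ofℝ v} ex ey)

  1≤exp : ∀ {x y} → 0# ≤ x → IsExpℂ (ofℝ x) (ofℝ y) → 1# ≤ y
  1≤exp {x} {y} 0≤x e = limit-≥ 1 (λ n 1≤n → begin
    1#  ≈⟨ κ-zero ⟨
    κ 0  ≈⟨ *-identityʳ _ ⟨
    κ 0 * 1#  ≈⟨ trans (Σ<-snoc 0 _) (trans (+-congʳ (Σ<-empty _)) (+-identityˡ _)) ⟨
    expSum x 1  ≤⟨ Σ<-extend (term-nonneg 0≤x) 1≤n ⟩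
    expSum x n  ∎) (expSum⟶ {x} {ofℝ y} e)

  expℂ-multiple : ∀ {z w} n → IsExpℂ z w → IsExpℂ ((n ·ℂ 1ℂ) *ℂ z) (w ^ℂ n)
  expℂ-multiple {z} {w} zero    e = expℂ-cong {0ℂ} {0ℂ *ℂ z} {1ℂ} {1ℂ} (ℂ.sym (ℂ.zeroˡ z)) ℂ.refl expℂ-0
  expℂ-multiple {z} {w} (suc n) e =
    expℂ-cong {z +ℂ (n ·ℂ 1ℂ) *ℂ z} {(suc n ·ℂ 1ℂ) *ℂ z} {w *ℂ w ^ℂ n} {w *ℂ w ^ℂ n}
      (ℂ.sym (ℂ.trans (ℂ.distribʳ z 1ℂ (n ·ℂ 1ℂ)) (ℂ.+-congʳ (ℂ.*-identityˡ z)))) ℂ.refl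
      (expℂ-+ {z} {(n ·ℂ 1ℂ) *ℂ z} {w} {w ^ℂ n} e (expℂ-multiple {z} {w} n e))

  -- Here e^m = e^y e^(m-y), the second factor is at least 1 as m ≥ y, and e^m ≤ B^m for an integer
  -- B above e. The integer base lets `harmonic-log` compare powers of natural numbers.
  exp-bound : ∃ λ B → 0 ℕ.< B × (∀ X y → IsExp y X → 0# < X → ∀ m → y ≤ ι m → X ≤ ι (B ℕ.^ m))
  exp-bound = B , 0<B , bound
    where
    e : Carrier
    e = proj₁ (expℂ-real-exists 1#)
    exp[1] : IsExpℂ (ofℝ 1#) (ofℝ e)
    exp[1] = proj₂ (expℂ-real-exists 1#)
    0<e : 0# < e
    0<e = <-≤-trans 0<1 (1≤exp 0≤1 exp[1])
    B : ℕ
    B = proj₁ (archimedean e)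
    e<B : e < ι B
    e<B = proj₂ (archimedean e)
    0<B : 0 ℕ.< B
    0<B = ι-cancel-< (<-trans 0<e e<B)
    exp[m] : ∀ m → IsExpℂ (ofℝ (ι m)) (ofℝ (e ^ m))
    exp[m] m = expℂ-cong {(m ·ℂ 1ℂ) *ℂ ofℝ 1#} {ofℝ (ι m)} {ofℝ e ^ℂ m} {ofℝ (e ^ m)}
      (ℂ.trans (ℂ.*-congʳ (·ℂ-ofℝ m)) (ℂ.*-identityʳ _)) (ofℝ-^ e m) (expℂ-multiple {ofℝ 1#} {ofℝ e} m exp[1])
    bound : ∀ X y → IsExp y X → 0# < X → ∀ m → y ≤ ι m → X ≤ ι (B ℕ.^ m)
    bound X y exp[y] 0<X m y≤m = begin
      X  ≈⟨ *-identityʳ X ⟨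
      X * 1#  ≤⟨ *-monoˡ-≤ X (<⇒≤ 0<X) (1≤exp (x≤y⇒0≤y-x y≤m) exp[m-y]) ⟩
      X * w  ≈⟨ proj₁ (expℂ-unique {ofℝ (ι m)} {ofℝ (X * w)} {ofℝ (e ^ m)}
                         (expℂ-cong {ofℝ (y + (ι m - y))} {ofℝ (ι m)} {ofℝ (X * w)} {ofℝ (X * w)}
                            (ofℝ-cong (solve 2 (λ y m → y :+ (m :- y) := m) refl y (ι m))) ℂ.refl
                            (expℂ-real-+ {y} {ι m - y} {X} {w} (exp⇒expℂ exp[y]) exp[m-y])) (exp[m] m)) ⟩
      e ^ m  ≤⟨ ^-mono-≤ m (<⇒≤ 0<e) (<⇒≤ e<B) ⟩
      ι B ^ m  ≈⟨ ι-^ B m ⟨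
      ι (B ℕ.^ m)  ∎
      where
      w : Carrier
      w = proj₁ (expℂ-real-exists (ι m - y))
      exp[m-y] : IsExpℂ (ofℝ (ι m - y)) (ofℝ w)
      exp[m-y] = proj₂ (expℂ-real-exists (ι m - y))

  -- The unit circle

  open SquareRootsOfOne ℂ-commutativeRing

  imaginary-cong : ∀ {x y} → x ≈ y → imaginary x ≈ℂ imaginary y
  imaginary-cong x≈y = refl , x≈y

  cis-cong : ∀ {x y w v} → x ≈ y → w ≈ℂ v → IsExpℂ (imaginary x) w → IsExpℂ (imaginary y) v
  cis-cong {x} {y} {w} {v} x≈y w≈v = expℂ-cong {imaginary x} {imaginary y} {w} {v} (imaginary-cong x≈y) w≈v

  cis-unique : ∀ {x w v} → IsExpℂ (imaginary x) w → IsExpℂ (imaginary x) v → w ≈ℂ v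
  cis-unique {x} {w} {v} = expℂ-unique {imaginary x} {w} {v}

  cis-+ : ∀ {x y w v} → IsExpℂ (imaginary x) w → IsExpℂ (imaginary y) v → IsExpℂ (imaginary (x + y)) (w *ℂ v)
  cis-+ {x} {y} {w} {v} ex ey = expℂ-cong {imaginary x +ℂ imaginary y} {imaginary (x + y)} {w *ℂ v} {w *ℂ v}
    (+-identityˡ 0# , refl) ℂ.refl (expℂ-+ {imaginary x} {imaginary y} {w} {v} ex ey)

  cis-multiple : ∀ {x w} n → IsExpℂ (imaginary x) w → IsExpℂ (imaginary (x * ι n)) (w ^ℂ n)
  cis-multiple {x} {w} n e = expℂ-cong {(n ·ℂ 1ℂ) *ℂ imaginary x} {imaginary (x * ι n)} {w ^ℂ n} {w ^ℂ n}
    (ℂ.trans (ℂ.*-congʳ (·ℂ-ofℝ n))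
      ( solve 2 (λ x n → n :* con (+ 0) :- con (+ 0) :* x := con (+ 0)) refl x (ι n)
      , solve 2 (λ x n → n :* x :+ con (+ 0) :* con (+ 0) := x :* n) refl x (ι n))) ℂ.refl
    (expℂ-multiple {imaginary x} {w} n e)

  opaque
    cis-exists : ∀ x → ∃ λ w → IsExpℂ (imaginary x) w
    cis-exists x = expℂ-exists (imaginary x)

  module _ (π : Carrier) (isPi : IsPi π) where
    private
      0<π : 0# < π
      0<π = proj₁ isPi
      cis[π] : IsExpℂ (imaginary π) (-ℂ 1ℂ)
      cis[π] = proj₁ (proj₂ isPi)
      minimal : ∀ y → 0# < y → y < π → ¬ IsExpℂ (imaginary y) (-ℂ 1ℂ)
      minimal = proj₂ (proj₂ isPi)

      2π : Carrier
      2π = ι 2 * π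

    0<2π : 0# < 2π
    0<2π = *-pos (0<ι-suc 1) 0<π

    -- If e^(iy) = 1 then e^(iy/2) = ±1, so y/2 or π - y/2 contradicts the minimality of π.
    no-period-below-2π : ∀ y → 0# < y → y < 2π → ¬ IsExpℂ (imaginary y) 1ℂ
    no-period-below-2π y 0<y y<2π cis[y] = [ v-1≈0-impossible , v+1≈0-impossible ]′ (ℂ-zero-product {v ℂ.- 1ℂ} {v +ℂ 1ℂ} (x*x≈1⇒[x-1][x+1]≈0 {v} vv≈1))
      where
      h : Carrier
      h = ½ * y
      0<h : 0# < h
      0<h = *-pos 0<½ 0<y
      h<π : h < π
      h<π = begin-strict
        ½ * y  <⟨ *-monoˡ-< ½ 0<½ y<2π ⟩
        ½ * (ι 2 * π)  ≈⟨ solve 2 (λ h x → h :* (con (+ 2) :* x) := h :* x :+ h :* x) refl ½ π ⟩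
        ½ * π + ½ * π  ≈⟨ ½+½ π ⟩
        π  ∎
      v : ℂ
      v = proj₁ (cis-exists h)
      cis[h] : IsExpℂ (imaginary h) v
      cis[h] = proj₂ (cis-exists h)
      vv≈1 : v *ℂ v ≈ℂ 1ℂ
      vv≈1 = cis-unique {y} {v *ℂ v} {1ℂ} (cis-cong {h + h} {y} {v *ℂ v} {v *ℂ v} (½+½ y) ℂ.refl (cis-+ {h} {h} {v} {v} cis[h] cis[h])) cis[y]
      v+1≈0-impossible : ¬ v +ℂ 1ℂ ≈ℂ 0ℂ
      v+1≈0-impossible eq = minimal h 0<h h<π (cis-cong {h} {h} {v} { -ℂ 1ℂ} refl (x+1≈0⇒x≈-1 {v} eq) cis[h])
      v-1≈0-impossible : ¬ v ℂ.- 1ℂ ≈ℂ 0ℂ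
      v-1≈0-impossible eq = minimal (π - h) (x<y⇒0<y-x h<π)
        (<-by h 0<h (solve 2 (λ p h → p := (p :- h) :+ h) refl π h))
        (cis-cong {π - h} {π - h} {u} { -ℂ 1ℂ} refl u≈-1 cis[π-h])
        where
        u : ℂ
        u = proj₁ (cis-exists (π - h))
        cis[π-h] : IsExpℂ (imaginary (π - h)) u
        cis[π-h] = proj₂ (cis-exists (π - h))
        -- With v = 1, u = u v = e^(i(π - h)) e^(ih) = e^(iπ) = -1.
        u≈-1 : u ≈ℂ -ℂ 1ℂ
        u≈-1 = ℂ.trans (ℂ.sym (ℂ.trans (ℂ.*-congˡ {u} (x-1≈0⇒x≈1 {v} eq)) (ℂ.*-identityʳ u)))
          (cis-unique {π} {u *ℂ v} { -ℂ 1ℂ}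
            (cis-cong {π - h + h} {π} {u *ℂ v} {u *ℂ v} (solve 2 (λ p h → (p :- h) :+ h := p) refl π h) ℂ.refl
              (cis-+ {π - h} {h} {u} {v} cis[π-h] cis[h])) cis[π])

    cis[2π] : IsExpℂ (imaginary 2π) 1ℂ
    cis[2π] = cis-cong {π + π} {2π} { -ℂ 1ℂ *ℂ -ℂ 1ℂ} {1ℂ} (solve 1 (λ p → p :+ p := con (+ 2) :* p) refl π) [-1]*[-1]≈1
      (cis-+ {π} {π} { -ℂ 1ℂ} { -ℂ 1ℂ} cis[π] cis[π])

    cis[2πn] : ∀ n → IsExpℂ (imaginary (2π * ι n)) 1ℂ
    cis[2πn] n = cis-cong {2π * ι n} {2π * ι n} {1ℂ ^ℂ n} {1ℂ} refl (1^n≈1 n) (cis-multiple {2π} {1ℂ} n cis[2π])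

    cis≈1⇒0 : ∀ x → 0# ≤ x → x < 1# → IsExpℂ (imaginary (2π * x)) 1ℂ → x ≈ 0#
    cis≈1⇒0 x (inj₂ 0≈x) _ _ = sym 0≈x
    cis≈1⇒0 x (inj₁ 0<x) x<1 e = contradiction e (no-period-below-2π (2π * x) (*-pos 0<2π 0<x)
      (<-≤-trans (*-monoˡ-< 2π 0<2π x<1) (≤-reflexive (*-identityʳ 2π))))

    -- Removing the integer part j does not change e^(2πix), so the fractional part r also gives the
    -- value 1, and r < 1 forces r = 0.
    cis≈1⇒integer : ∀ x → 0# ≤ x → IsExpℂ (imaginary (2π * x)) 1ℂ → ∃ λ j → x ≈ ι j
    cis≈1⇒integer x 0≤x e =
      let j , j≤x , x<1+j = floor x 0≤x
          r = x - ι j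
          u , cis[r] = cis-exists (2π * r)
          u≈1 : u ≈ℂ 1ℂ
          u≈1 = ℂ.trans (ℂ.sym (ℂ.*-identityʳ u)) (cis-unique {2π * x} {u *ℂ 1ℂ} {1ℂ}
            (cis-cong {2π * r + 2π * ι j} {2π * x} {u *ℂ 1ℂ} {u *ℂ 1ℂ} (solve 3 (λ t x j → t :* (x :- j) :+ t :* j := t :* x) refl 2π x (ι j)) ℂ.refl
              (cis-+ {2π * r} {2π * ι j} {u} {1ℂ} cis[r] (cis[2πn] j))) e)
          r<1 : r < 1#
          r<1 = begin-strict
            x - ι j  <⟨ +-monoˡ-< _ x<1+j ⟩
            1# + ι j - ι j  ≈⟨ solve 2 (λ o j → o :+ j :- j := o) refl 1# (ι j) ⟩
            1#  ∎
          r≈0 = cis≈1⇒0 r (x≤y⇒0≤y-x j≤x) r<1 (cis-cong {2π * r} {2π * r} {u} {1ℂ} refl u≈1 cis[r])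
      in j , trans (solve 2 (λ x j → x := j :+ (x :- j)) refl x (ι j)) (trans (+-congˡ r≈0) (+-identityʳ _))

    module _ {α : ℂ} {θ : Carrier} (isTheta : IsTheta π α θ) where
      private
        cis[θ] : IsExpℂ (imaginary (2π * θ)) α
        cis[θ] = proj₂ (proj₂ isTheta)

        cis[θd] : ∀ d → IsExpℂ (imaginary (2π * (θ * ι d))) (α ^ℂ d)
        cis[θd] d = cis-cong {2π * θ * ι d} {2π * (θ * ι d)} {α ^ℂ d} {α ^ℂ d} (*-assoc _ _ _) ℂ.refl (cis-multiple {2π * θ} {α} d cis[θ])

      -- With `integer⇒power≈1` this turns the conditions on powers of α into integrality of
      -- multiples of θ, and so into divisibility conditions on k.
      power≈1⇒integer : ∀ d → α ^ℂ d ≈ℂ 1ℂ → ∃ λ j → θ * ι d ≈ ι j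
      power≈1⇒integer d αᵈ≈1 = cis≈1⇒integer (θ * ι d) (*-nonneg (proj₁ isTheta) (0≤ι d))
        (cis-cong {2π * (θ * ι d)} {2π * (θ * ι d)} {α ^ℂ d} {1ℂ} refl αᵈ≈1 (cis[θd] d))

      integer⇒power≈1 : ∀ d j → θ * ι d ≈ ι j → α ^ℂ d ≈ℂ 1ℂ
      integer⇒power≈1 d j θd≈j = cis-unique {2π * ι j} {α ^ℂ d} {1ℂ}
        (cis-cong {2π * (θ * ι d)} {2π * ι j} {α ^ℂ d} {α ^ℂ d} (*-congˡ θd≈j) ℂ.refl (cis[θd] d)) (cis[2πn] j)

    -- The number x = φ + (1 - θ) lies strictly between 0 and 2, and e^(2πix) = β/α = 1, so x = 1.
    -- Adding 1 - θ in place of -θ keeps the argument nonnegative, as `cis≈1⇒integer` demands.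
    theta-unique : ∀ {α β θ φ} → IsTheta π α θ → IsTheta π β φ → α ≈ℂ β → θ ≈ φ
    theta-unique {α} {β} {θ} {φ} (0≤θ , θ<1 , cis[θ]) (0≤φ , φ<1 , cis[φ]) α≈β =
      let j , x≈j = cis≈1⇒integer x (<⇒≤ 0<x) (cis-cong {2π * φ + 2π * (1# - θ)} {2π * x} {β *ℂ v} {1ℂ} (sym (distribˡ _ _ _)) βv≈1
                      (cis-+ {2π * φ} {2π * (1# - θ)} {β} {v} cis[φ] cis[1-θ]))
          0<j = ι-cancel-< {0} {j} (<-≤-trans 0<x (≤-reflexive x≈j))
          j<2 = ι-cancel-< {j} {2} (≤-<-trans (≤-reflexive (sym x≈j)) x<2)
          x≈1 = trans x≈j (trans (reflexive (≡.cong ι (ℕ.≤-antisym (ℕ.s≤s⁻¹ j<2) 0<j))) ι-1)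
      in sym (begin-equality
        φ  ≈⟨ solve 3 (λ p o t → p := (p :+ (o :- t)) :- o :+ t) refl φ 1# θ ⟩
        x - 1# + θ  ≈⟨ +-congʳ (trans (+-congʳ x≈1) (-‿inverseʳ 1#)) ⟩
        0# + θ  ≈⟨ +-identityˡ θ ⟩
        θ  ∎)
      where
      x : Carrier
      x = φ + (1# - θ)
      0<x : 0# < x
      0<x = <-≤-trans (+-pos (x<y⇒0<y-x θ<1) 0≤φ) (≤-reflexive (+-comm _ _))
      x<2 : x < ι 2
      x<2 = <-by ((1# - φ) + θ) (+-pos (x<y⇒0<y-x φ<1) 0≤θ) (trans (+-congˡ ι-1)
        (solve 3 (λ p o t → o :+ o := (p :+ (o :- t)) :+ ((o :- p) :+ t)) refl φ 1# θ))
      v : ℂ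
      v = proj₁ (cis-exists (2π * (1# - θ)))
      cis[1-θ] : IsExpℂ (imaginary (2π * (1# - θ))) v
      cis[1-θ] = proj₂ (cis-exists (2π * (1# - θ)))
      βv≈1 : β *ℂ v ≈ℂ 1ℂ
      βv≈1 = ℂ.trans (ℂ.*-congʳ {v} (ℂ.sym α≈β)) (cis-unique {2π} {α *ℂ v} {1ℂ}
        (cis-cong {2π * θ + 2π * (1# - θ)} {2π} {α *ℂ v} {α *ℂ v}
          (trans (solve 3 (λ t θ o → t :* θ :+ t :* (o :- θ) := t :* o) refl 2π θ 1#) (*-identityʳ 2π)) ℂ.refl
          (cis-+ {2π * θ} {2π * (1# - θ)} {α} {v} cis[θ] cis[1-θ])) cis[2π])

  -- Roots of the Alexander polynomials

  open Evaluation ℂ-commutativeRing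
  open IntegerImage ℂ-commutativeRing using (image)

  fromℤ≡image : ∀ i → fromℤ i ≡ image i
  fromℤ≡image (+ n)    = ≡.refl
  fromℤ≡image -[1+ n ] = ≡.refl

  eval≈ev : ∀ f z → eval f z ≈ℂ ev f z
  eval≈ev []      z = ℂ.refl
  eval≈ev (a ∷ f) z = ℂ.+-cong {fromℤ a} {image a} {z *ℂ eval f z} {z *ℂ ev f z}
    (ℂ.reflexive (fromℤ≡image a)) (ℂ.*-congˡ {z} {eval f z} {ev f z} (eval≈ev f z))

  ·ℂ≉0 : ∀ {n} → 0 ℕ.< n → ¬ n ·ℂ 1ℂ ≈ℂ 0ℂ
  ·ℂ≉0 {n} 0<n eq = pos⇒≉0 (0<ι 0<n) (proj₁ (ℂ.trans (ℂ.sym (·ℂ-ofℝ n)) eq))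

  root⇒not-pth : ∀ p q Δ α → 0 ℕ.< p → 0 ℕ.< q → IsAlexander p q Δ → ev Δ α ≈ℂ 0ℂ → ¬ α ^ℂ p ≈ℂ 1ℂ
  root⇒not-pth p q Δ α 0<p 0<q isΔ root αᵖ≈1 = ·ℂ≉0 {q} 0<q
    (ℂ.trans (ℂ.sym (ev-alexander-quotient p q Δ α 0<p isΔ αᵖ≈1)) (ℂ.trans (ℂ.*-congʳ root) (ℂ.zeroˡ _)))

  root⇒pqth : ∀ p q Δ α → IsAlexander p q Δ → ev Δ α ≈ℂ 0ℂ → α ^ℂ (p ℕ.* q) ≈ℂ 1ℂ
  -- One of the factors of (α^(pq) - 1)(α - 1) is 0; if it is the second, then α = 1, which is a
  -- pq-th root of unity as well.
  root⇒pqth p q Δ α isΔ root = [ x-1≈0⇒x≈1 , (λ eq → ℂ.trans (^ℂ-congˡ (p ℕ.* q) (x-1≈0⇒x≈1 eq)) (1^n≈1 (p ℕ.* q))) ]′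
    (ℂ-zero-product (ℂ.trans (ℂ.sym (ev-alexander p q Δ α isΔ)) (ℂ.trans (ℂ.*-congʳ root) (ℂ.zeroˡ _))))

  alexanderRoot⇒ : ∀ p q α → 0 ℕ.< p → 0 ℕ.< q → IsAlexanderRoot p q α →
    α ^ℂ (p ℕ.* q) ≈ℂ 1ℂ × (¬ α ^ℂ p ≈ℂ 1ℂ) × (¬ α ^ℂ q ≈ℂ 1ℂ)
  alexanderRoot⇒ p q α 0<p 0<q (Δ , isΔ , evalΔ≈0) =
    root⇒pqth p q Δ α isΔ root , root⇒not-pth p q Δ α 0<p 0<q isΔ root ,
    root⇒not-pth q p Δ α 0<q 0<p (AlexanderPolynomial.alexander-swap p q {Δ} isΔ) root
    where
    root : ev Δ α ≈ℂ 0ℂ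
    root = ℂ.trans {ev Δ α} {eval Δ α} {0ℂ} (ℂ.sym {eval Δ α} {ev Δ α} (eval≈ev Δ α)) evalΔ≈0

  -- At α the equation for Δ reads (α^p - 1)(α^q - 1) Δ(α) = 0, and the two nonzero factors are
  -- removed in turn.
  ⇒alexanderRoot : ∀ p q α → Coprime p q → α ^ℂ (p ℕ.* q) ≈ℂ 1ℂ → ¬ α ^ℂ p ≈ℂ 1ℂ → ¬ α ^ℂ q ≈ℂ 1ℂ → IsAlexanderRoot p q α
  ⇒alexanderRoot p q α coprime αᵖᑫ≈1 αᵖ≉1 α^q≉1 =
    let Δ , isΔ = AlexanderPolynomial.alexander-exists p q coprime
        u = α ^ℂ p ℂ.- 1ℂ
        v = α ^ℂ q ℂ.- 1ℂ
        product≈0 : u *ℂ (v *ℂ ev Δ α) ≈ℂ 0ℂ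
        product≈0 = ℂ.trans (ℂ.trans (ℂ.sym (ℂ.*-assoc u v (ev Δ α))) (ℂ.*-comm (u *ℂ v) (ev Δ α)))
          (ℂ.trans (ev-alexander p q Δ α isΔ) (ℂ.trans (ℂ.*-congʳ (x≈1⇒x-1≈0 αᵖᑫ≈1)) (ℂ.zeroˡ _)))
    in Δ , isΔ , ℂ.trans {eval Δ α} {ev Δ α} {0ℂ} (eval≈ev Δ α)
         (ℂ-*≈0⇒≈0 {v} {ev Δ α} (λ eq → α^q≉1 (x-1≈0⇒x≈1 eq)) (ℂ-*≈0⇒≈0 {u} {v *ℂ ev Δ α} (λ eq → αᵖ≉1 (x-1≈0⇒x≈1 eq)) product≈0))

  -- Finite sums and counting

  ΣL : ∀ {a} {A : Set a} → List A → (A → Carrier) → Carrier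
  ΣL []       f = 0#
  ΣL (x ∷ xs) f = f x + ΣL xs f

  module _ {a} {A : Set a} where

    ΣL-cong : ∀ (xs : List A) {f g} → (∀ {x} → x ∈ xs → f x ≈ g x) → ΣL xs f ≈ ΣL xs g
    ΣL-cong []       f≈g = refl
    ΣL-cong (x ∷ xs) f≈g = +-cong (f≈g (here ≡.refl)) (ΣL-cong xs (f≈g ∘ there))

    ΣL-mono : ∀ (xs : List A) {f g} → (∀ {x} → x ∈ xs → f x ≤ g x) → ΣL xs f ≤ ΣL xs g
    ΣL-mono []       f≤g = ≤-refl
    ΣL-mono (x ∷ xs) f≤g = +-mono-≤ (f≤g (here ≡.refl)) (ΣL-mono xs (f≤g ∘ there))

    ΣL-+ : ∀ (xs : List A) f g → ΣL xs (λ x → f x + g x) ≈ ΣL xs f + ΣL xs g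
    ΣL-+ []       f g = sym (+-identityˡ 0#)
    ΣL-+ (x ∷ xs) f g = trans (+-congˡ (ΣL-+ xs f g))
      (solve 4 (λ a b c d → (a :+ b) :+ (c :+ d) := (a :+ c) :+ (b :+ d)) refl (f x) (g x) (ΣL xs f) (ΣL xs g))

    ΣL-*ˡ : ∀ (xs : List A) k f → ΣL xs (λ x → k * f x) ≈ k * ΣL xs f
    ΣL-*ˡ []       k f = sym (zeroʳ k)
    ΣL-*ˡ (x ∷ xs) k f = trans (+-congˡ (ΣL-*ˡ xs k f)) (sym (distribˡ _ _ _))

    ΣL-*ʳ : ∀ (xs : List A) k f → ΣL xs (λ x → f x * k) ≈ ΣL xs f * k
    ΣL-*ʳ xs k f = trans (ΣL-cong xs (λ _ → *-comm _ _)) (trans (ΣL-*ˡ xs k f) (*-comm _ _))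

    ΣL-minus : ∀ (xs : List A) f g → ΣL xs (λ x → f x - g x) ≈ ΣL xs f - ΣL xs g
    ΣL-minus []       f g = sym (-‿inverseʳ 0#)
    ΣL-minus (x ∷ xs) f g = trans (+-congˡ (ΣL-minus xs f g))
      (solve 4 (λ a b c d → (a :- b) :+ (c :- d) := (a :+ c) :- (b :+ d)) refl (f x) (g x) (ΣL xs f) (ΣL xs g))

    ΣL-++ : ∀ (xs ys : List A) f → ΣL (xs ++ ys) f ≈ ΣL xs f + ΣL ys f
    ΣL-++ []       ys f = sym (+-identityˡ _)
    ΣL-++ (x ∷ xs) ys f = trans (+-congˡ (ΣL-++ xs ys f)) (sym (+-assoc _ _ _))

    ΣL-zero : ∀ (xs : List A) {f} → (∀ {x} → x ∈ xs → f x ≈ 0#) → ΣL xs f ≈ 0#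
    ΣL-zero []       f≈0 = refl
    ΣL-zero (x ∷ xs) f≈0 = trans (+-cong (f≈0 (here ≡.refl)) (ΣL-zero xs (f≈0 ∘ there))) (+-identityˡ 0#)

    ∣ΣL∣≤ : ∀ (xs : List A) f → ∣ ΣL xs f ∣ ≤ ΣL xs (λ x → ∣ f x ∣)
    ∣ΣL∣≤ []       f = ≤-reflexive (nonneg⇒∣x∣≈x ≤-refl)
    ∣ΣL∣≤ (x ∷ xs) f = ≤-trans (∣∣-triangle _ _) (+-monoʳ-≤ _ (∣ΣL∣≤ xs f))

  ΣL-map : ∀ {a b} {A : Set a} {B : Set b} (h : A → B) xs f → ΣL (map h xs) f ≡ ΣL xs (f ∘ h)
  ΣL-map h []       f = ≡.refl
  ΣL-map h (x ∷ xs) f = ≡.cong (λ u → f (h x) + u) (ΣL-map h xs f)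

  module _ {a b} {A : Set a} {B : Set b} where

    ΣL-swap : ∀ (xs : List A) (ys : List B) (f : A → B → Carrier) → ΣL xs (λ x → ΣL ys (f x)) ≈ ΣL ys (λ y → ΣL xs (λ x → f x y))
    ΣL-swap []       ys f = sym (ΣL-zero ys (λ _ → refl))
    ΣL-swap (x ∷ xs) ys f = trans (+-congˡ (ΣL-swap xs ys f)) (sym (ΣL-+ ys (f x) (λ y → ΣL xs (λ x → f x y))))

    ΣL-product : ∀ (xs : List A) (ys : List B) (f : A × B → Carrier) → ΣL (cartesianProduct xs ys) f ≈ ΣL xs (λ x → ΣL ys (λ y → f (x , y)))
    ΣL-product []       ys f = refl
    ΣL-product (x ∷ xs) ys f = trans (ΣL-++ (map (x ,_) ys) (cartesianProduct xs ys) f)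
      (+-cong (reflexive (ΣL-map (x ,_) ys f)) (ΣL-product xs ys f))

    ΣL-*-ΣL : ∀ (xs : List A) (ys : List B) f g → ΣL xs (λ x → ΣL ys (λ y → f x * g y)) ≈ ΣL xs f * ΣL ys g
    ΣL-*-ΣL xs ys f g = trans (ΣL-cong xs (λ _ → ΣL-*ˡ ys _ g)) (ΣL-*ʳ xs (ΣL ys g) f)

  opaque
    𝟙 : ∀ {p} {P : Set p} → Dec P → Carrier
    𝟙 P? = if does P? then 1# else 0#

    𝟙-yes : ∀ {p} {P : Set p} (P? : Dec P) → P → 𝟙 P? ≈ 1#
    𝟙-yes (yes _) p = refl
    𝟙-yes (no ¬p) p = contradiction p ¬p

    𝟙-no : ∀ {p} {P : Set p} (P? : Dec P) → ¬ P → 𝟙 P? ≈ 0#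
    𝟙-no (yes p) ¬p = contradiction p ¬p
    𝟙-no (no _)  ¬p = refl

    𝟙-nonneg : ∀ {p} {P : Set p} (P? : Dec P) → 0# ≤ 𝟙 P?
    𝟙-nonneg (yes _) = 0≤1
    𝟙-nonneg (no _)  = ≤-refl

    𝟙≤1 : ∀ {p} {P : Set p} (P? : Dec P) → 𝟙 P? ≤ 1#
    𝟙≤1 (yes _) = ≤-refl
    𝟙≤1 (no _)  = 0≤1

    𝟙-× : ∀ {p q} {P : Set p} {Q : Set q} (P? : Dec P) (Q? : Dec Q) → 𝟙 (P? ×-dec Q?) ≈ 𝟙 P? * 𝟙 Q?
    𝟙-× (yes _) (yes _) = sym (*-identityˡ 1#)
    𝟙-× (yes _) (no _)  = sym (zeroʳ 1#)
    𝟙-× (no _)  Q?      = sym (zeroˡ _)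

    length-filter : ∀ {a p} {A : Set a} {P : A → Set p} (P? : Decidable P) xs →
                    ι (length (filter P? xs)) ≈ ΣL xs (λ x → 𝟙 (P? x))
    length-filter P? []       = refl
    length-filter P? (x ∷ xs) with does (P? x)
    ... | true  = +-congˡ (length-filter P? xs)
    ... | false = trans (length-filter P? xs) (sym (+-identityˡ _))

    -- A union bound: as soon as P or Q holds, the left side is at most 0. It gives the lower
    -- estimate for the k in an interval that are divisible by neither p nor q.
    𝟙-exclude : ∀ {p q r} {P : Set p} {Q : Set q} {R : Set r} (P? : Dec P) (Q? : Dec Q) (R? : Dec R) →
                𝟙 R? - 𝟙 P? - 𝟙 Q? ≤ 𝟙 ((¬? P? ×-dec ¬? Q?) ×-dec R?)
    𝟙-exclude (yes p) Q? R? = begin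
      𝟙 R? - 1# - 𝟙 Q?  ≤⟨ +-mono-≤ (+-monoˡ-≤ (- 1#) (𝟙≤1 R?)) (neg-mono-≤ (𝟙-nonneg Q?)) ⟩
      1# - 1# - 0#  ≈⟨ solve 1 (λ o → o :- o :- con (+ 0) := con (+ 0)) refl 1# ⟩
      0#  ∎
    𝟙-exclude (no _) (yes _) R? = begin
      𝟙 R? - 0# - 1#  ≤⟨ +-monoˡ-≤ (- 1#) (+-monoˡ-≤ (- 0#) (𝟙≤1 R?)) ⟩
      1# - 0# - 1#  ≈⟨ solve 1 (λ o → o :- con (+ 0) :- o := con (+ 0)) refl 1# ⟩
      0#  ∎
    𝟙-exclude (no _) (no _) (yes _) = ≤-reflexive (solve 1 (λ o → o :- con (+ 0) :- con (+ 0) := o) refl 1#)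
    𝟙-exclude (no _) (no _) (no _)  = ≤-reflexive (solve 0 (con (+ 0) :- con (+ 0) :- con (+ 0) := con (+ 0)) refl)

  𝟙-mono : ∀ {p q} {P : Set p} {Q : Set q} (P? : Dec P) (Q? : Dec Q) → (P → Q) → 𝟙 P? ≤ 𝟙 Q?
  𝟙-mono P?@(yes p) Q? f = ≤-trans (𝟙≤1 P?) (≤-reflexive (sym (𝟙-yes Q? (f p))))
  𝟙-mono P?@(no ¬p) Q? f = ≤-trans (≤-reflexive (𝟙-no P? ¬p)) (𝟙-nonneg Q?)

  𝟙-cong : ∀ {p q} {P : Set p} {Q : Set q} (P? : Dec P) (Q? : Dec Q) → (P → Q) → (Q → P) → 𝟙 P? ≈ 𝟙 Q?
  𝟙-cong P? Q? f g = ≤-antisym (𝟙-mono P? Q? f) (𝟙-mono Q? P? g)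

  -- The numbers from n down to 1. With the largest at the head, `range (suc n)` is `range n` with
  -- one entry put in front, as inductions on n require.
  range : ℕ → List ℕ
  range n = map suc (downFrom n)

  ∈-range⁻ : ∀ {k} n → k ∈ range n → 0 ℕ.< k × k ℕ.≤ n
  ∈-range⁻ n k∈ with ∈-map⁻ suc k∈
  ... | i , i∈ , ≡.refl = ℕ.z<s , ∈-downFrom⁻ i∈

  ∈-range⁺ : ∀ {k n} → 0 ℕ.< k → k ℕ.≤ n → k ∈ range n
  ∈-range⁺ {suc k} _ k<n = ∈-map⁺ suc (∈-downFrom⁺ k<n)

  ΣL-range-const : ∀ n k → ΣL (range n) (λ _ → k) ≈ ι n * k
  ΣL-range-const zero    k = sym (zeroˡ k)
  ΣL-range-const (suc n) k = trans (+-cong (sym (*-identityˡ k)) (ΣL-range-const n k)) (sym (distribʳ _ _ _))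

  ΣL-downFrom-suc : ∀ n f → ΣL (downFrom (suc n)) f ≈ f 0 + ΣL (range n) f
  ΣL-downFrom-suc zero    f = refl
  ΣL-downFrom-suc (suc n) f = trans (+-congˡ (ΣL-downFrom-suc n f))
    (solve 3 (λ a b c → a :+ (b :+ c) := b :+ (a :+ c)) refl (f (suc n)) (f 0) (ΣL (range n) f))

  ΣL-downFrom≤ : ∀ n f → (∀ k → 0# ≤ f k) → ΣL (downFrom n) f ≤ f 0 + ΣL (range n) f
  ΣL-downFrom≤ n f 0≤f = ≤-trans (≤-by (f n) (0≤f n) (+-comm _ _)) (≤-reflexive (ΣL-downFrom-suc n f))

  ΣL-truncate : ∀ {m n} f → m ℕ.≤ n → ΣL (downFrom n) (λ k → 𝟙 (k ℕ.<? m) * f k) ≈ ΣL (downFrom m) f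
  ΣL-truncate {m} f m≤n = go (ℕ.≤⇒≤′ m≤n)
    where
    go : ∀ {n} → m ℕ.≤′ n → ΣL (downFrom n) (λ k → 𝟙 (k ℕ.<? m) * f k) ≈ ΣL (downFrom m) f
    go ℕ.≤′-refl = ΣL-cong (downFrom m) (λ {k} k∈ → trans (*-congʳ (𝟙-yes (k ℕ.<? m) (∈-downFrom⁻ k∈))) (*-identityˡ _))
    go (ℕ.≤′-step {n} m≤n) = trans
      (+-cong (trans (*-congʳ (𝟙-no (n ℕ.<? m) (ℕ.≤⇒≯ (ℕ.≤′⇒≤ m≤n)))) (zeroˡ _)) (go m≤n)) (+-identityˡ _)

  -- Division with remainder by induction on n: r grows until it would reach d, and then m grows by
  -- 1. Since f is quantified last, the same m = ⌊n/d⌋ serves several sums, as needed for A_d and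
  -- B_d together.
  ΣL-multiples : ∀ d n → 0 ℕ.< d → ∃₂ λ m r → n ≡ d ℕ.* m ℕ.+ r × r ℕ.< d ×
    (∀ (f : ℕ → Carrier) → ΣL (range n) (λ k → 𝟙 (d ∣? k) * f k) ≈ ΣL (range m) (λ e → f (d ℕ.* e)))
  ΣL-multiples d zero    0<d = 0 , 0 , ≡.sym (≡.trans (ℕ.+-identityʳ _) (ℕ.*-zeroʳ d)) , 0<d , λ f → refl
  ΣL-multiples d (suc n) 0<d with ΣL-multiples d n 0<d
  ... | m , r , n≡ , r<d , sums with suc r ℕ.<? d
  ...   | yes 1+r<d = m , suc r , 1+n≡ , 1+r<d , λ f →
            trans (+-cong (trans (*-congʳ (𝟙-no (d ∣? suc n) d∤1+n)) (zeroˡ _)) (sums f)) (+-identityˡ _)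
    where
    1+n≡ : suc n ≡ d ℕ.* m ℕ.+ suc r
    1+n≡ = ≡.trans (≡.cong suc n≡) (≡.sym (ℕ.+-suc _ r))
    d∤1+n : ¬ d ∣ suc n
    d∤1+n d∣1+n = ℕ.<⇒≱ 1+r<d (∣⇒≤ (∣m+n∣m⇒∣n (≡.subst (d ∣_) 1+n≡ d∣1+n) (m∣m*n m)))
  ...   | no  1+r≮d = suc m , 0 , 1+n≡ , 0<d , λ f → +-cong
            (trans (*-congʳ (𝟙-yes (d ∣? suc n) (divides (suc m) (≡.trans 1+n≡d[1+m] (ℕ.*-comm d (suc m))))))
              (trans (*-identityˡ _) (reflexive (≡.cong f 1+n≡d[1+m])))) (sums f)
    where
    1+n≡d[1+m] : suc n ≡ d ℕ.* suc m
    1+n≡d[1+m] = ≡.trans (≡.cong suc n≡) (≡.trans (≡.sym (ℕ.+-suc (d ℕ.* m) r))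
      (≡.trans (≡.cong (d ℕ.* m ℕ.+_) (ℕ.≤-antisym r<d (ℕ.≮⇒≥ 1+r≮d))) (≡.trans (ℕ.+-comm (d ℕ.* m) d) (≡.sym (ℕ.*-suc d m)))))
    1+n≡ : suc n ≡ d ℕ.* suc m ℕ.+ 0
    1+n≡ = ≡.trans 1+n≡d[1+m] (≡.sym (ℕ.+-identityʳ _))

  module _ {p} {Q : ℕ → Set p} (Q? : Decidable Q) {v : Carrier}
           (Q⇒≤ : ∀ {k} → Q k → ι k ≤ v) (¬Q⇒≥ : ∀ {k} → ¬ Q k → v ≤ ι k) (0≤v : 0# ≤ v) where

    -- The hypotheses on Q fit both `ι k ≤ v` and `ι k < v`. As long as m ≤ v every k below m
    -- counts; once m has passed v nothing is added, and the count stays between v and v + 1.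
    count-initial : ∀ m → let count = ΣL (downFrom m) (λ k → 𝟙 (Q? k)) in
      (ι m ≤ v → count ≈ ι m) × (v ≤ ι m → v ≤ count × count ≤ v + 1#)
    count-initial zero = (λ _ → refl) , λ v≤0 → v≤0 , +-nonneg 0≤v 0≤1
    count-initial (suc m) with Q? m | 𝟙-yes (Q? m) | 𝟙-no (Q? m) | count-initial m
    ... | yes Qm | 𝟙≈1 | _ | full , _ = (λ _ → count≈) ,
          (λ v≤ → ≤-trans v≤ (≤-reflexive (sym count≈)) , (begin
            𝟙 (yes Qm) + ΣL (downFrom m) (λ k → 𝟙 (Q? k))  ≈⟨ count≈ ⟩
            1# + ι m  ≤⟨ +-monoʳ-≤ 1# (Q⇒≤ Qm) ⟩
            1# + v  ≈⟨ +-comm 1# v ⟩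
            v + 1#  ∎))
      where
      count≈ : 𝟙 (yes Qm) + ΣL (downFrom m) (λ k → 𝟙 (Q? k)) ≈ ι (suc m)
      count≈ = +-cong (𝟙≈1 Qm) (full (Q⇒≤ Qm))
    ... | no ¬Qm | _ | 𝟙≈0 | _ , bounds =
          (λ 1+m≤v → contradiction (≤-trans 1+m≤v (¬Q⇒≥ ¬Qm)) (<⇒≱ (ι-mono-< (ℕ.n<1+n m)))) ,
          (λ _ → let lower , upper = bounds (¬Q⇒≥ ¬Qm)
                     count≈ = trans (+-congʳ (𝟙≈0 ¬Qm)) (+-identityˡ _) in
            ≤-trans lower (≤-reflexive (sym count≈)) , ≤-trans (≤-reflexive count≈) upper)

  between? : ∀ u v k → Dec (u ≤ ι k × ι k ≤ v)
  between? u v k = (u ≤? ι k) ×-dec (ι k ≤? v)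

  -- Reduces the interval to two initial segments; the lower one is taken with strict inequality so
  -- that the left endpoint survives the subtraction.
  𝟙-between : ∀ {u v} → u ≤ v → ∀ k → 𝟙 (between? u v k) ≈ 𝟙 (ι k ≤? v) - 𝟙 (ι k <? u)
  𝟙-between {u} {v} u≤v k with <-≤-dichotomy (ι k) u | <-≤-dichotomy v (ι k)
  ... | inj₁ k<u | _ = begin-equality
    𝟙 (between? u v k)  ≈⟨ 𝟙-no (between? u v k) (λ (u≤k , _) → <⇒≱ k<u u≤k) ⟩
    0#  ≈⟨ -‿inverseʳ 1# ⟨
    1# - 1#  ≈⟨ +-cong (𝟙-yes (ι k ≤? v) (≤-trans (<⇒≤ k<u) u≤v)) (-‿cong (𝟙-yes (ι k <? u) k<u)) ⟨
    𝟙 (ι k ≤? v) - 𝟙 (ι k <? u)  ∎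
  ... | inj₂ u≤k | inj₁ v<k = begin-equality
    𝟙 (between? u v k)  ≈⟨ 𝟙-no (between? u v k) (λ (_ , k≤v) → <⇒≱ v<k k≤v) ⟩
    0#  ≈⟨ -‿inverseʳ 0# ⟨
    0# - 0#  ≈⟨ +-cong (𝟙-no (ι k ≤? v) (<⇒≱ v<k)) (-‿cong (𝟙-no (ι k <? u) (λ k<u → <⇒≱ k<u u≤k))) ⟨
    𝟙 (ι k ≤? v) - 𝟙 (ι k <? u)  ∎
  ... | inj₂ u≤k | inj₂ k≤v = begin-equality
    𝟙 (between? u v k)  ≈⟨ 𝟙-yes (between? u v k) (u≤k , k≤v) ⟩
    1#  ≈⟨ solve 1 (λ o → o := o :- con (+ 0)) refl 1# ⟩
    1# - 0#  ≈⟨ +-cong (𝟙-yes (ι k ≤? v) k≤v) (-‿cong (𝟙-no (ι k <? u) (λ k<u → <⇒≱ k<u u≤k))) ⟨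
    𝟙 (ι k ≤? v) - 𝟙 (ι k <? u)  ∎

  count-between : ∀ {u v} m → 0# ≤ u → u ≤ v → v ≤ ι m →
    let count = ΣL (downFrom m) (λ k → 𝟙 (between? u v k)) in count ≤ v - u + 1# × v - u - 1# ≤ count
  count-between {u} {v} m 0≤u u≤v v≤m =
    let count≤v = proj₂ (count-initial (λ k → ι k ≤? v) (λ k≤v → k≤v) (λ k≰v → <⇒≤ (≰⇒> k≰v)) (≤-trans 0≤u u≤v) m) v≤m
        count<u = proj₂ (count-initial (λ k → ι k <? u) <⇒≤ ≮⇒≥ 0≤u m) (≤-trans u≤v v≤m)
    in (begin
         ΣL (downFrom m) (λ k → 𝟙 (between? u v k))  ≈⟨ split ⟩
         ΣL (downFrom m) (λ k → 𝟙 (ι k ≤? v)) - ΣL (downFrom m) (λ k → 𝟙 (ι k <? u))  ≤⟨ +-mono-≤ (proj₂ count≤v) (neg-mono-≤ (proj₁ count<u)) ⟩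
         v + 1# - u  ≈⟨ solve 3 (λ v o u → v :+ o :- u := v :- u :+ o) refl v 1# u ⟩
         v - u + 1#  ∎) , (begin
         v - u - 1#  ≈⟨ solve 3 (λ v o u → v :- u :- o := v :- (u :+ o)) refl v 1# u ⟩
         v - (u + 1#)  ≤⟨ +-mono-≤ (proj₁ count≤v) (neg-mono-≤ (proj₂ count<u)) ⟩
         ΣL (downFrom m) (λ k → 𝟙 (ι k ≤? v)) - ΣL (downFrom m) (λ k → 𝟙 (ι k <? u))  ≈⟨ split ⟨
         ΣL (downFrom m) (λ k → 𝟙 (between? u v k))  ∎)
    where
    split : ΣL (downFrom m) (λ k → 𝟙 (between? u v k)) ≈ ΣL (downFrom m) (λ k → 𝟙 (ι k ≤? v)) - ΣL (downFrom m) (λ k → 𝟙 (ι k <? u))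
    split = trans (ΣL-cong (downFrom m) (λ {k} _ → 𝟙-between u≤v k)) (ΣL-minus (downFrom m) _ _)

  -- There are q multiples; the spare 1 arises because passing to `range` adds the index pq while 0
  -- is kept.
  count-multiples : ∀ p q → 0 ℕ.< p → ΣL (downFrom (p ℕ.* q)) (λ k → 𝟙 (p ∣? k)) ≤ ι q + 1#
  count-multiples p q 0<p with ΣL-multiples p (p ℕ.* q) 0<p
  ... | m , r , pq≡ , _ , sums = begin
    ΣL (downFrom (p ℕ.* q)) (λ k → 𝟙 (p ∣? k))  ≤⟨ ΣL-downFrom≤ (p ℕ.* q) _ (λ k → 𝟙-nonneg (p ∣? k)) ⟩
    𝟙 (p ∣? 0) + ΣL (range (p ℕ.* q)) (λ k → 𝟙 (p ∣? k))  ≤⟨ +-monoˡ-≤ _ (𝟙≤1 (p ∣? 0)) ⟩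
    1# + ΣL (range (p ℕ.* q)) (λ k → 𝟙 (p ∣? k))  ≈⟨ +-congˡ (ΣL-cong (range (p ℕ.* q)) (λ _ → sym (*-identityʳ _))) ⟩
    1# + ΣL (range (p ℕ.* q)) (λ k → 𝟙 (p ∣? k) * 1#)  ≈⟨ +-congˡ (trans (sums (λ _ → 1#)) (trans (ΣL-range-const m 1#) (*-identityʳ _))) ⟩
    1# + ι m  ≤⟨ +-monoʳ-≤ 1# (ι-mono-≤ m≤q) ⟩
    1# + ι q  ≈⟨ +-comm 1# (ι q) ⟩
    ι q + 1#  ∎
    where
    m≤q : m ℕ.≤ q
    m≤q = ℕ.*-cancelˡ-≤ p {{ℕ.>-nonZero 0<p}} (ℕ.≤-trans (ℕ.m≤m+n _ r) (ℕ.≤-reflexive (≡.sym pq≡)))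

  module _ (a b : Carrier) (0≤a : 0# ≤ a) (a≤b : a ≤ b) (b≤1 : b ≤ 1#) where

    -- k stands for the root e^(2πik/(pq)).
    admissible? : ∀ p q k → Dec ((p ∤ k × q ∤ k) × (a * ι (p ℕ.* q) ≤ ι k × ι k ≤ b * ι (p ℕ.* q)))
    admissible? p q k = (¬? (p ∣? k) ×-dec ¬? (q ∣? k)) ×-dec between? (a * ι (p ℕ.* q)) (b * ι (p ℕ.* q)) k

    rootCount : ℕ → ℕ → Carrier
    rootCount p q = ΣL (downFrom (p ℕ.* q)) (λ k → 𝟙 (admissible? p q k))

    -- The interval holds (b - a)pq of the k up to an error of 1, and from these at most q + 1
    -- multiples of p and p + 1 multiples of q are removed. The errors add up to p + q + 3.
    rootCount-bound : ∀ p q → 0 ℕ.< p → 0 ℕ.< q → ∣ rootCount p q - (b - a) * (ι p * ι q) ∣ ≤ ι p + ι q + ι 3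
    rootCount-bound p q 0<p 0<q = ∣∣≤ (begin
        rootCount p q - (b - a) * (ι p * ι q)  ≤⟨ +-monoˡ-≤ _ (ΣL-mono (downFrom (p ℕ.* q)) (λ {k} _ → upper k)) ⟩
        ΣL (downFrom (p ℕ.* q)) (λ k → 𝟙 (I? k)) - (b - a) * (ι p * ι q)  ≤⟨ +-monoˡ-≤ _ (proj₁ count) ⟩
        b * ι (p ℕ.* q) - a * ι (p ℕ.* q) + 1# - (b - a) * (ι p * ι q)  ≈⟨ trans (+-congʳ (+-congʳ (+-cong (*-congˡ (ι-* p q)) (-‿cong (*-congˡ (ι-* p q))))))
                                                                                     (solve 4 (λ a b m o → b :* m :- a :* m :+ o :- (b :- a) :* m := o) refl a b (ι p * ι q) 1#) ⟩
        1#  ≈⟨ ι-1 ⟨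
        ι 1  ≤⟨ ≤-by (ι p + ι q + ι 2) (+-nonneg (+-nonneg (0≤ι p) (0≤ι q)) (0≤ι 2))
                                                                                     (solve 2 (λ p q → p :+ q :+ con (+ 3) := con (+ 1) :+ (p :+ q :+ con (+ 2))) refl (ι p) (ι q)) ⟩
        ι p + ι q + ι 3  ∎) (begin
        - (rootCount p q - (b - a) * (ι p * ι q))  ≈⟨ solve 2 (λ x y → :- (x :- y) := y :- x) refl (rootCount p q) _ ⟩
        (b - a) * (ι p * ι q) - rootCount p q  ≤⟨ +-monoʳ-≤ _ (neg-mono-≤ lower-sum) ⟩
        (b - a) * (ι p * ι q) - (b * ι (p ℕ.* q) - a * ι (p ℕ.* q) - 1# - (ι q + 1#) - (ι p + 1#))
                                                                                ≈⟨ +-congˡ (-‿cong (+-cong (+-cong (+-cong (+-cong (*-congˡ (ι-* p q)) (-‿cong (*-congˡ (ι-* p q)))) (-‿cong (sym ι-1))) (-‿cong (+-congˡ (sym ι-1)))) (-‿cong (+-congˡ (sym ι-1))))) ⟩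
        (b - a) * (ι p * ι q) - (b * (ι p * ι q) - a * (ι p * ι q) - ι 1 - (ι q + ι 1) - (ι p + ι 1))
                                                                                ≈⟨ solve 4 (λ a b p q → (b :- a) :* (p :* q) :- (b :* (p :* q) :- a :* (p :* q) :- con (+ 1) :- (q :+ con (+ 1)) :- (p :+ con (+ 1))) := p :+ q :+ con (+ 3)) refl a b (ι p) (ι q) ⟩
        ι p + ι q + ι 3  ∎)
      where
      I? : ∀ k → Dec (a * ι (p ℕ.* q) ≤ ι k × ι k ≤ b * ι (p ℕ.* q))
      I? = between? (a * ι (p ℕ.* q)) (b * ι (p ℕ.* q))
      count : ΣL (downFrom (p ℕ.* q)) (λ k → 𝟙 (I? k)) ≤ b * ι (p ℕ.* q) - a * ι (p ℕ.* q) + 1# ×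
              b * ι (p ℕ.* q) - a * ι (p ℕ.* q) - 1# ≤ ΣL (downFrom (p ℕ.* q)) (λ k → 𝟙 (I? k))
      count = count-between (p ℕ.* q) (*-nonneg 0≤a (0≤ι (p ℕ.* q))) (*-monoʳ-≤ _ (0≤ι (p ℕ.* q)) a≤b)
        (≤-trans (*-monoʳ-≤ _ (0≤ι (p ℕ.* q)) b≤1) (≤-reflexive (*-identityˡ _)))
      upper : ∀ k → 𝟙 (admissible? p q k) ≤ 𝟙 (I? k)
      upper k = 𝟙-mono (admissible? p q k) (I? k) proj₂
      lower : ∀ k → 𝟙 (I? k) - 𝟙 (p ∣? k) - 𝟙 (q ∣? k) ≤ 𝟙 (admissible? p q k)
      lower k = 𝟙-exclude (p ∣? k) (q ∣? k) (I? k)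
      lower-sum : b * ι (p ℕ.* q) - a * ι (p ℕ.* q) - 1# - (ι q + 1#) - (ι p + 1#) ≤ rootCount p q
      lower-sum = begin
        b * ι (p ℕ.* q) - a * ι (p ℕ.* q) - 1# - (ι q + 1#) - (ι p + 1#)
          ≤⟨ +-mono-≤ (+-mono-≤ (proj₂ count) (neg-mono-≤ (count-multiples p q 0<p)))
               (neg-mono-≤ (≤-trans (≤-reflexive (reflexive (≡.cong (λ n → ΣL (downFrom n) (λ k → 𝟙 (q ∣? k))) (ℕ.*-comm p q)))) (count-multiples q p 0<q))) ⟩
        ΣL (downFrom (p ℕ.* q)) (λ k → 𝟙 (I? k)) - ΣL (downFrom (p ℕ.* q)) (λ k → 𝟙 (p ∣? k)) - ΣL (downFrom (p ℕ.* q)) (λ k → 𝟙 (q ∣? k))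
          ≈⟨ +-congʳ (ΣL-minus (downFrom (p ℕ.* q)) (λ k → 𝟙 (I? k)) (λ k → 𝟙 (p ∣? k))) ⟨
        ΣL (downFrom (p ℕ.* q)) (λ k → 𝟙 (I? k) - 𝟙 (p ∣? k)) - ΣL (downFrom (p ℕ.* q)) (λ k → 𝟙 (q ∣? k))
          ≈⟨ ΣL-minus (downFrom (p ℕ.* q)) (λ k → 𝟙 (I? k) - 𝟙 (p ∣? k)) (λ k → 𝟙 (q ∣? k)) ⟨
        ΣL (downFrom (p ℕ.* q)) (λ k → 𝟙 (I? k) - 𝟙 (p ∣? k) - 𝟙 (q ∣? k))
          ≤⟨ ΣL-mono (downFrom (p ℕ.* q)) (λ {k} _ → lower k) ⟩
        rootCount p q
          ∎

  coprimeSum : ℕ → Carrier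
  coprimeSum n = ΣL (range n) (λ p → ΣL (range n) (λ q → 𝟙 (coprime? p q) * (ι p * ι q)))

  -- Möbius inversion and harmonic sums

  open Roughness

  signedDivisorSum : List (Carrier × ℕ) → ℕ → Carrier
  signedDivisorSum L m = ΣL L (λ (s , d) → s * 𝟙 (d ∣? m))

  -- The signed divisors d with sign μ(d), for the d composed of primes below y.
  record MöbiusList (y : ℕ) : Set (c ⊔ ℓ₁ ⊔ ℓ₂) where
    field
      terms    : List (Carrier × ℕ)
      sign≤1   : ∀ {t} → t ∈ terms → ∣ proj₁ t ∣ ≤ 1#
      positive : ∀ {t} → t ∈ terms → 0 ℕ.< proj₂ t
      smooth   : ∀ {t} → t ∈ terms → ∀ {r} → Prime r → y ℕ.≤ r → r ∤ proj₂ t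
      unique   : Unique (map proj₂ terms)
      sieves   : ∀ m → 0 ℕ.< m → signedDivisorSum terms m ≈ 𝟙 (rough? y m)

  -- A signed sieve of Eratosthenes. A prime y adds y d with the opposite sign for each d in the
  -- list; `smooth` keeps these multiples of y apart from the old divisors. If y divides m, the new
  -- terms form the old sum for m/y, which is y-rough exactly when m is, so everything cancels;
  -- otherwise the new terms vanish. For y not prime, being y-rough and being (y + 1)-rough
  -- coincide.
  möbiusList : ∀ y → MöbiusList y
  möbiusList zero = record
    { terms    = [ 1# , 1 ]
    ; sign≤1   = λ { (here ≡.refl) → ≤-reflexive (nonneg⇒∣x∣≈x 0≤1) }
    ; positive = λ { (here ≡.refl) → ℕ.z<s }
    ; smooth   = λ { (here ≡.refl) {r} y-prime _ r∣1 → ℕ.nonTrivial⇒≢1 {r} {{prime⇒nonTrivial y-prime}} (∣1⇒≡1 r∣1) }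
    ; unique   = [] ∷ []
    ; sieves   = λ m _ → trans (+-identityʳ _) (trans (*-identityˡ _) (𝟙-cong (1 ∣? m) (rough? 0 m) (λ _ → 0-rough) (λ _ → 1∣ m)))
    }
  möbiusList (suc y) with prime? y
  ... | no ¬y-prime = record
    { terms    = terms
    ; sign≤1   = sign≤1
    ; positive = positive
    ; smooth   = λ t∈ y-prime y<r → smooth t∈ y-prime (ℕ.<⇒≤ y<r)
    ; unique   = unique
    ; sieves   = λ m 0<m → trans (sieves m 0<m) (𝟙-cong (rough? y m) (rough? (suc y) m) (¬prime⇒rough-suc ¬y-prime) rough-weaken)
    }
    where open MöbiusList (möbiusList y)
  ... | yes y-prime = record
    { terms    = terms ++ map multiple terms
    ; sign≤1   = λ t∈ → [ sign≤1 , (λ t∈ → let t′ , t′∈ , eq = ∈-map⁻ multiple t∈ in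
                     ≡.subst (λ t → ∣ proj₁ t ∣ ≤ 1#) (≡.sym eq) (≤-trans (≤-reflexive (∣-x∣≈∣x∣ _)) (sign≤1 t′∈))) ]′ (∈-++⁻ terms t∈)
    ; positive = λ t∈ → [ positive , (λ t∈ → let t′ , t′∈ , eq = ∈-map⁻ multiple t∈ in
                     ≡.subst (λ t → 0 ℕ.< proj₂ t) (≡.sym eq) (ℕ.*-mono-< {0} {y} {0} 0<y (positive t′∈))) ]′ (∈-++⁻ terms t∈)
    ; smooth   = λ t∈ r-prime y<r → [ (λ t∈ → smooth t∈ r-prime (ℕ.<⇒≤ y<r)) , (λ t∈ → let t′ , t′∈ , eq = ∈-map⁻ multiple t∈ in
                     ≡.subst (λ t → _ ∤ proj₂ t) (≡.sym eq) (λ r∣yd → [ (λ r∣y → ℕ.<⇒≱ y<r (∣⇒≤ {{prime⇒nonZero y-prime}} r∣y))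
                                                                    , smooth t′∈ r-prime (ℕ.<⇒≤ y<r) ]′ (euclidsLemma y (proj₂ t′) r-prime r∣yd))) ]′ (∈-++⁻ terms t∈)
    ; unique   = ≡.subst Unique (≡.sym divisors≡) (Unique.++⁺ unique (Unique.map⁺ (ℕ.*-cancelˡ-≡ _ _ y {{prime⇒nonZero y-prime}}) unique) disjoint)
    ; sieves   = λ m 0<m → trans (ΣL-++ terms (map multiple terms) _)
                   (trans (+-congˡ (reflexive (ΣL-map multiple terms _))) (step m 0<m (y ∣? m)))
    }
    where
    open MöbiusList (möbiusList y)
    0<y : 0 ℕ.< y
    0<y = ℕ.>-nonZero⁻¹ y {{prime⇒nonZero y-prime}}
    multiple : Carrier × ℕ → Carrier × ℕ
    multiple (s , d) = - s , y ℕ.* d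
    divisors≡ : map proj₂ (terms ++ map multiple terms) ≡ map proj₂ terms ++ map (y ℕ.*_) (map proj₂ terms)
    divisors≡ = ≡.trans (List.map-++ proj₂ terms (map multiple terms))
      (≡.cong (map proj₂ terms ++_) (≡.trans (≡.sym (List.map-∘ terms)) (List.map-∘ terms)))
    disjoint : ∀ {d} → ¬ (d ∈ map proj₂ terms × d ∈ map (y ℕ.*_) (map proj₂ terms))
    disjoint (d∈ , d∈y*) with ∈-map⁻ proj₂ d∈ | ∈-map⁻ (y ℕ.*_) d∈y*
    ... | t , t∈ , ≡.refl | e , _ , eq = smooth t∈ y-prime ℕ.≤-refl (≡.subst (y ∣_) (≡.sym eq) (m∣m*n e))
    step : ∀ m → 0 ℕ.< m → Dec (y ∣ m) →
      signedDivisorSum terms m + ΣL terms (λ (s , d) → - s * 𝟙 (y ℕ.* d ∣? m)) ≈ 𝟙 (rough? (suc y) m)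
    step m 0<m (no y∤m) = begin-equality
      signedDivisorSum terms m + ΣL terms (λ (s , d) → - s * 𝟙 (y ℕ.* d ∣? m))
        ≈⟨ +-cong (sieves m 0<m) (ΣL-zero terms (λ {(s , d)} _ → trans (*-congˡ (𝟙-no (y ℕ.* d ∣? m) (λ yd∣m → y∤m (∣-trans (m∣m*n d) yd∣m)))) (zeroʳ _))) ⟩
      𝟙 (rough? y m) + 0#  ≈⟨ +-identityʳ _ ⟩
      𝟙 (rough? y m)  ≈⟨ 𝟙-cong (rough? y m) (rough? (suc y) m) (∤⇒rough-suc y∤m) rough-weaken ⟩
      𝟙 (rough? (suc y) m)  ∎
    step m 0<m (yes (divides m′ m≡m′y)) = begin-equality
      signedDivisorSum terms m + ΣL terms (λ (s , d) → - s * 𝟙 (y ℕ.* d ∣? m))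
        ≈⟨ +-cong (sieves m 0<m) (ΣL-cong terms (λ {(s , d)} _ → trans (*-congˡ (cancel d)) (solve 2 (λ s i → :- s :* i := :- con (+ 1) :* (s :* i)) refl s _))) ⟩
      𝟙 (rough? y m) + ΣL terms (λ (s , d) → - ι 1 * (s * 𝟙 (d ∣? m′)))
        ≈⟨ +-congˡ (trans (ΣL-*ˡ terms (- ι 1) _) (*-congˡ (sieves m′ 0<m′))) ⟩
      𝟙 (rough? y m) + - ι 1 * 𝟙 (rough? y m′)
        ≈⟨ +-congˡ (*-congˡ (𝟙-cong (rough? y m′) (rough? y m)
             (λ rough → ≡.subst (y Rough_) (≡.sym m≡ym′) (rough-* y-prime rough))
             (λ rough → rough∧∣⇒rough rough (divides y m≡ym′)))) ⟩
      𝟙 (rough? y m) + - ι 1 * 𝟙 (rough? y m)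
        ≈⟨ solve 1 (λ i → i :+ :- con (+ 1) :* i := con (+ 0)) refl (𝟙 (rough? y m)) ⟩
      0#
        ≈⟨ 𝟙-no (rough? (suc y) m) (λ rough → rough-suc⇒∤ {{prime⇒nonTrivial y-prime}} rough (divides m′ m≡m′y)) ⟨
      𝟙 (rough? (suc y) m)
        ∎
      where
      m≡ym′ : m ≡ y ℕ.* m′
      m≡ym′ = ≡.trans m≡m′y (ℕ.*-comm m′ y)
      0<m′ : 0 ℕ.< m′
      0<m′ = ℕ.n≢0⇒n>0 λ { ≡.refl → ℕ.<-irrefl (≡.sym m≡m′y) 0<m }
      cancel : ∀ d → 𝟙 (y ℕ.* d ∣? m) ≈ 𝟙 (d ∣? m′)
      cancel d = 𝟙-cong (y ℕ.* d ∣? m) (d ∣? m′)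
        (λ yd∣m → *-cancelˡ-∣ y {{prime⇒nonZero y-prime}} (≡.subst (y ℕ.* d ∣_) m≡ym′ yd∣m))
        (λ d∣m′ → ≡.subst (y ℕ.* d ∣_) (≡.sym m≡ym′) (*-monoʳ-∣ y d∣m′))

  module _ (n : ℕ) where
    open MöbiusList (möbiusList (suc n)) public

    -- The list contains every product of distinct primes up to n, hence also many d > n; those
    -- divide no m in the range considered. Among 1, ..., n only 1 survives the sieve.
    möbius-inversion : ∀ {m} → 0 ℕ.< m → m ℕ.≤ n → signedDivisorSum terms m ≈ 𝟙 (m ℕ.≟ 1)
    möbius-inversion {m} 0<m m≤n = trans (sieves m 0<m)
      (𝟙-cong (rough? (suc n) m) (m ℕ.≟ 1) (rough⇒≡1 0<m m≤n) (λ { ≡.refl → rough-1 (suc n) }))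

  ΣL-unique-≟ : ∀ {g : ℕ → Carrier} k xs → 0# ≤ g k → Unique xs → ΣL xs (λ d → 𝟙 (d ℕ.≟ k) * g d) ≤ g k
  ΣL-unique-≟ {g} k []       0≤gk _ = 0≤gk
  ΣL-unique-≟ {g} k (x ∷ xs) 0≤gk (x≢ ∷ unique) with x ℕ.≟ k
  ... | no x≢k = begin
    𝟙 (no x≢k) * g x + ΣL xs (λ d → 𝟙 (d ℕ.≟ k) * g d)  ≈⟨ +-congʳ (trans (*-congʳ (𝟙-no (no x≢k) x≢k)) (zeroˡ _)) ⟩
    0# + ΣL xs (λ d → 𝟙 (d ℕ.≟ k) * g d)  ≈⟨ +-identityˡ _ ⟩
    ΣL xs (λ d → 𝟙 (d ℕ.≟ k) * g d)  ≤⟨ ΣL-unique-≟ {g} k xs 0≤gk unique ⟩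
    g k  ∎
  ... | yes ≡.refl = ≤-reflexive (begin-equality
    𝟙 (yes ≡.refl) * g x + ΣL xs (λ d → 𝟙 (d ℕ.≟ x) * g d)  ≈⟨ +-cong (trans (*-congʳ (𝟙-yes (yes ≡.refl) ≡.refl)) (*-identityˡ _))
                                                                     (ΣL-zero xs (λ {d} d∈ → trans (*-congʳ (𝟙-no (d ℕ.≟ x) (λ d≡x → All.lookup x≢ d∈ (≡.sym d≡x)))) (zeroˡ _))) ⟩
    g x + 0#  ≈⟨ +-identityʳ _ ⟩
    g x  ∎)

  -- Since the divisors are distinct, each d ≤ n occurs at most once. This bounds the sum of 1/d
  -- over the Möbius list by a harmonic sum.
  ΣL-unique≤ΣL-range : ∀ {g : ℕ → Carrier} xs n → (∀ {d} → 0 ℕ.< d → 0# ≤ g d) → (∀ {d} → d ∈ xs → 0 ℕ.< d) → Unique xs →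
    ΣL xs (λ d → 𝟙 (d ℕ.≤? n) * g d) ≤ ΣL (range n) g
  ΣL-unique≤ΣL-range {g} xs zero    0≤g 0<d unique = ≤-reflexive (ΣL-zero xs (λ {d} d∈ →
    trans (*-congʳ (𝟙-no (d ℕ.≤? 0) (ℕ.<⇒≱ (0<d d∈)))) (zeroˡ _)))
  ΣL-unique≤ΣL-range {g} xs (suc n) 0≤g 0<d unique = begin
    ΣL xs (λ d → 𝟙 (d ℕ.≤? suc n) * g d)
      ≈⟨ ΣL-cong xs (λ {d} _ → trans (*-congʳ (split d)) (distribʳ _ _ _)) ⟩
    ΣL xs (λ d → 𝟙 (d ℕ.≟ suc n) * g d + 𝟙 (d ℕ.≤? n) * g d)
      ≈⟨ ΣL-+ xs _ _ ⟩
    ΣL xs (λ d → 𝟙 (d ℕ.≟ suc n) * g d) + ΣL xs (λ d → 𝟙 (d ℕ.≤? n) * g d)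
      ≤⟨ +-mono-≤ (ΣL-unique-≟ {g} (suc n) xs (0≤g ℕ.z<s) unique) (ΣL-unique≤ΣL-range xs n 0≤g 0<d unique) ⟩
    g (suc n) + ΣL (range n) g
      ∎
    where
    split : ∀ d → 𝟙 (d ℕ.≤? suc n) ≈ 𝟙 (d ℕ.≟ suc n) + 𝟙 (d ℕ.≤? n)
    split d with ℕ.<-cmp d (suc n)
    ... | tri< d<1+n d≢1+n _ = trans (𝟙-yes (d ℕ.≤? suc n) (ℕ.<⇒≤ d<1+n))
          (sym (trans (+-cong (𝟙-no (d ℕ.≟ suc n) d≢1+n) (𝟙-yes (d ℕ.≤? n) (ℕ.s≤s⁻¹ d<1+n))) (+-identityˡ 1#)))
    ... | tri≈ _ d≡1+n _ = trans (𝟙-yes (d ℕ.≤? suc n) (ℕ.≤-reflexive d≡1+n))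
          (sym (trans (+-cong (𝟙-yes (d ℕ.≟ suc n) d≡1+n) (𝟙-no (d ℕ.≤? n) (λ d≤n → ℕ.<-irrefl d≡1+n (ℕ.s≤s d≤n)))) (+-identityʳ 1#)))
    ... | tri> d≮1+n d≢1+n d>1+n = trans (𝟙-no (d ℕ.≤? suc n) (ℕ.<⇒≱ d>1+n))
          (sym (trans (+-cong (𝟙-no (d ℕ.≟ suc n) d≢1+n) (𝟙-no (d ℕ.≤? n) (λ d≤n → d≮1+n (ℕ.s≤s d≤n)))) (+-identityˡ 0#)))

  harmonic : ℕ → Carrier
  harmonic n = ΣL (range n) (λ k → (ι k) ⁻¹)

  harmonic-mono : ∀ {m n} → m ℕ.≤ n → harmonic m ≤ harmonic n
  harmonic-mono {m} m≤n = go (ℕ.≤⇒≤′ m≤n)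
    where
    go : ∀ {n} → m ℕ.≤′ n → harmonic m ≤ harmonic n
    go ℕ.≤′-refl = ≤-refl
    go (ℕ.≤′-step {n} m≤n) = ≤-trans (go m≤n) (≤-by _ (⁻¹-nonneg (0<ι-suc n)) (+-comm _ _))

  harmonic-extend : ∀ m j → harmonic (j ℕ.+ m) ≤ harmonic m + ι j * (ι (suc m)) ⁻¹
  harmonic-extend m zero    = ≤-reflexive (sym (trans (+-congˡ (zeroˡ _)) (+-identityʳ _)))
  harmonic-extend m (suc j) = begin
    (ι (suc (j ℕ.+ m))) ⁻¹ + harmonic (j ℕ.+ m)  ≤⟨ +-mono-≤ (⁻¹-anti-≤ (0<ι-suc m) (ι-mono-≤ (ℕ.s≤s (ℕ.m≤n+m m j)))) (harmonic-extend m j) ⟩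
    (ι (suc m)) ⁻¹ + (harmonic m + ι j * (ι (suc m)) ⁻¹)  ≈⟨ +-congʳ (*-identityˡ _) ⟨
    1# * (ι (suc m)) ⁻¹ + (harmonic m + ι j * (ι (suc m)) ⁻¹)  ≈⟨ solve 4 (λ o v h j → o :* v :+ (h :+ j :* v) := h :+ (o :+ j) :* v) refl 1# _ (harmonic m) (ι j) ⟩
    harmonic m + (1# + ι j) * (ι (suc m)) ⁻¹  ∎

  harmonic-double : ∀ m → harmonic (suc m ℕ.+ m) ≤ harmonic m + 1#
  harmonic-double m = ≤-trans (harmonic-extend m (suc m)) (≤-reflexive (+-congˡ (⁻¹-inverseʳ (pos⇒≉0 (0<ι-suc m)))))

  -- Halving n lowers the harmonic sum by at most 1: with h = ⌊n/2⌋ at most h + 1 terms are lost,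
  -- each at most 1/(h + 1). The number k of halvings satisfies 2^k ≤ n.
  harmonic-dyadic : ∀ n → 0 ℕ.< n → ∃ λ k → 2 ℕ.^ k ℕ.≤ n × harmonic n ≤ ι (suc k)
  harmonic-dyadic n 0<n = go n n ℕ.≤-refl 0<n
    where
    -- The bound f on n makes the recursion on ⌊n/2⌋ structural.
    go : ∀ f n → n ℕ.≤ f → 0 ℕ.< n → ∃ λ k → 2 ℕ.^ k ℕ.≤ n × harmonic n ≤ ι (suc k)
    go f 1 _ _ = 0 , ℕ.≤-refl , ≤-reflexive (+-congʳ ι1⁻¹≈1)
    go (suc f) n@(2+ n-2) (ℕ.s≤s n-1≤f) _ =
      let h = ℕ.⌊ n /2⌋
          k , 2^k≤h , H≤ = go f h (ℕ.≤-trans (ℕ.s≤s (ℕ.⌊n/2⌋≤n n-2)) n-1≤f) ℕ.z<s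
      in suc k
       , ℕ.≤-trans (ℕ.*-monoʳ-≤ 2 2^k≤h) (ℕ.≤-trans (ℕ.≤-reflexive (≡.cong (h ℕ.+_) (ℕ.+-identityʳ h)))
           (ℕ.≤-trans (ℕ.+-monoʳ-≤ h (ℕ.⌊n/2⌋≤⌈n/2⌉ n)) (ℕ.≤-reflexive (ℕ.⌊n/2⌋+⌈n/2⌉≡n n))))
       , (begin
           harmonic n  ≤⟨ harmonic-mono (n≤1+2⌊n/2⌋ n) ⟩
           harmonic (suc h ℕ.+ h)  ≤⟨ harmonic-double h ⟩
           harmonic h + 1#  ≤⟨ +-monoˡ-≤ 1# H≤ ⟩
           ι (suc k) + 1#  ≈⟨ +-comm _ _ ⟩
           ι (suc (suc k))  ∎)
      where
      n≤1+2⌊n/2⌋ : ∀ n → n ℕ.≤ suc ℕ.⌊ n /2⌋ ℕ.+ ℕ.⌊ n /2⌋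
      n≤1+2⌊n/2⌋ 0      = ℕ.z≤n
      n≤1+2⌊n/2⌋ 1      = ℕ.s≤s ℕ.z≤n
      n≤1+2⌊n/2⌋ (2+ n) = ℕ.s≤s (ℕ.≤-trans (ℕ.s≤s (n≤1+2⌊n/2⌋ n)) (ℕ.≤-reflexive (≡.cong suc (≡.sym (ℕ.+-suc _ _)))))

  -- The sum of pq over coprime pairs

  inverseSquares : ℕ → Carrier
  inverseSquares m = ΣL (range m) (λ k → (ι k ^ 2) ⁻¹)

  inverse-square : ∀ {x} → 0# < x → (x ^ 2) ⁻¹ ≈ x ⁻¹ * x ⁻¹
  inverse-square {x} 0<x = trans (⁻¹-cong (*-congˡ (*-identityʳ x))) (⁻¹-distrib-* 0<x 0<x)

  inverse-square-pos : ∀ k → 0# < (ι (suc k) ^ 2) ⁻¹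
  inverse-square-pos k = ⁻¹-pos (^-pos 2 (0<ι-suc k))

  inverseSquares-mono : ∀ {m n} → m ℕ.≤ n → inverseSquares m ≤ inverseSquares n
  inverseSquares-mono {m} m≤n = go (ℕ.≤⇒≤′ m≤n)
    where
    go : ∀ {n} → m ℕ.≤′ n → inverseSquares m ≤ inverseSquares n
    go ℕ.≤′-refl = ≤-refl
    go (ℕ.≤′-step {n} m≤n) = ≤-trans (go m≤n) (≤-by _ (<⇒≤ (inverse-square-pos n)) (+-comm _ _))

  -- 1/(j+1)² ≤ 1/(j(j+1)) = 1/j - 1/(j+1)
  telescoping : ∀ j → 0 ℕ.< j → (ι (suc j) ^ 2) ⁻¹ + (ι (suc j)) ⁻¹ ≤ (ι j) ⁻¹
  telescoping j 0<j = begin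
    (ι (suc j) ^ 2) ⁻¹ + y  ≈⟨ +-congʳ (inverse-square (0<ι-suc j)) ⟩
    y * y + y  ≤⟨ +-monoˡ-≤ y (*-monoʳ-≤ y (⁻¹-nonneg (0<ι-suc j)) (⁻¹-anti-≤ (0<ι 0<j) (ι-mono-≤ (ℕ.n≤1+n j)))) ⟩
    x * y + y  ≈⟨ +-congˡ (trans (*-congʳ (⁻¹-inverseʳ (pos⇒≉0 (0<ι 0<j)))) (*-identityˡ y)) ⟨
    x * y + ι j * x * y  ≈⟨ +-congʳ (trans (*-assoc 1# x y) (*-identityˡ (x * y))) ⟨
    1# * x * y + ι j * x * y  ≈⟨ solve 4 (λ o j x y → o :* x :* y :+ j :* x :* y := x :* ((o :+ j) :* y)) refl 1# (ι j) x y ⟩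
    x * (ι (suc j) * y)  ≈⟨ trans (*-congˡ (⁻¹-inverseʳ (pos⇒≉0 (0<ι-suc j)))) (*-identityʳ x) ⟩
    x  ∎
    where
    x = (ι j) ⁻¹
    y = (ι (suc j)) ⁻¹

  -- By `telescoping`, adding 1/n to the partial sum yields a sequence that does not increase.
  inverseSquares-upper : ∀ {m n} → 0 ℕ.< m → m ℕ.≤ n → inverseSquares n ≤ inverseSquares m + (ι m) ⁻¹
  inverseSquares-upper {m} {n} 0<m m≤n = ≤-trans (≤-by _ (⁻¹-nonneg (0<ι (ℕ.≤-trans 0<m m≤n))) refl) (go (ℕ.≤⇒≤′ m≤n))
    where
    go : ∀ {n} → m ℕ.≤′ n → inverseSquares n + (ι n) ⁻¹ ≤ inverseSquares m + (ι m) ⁻¹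
    go ℕ.≤′-refl = ≤-refl
    go (ℕ.≤′-step {n} m≤n) = begin
      (ι (suc n) ^ 2) ⁻¹ + inverseSquares n + (ι (suc n)) ⁻¹  ≈⟨ solve 3 (λ a b c → a :+ b :+ c := b :+ (a :+ c)) refl _ _ _ ⟩
      inverseSquares n + ((ι (suc n) ^ 2) ⁻¹ + (ι (suc n)) ⁻¹)  ≤⟨ +-monoʳ-≤ _ (telescoping n (ℕ.≤-trans 0<m (ℕ.≤′⇒≤ m≤n))) ⟩
      inverseSquares n + (ι n) ⁻¹  ≤⟨ go m≤n ⟩
      inverseSquares m + (ι m) ⁻¹  ∎

  -- The factor 2 clears the denominator of m(m + 1)/2. Squared, it becomes the 4 in 4ζ(2).
  twice-triangular : ∀ d m → ι 2 * ΣL (range m) (λ e → ι (d ℕ.* e)) ≈ ι d * (ι m * (ι m + ι 1))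
  twice-triangular d zero    = solve 1 (λ d → con (+ 2) :* con (+ 0) := d :* (con (+ 0) :* (con (+ 0) :+ con (+ 1)))) refl (ι d)
  twice-triangular d (suc m) = begin-equality
    ι 2 * (ι (d ℕ.* suc m) + S)  ≈⟨ *-congˡ (+-congʳ (trans (ι-* d (suc m)) (*-congˡ (+-congʳ (sym ι-1))))) ⟩
    ι 2 * (ι d * (ι 1 + ι m) + S)  ≈⟨ distribˡ _ _ _ ⟩
    ι 2 * (ι d * (ι 1 + ι m)) + ι 2 * S  ≈⟨ +-congˡ (twice-triangular d m) ⟩
    ι 2 * (ι d * (ι 1 + ι m)) + ι d * (ι m * (ι m + ι 1))  ≈⟨ solve 2 (λ d m → con (+ 2) :* (d :* (con (+ 1) :+ m)) :+ d :* (m :* (m :+ con (+ 1)))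
                                                                       := d :* ((con (+ 1) :+ m) :* ((con (+ 1) :+ m) :+ con (+ 1)))) refl (ι d) (ι m) ⟩
    ι d * ((ι 1 + ι m) * ((ι 1 + ι m) + ι 1))  ≈⟨ *-congˡ (*-cong (+-congʳ ι-1) (+-congʳ (+-congʳ ι-1))) ⟩
    ι d * (ι (suc m) * (ι (suc m) + ι 1))  ∎
    where S = ΣL (range m) (λ e → ι (d ℕ.* e))

  inverseSquares-scale : ∀ d m → 0 ℕ.< d → ΣL (range m) (λ e → (ι (d ℕ.* e) ^ 2) ⁻¹) ≈ (ι d) ⁻¹ * (ι d) ⁻¹ * inverseSquares m
  inverseSquares-scale d m 0<d = trans (ΣL-cong (range m) (λ e∈ → scale (proj₁ (∈-range⁻ m e∈)))) (ΣL-*ˡ (range m) _ _)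
    where
    scale : ∀ {e} → 0 ℕ.< e → (ι (d ℕ.* e) ^ 2) ⁻¹ ≈ (ι d) ⁻¹ * (ι d) ⁻¹ * (ι e ^ 2) ⁻¹
    scale {e} 0<e = begin-equality
      (ι (d ℕ.* e) ^ 2) ⁻¹  ≈⟨ inverse-square (0<ι (ℕ.*-mono-< {0} {d} {0} 0<d 0<e)) ⟩
      (ι (d ℕ.* e)) ⁻¹ * (ι (d ℕ.* e)) ⁻¹  ≈⟨ *-cong eq eq ⟩
      (ι d) ⁻¹ * (ι e) ⁻¹ * ((ι d) ⁻¹ * (ι e) ⁻¹)  ≈⟨ solve 2 (λ u v → u :* v :* (u :* v) := u :* u :* (v :* v)) refl _ _ ⟩
      (ι d) ⁻¹ * (ι d) ⁻¹ * ((ι e) ⁻¹ * (ι e) ⁻¹)  ≈⟨ *-congˡ (inverse-square (0<ι 0<e)) ⟨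
      (ι d) ⁻¹ * (ι d) ⁻¹ * (ι e ^ 2) ⁻¹  ∎
      where
      eq : (ι (d ℕ.* e)) ⁻¹ ≈ (ι d) ⁻¹ * (ι e) ⁻¹
      eq = trans (⁻¹-cong (ι-* d e)) (⁻¹-distrib-* (0<ι 0<d) (0<ι 0<e))

  -- x plays the role of n/d and M that of ⌊n/d⌋.
  floor-error : ∀ ζ M x Z → ι 1 ≤ M → M ≤ x → x ≤ M + ι 1 → 0# ≤ ζ → ζ ≤ ι 2 → Z ≤ ζ → ζ ≤ Z + M ⁻¹ →
    ∣ ζ * ((M * (M + ι 1)) ^ 2) - x ^ 4 * Z ∣ ≤ ι 24 * x ^ 3
  floor-error ζ M x Z 1≤M M≤x x≤M+1 0≤ζ ζ≤2 Z≤ζ ζ≤Z+M⁻¹ = ∣∣≤ (begin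
      ζ * Q - x ^ 4 * Z
        ≈⟨ solve 5 (λ z q x4 Z w → z :* q :- x4 :* Z := z :* (q :- x4) :+ x4 :* (z :- (Z :+ w)) :+ x4 :* w) refl ζ Q (x ^ 4) Z (M ⁻¹) ⟩
      ζ * (Q - x ^ 4) + x ^ 4 * (ζ - (Z + M ⁻¹)) + x ^ 4 * M ⁻¹
        ≤⟨ +-mono-≤ (+-mono-≤ (*-monoˡ-≤ ζ 0≤ζ Q-x⁴≤) (*-monoˡ-≤ (x ^ 4) (^-nonneg 4 0≤x) ζ-Z-w≤0)) x⁴w≤ ⟩
      ζ * (ι 3 * x ^ 3) + x ^ 4 * 0# + ι 2 * x ^ 3
        ≤⟨ +-monoˡ-≤ _ (+-monoˡ-≤ _ (*-monoʳ-≤ _ (*-nonneg (0≤ι 3) 0≤x³) ζ≤2)) ⟩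
      ι 2 * (ι 3 * x ^ 3) + x ^ 4 * 0# + ι 2 * x ^ 3
        -- This side needs only 2 · 3 + 2 = 8; the slack 16 raises it to 24 = 2 · 12, the constant
        -- of the other side.
        ≤⟨ ≤-by (ι 16 * x ^ 3) (*-nonneg (0≤ι 16) 0≤x³)
             (solve 2 (λ y x4 → con (+ 24) :* y := con (+ 2) :* (con (+ 3) :* y) :+ x4 :* con (+ 0) :+ con (+ 2) :* y :+ con (+ 16) :* y) refl (x ^ 3) (x ^ 4)) ⟩
      ι 24 * x ^ 3
        ∎) (begin
      - (ζ * Q - x ^ 4 * Z)
        ≈⟨ solve 4 (λ z q x4 Z → :- (z :* q :- x4 :* Z) := x4 :* Z :- z :* q) refl ζ Q (x ^ 4) Z ⟩
      x ^ 4 * Z - ζ * Q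
        ≤⟨ +-monoˡ-≤ _ (*-monoˡ-≤ (x ^ 4) (^-nonneg 4 0≤x) Z≤ζ) ⟩
      x ^ 4 * ζ - ζ * Q
        ≈⟨ solve 3 (λ z q x4 → x4 :* z :- z :* q := z :* (x4 :- q)) refl ζ Q (x ^ 4) ⟩
      ζ * (x ^ 4 - Q)
        ≤⟨ *-monoˡ-≤ ζ 0≤ζ x⁴-Q≤ ⟩
      ζ * (ι 12 * x ^ 3)
        ≤⟨ *-monoʳ-≤ _ (*-nonneg (0≤ι 12) 0≤x³) ζ≤2 ⟩
      ι 2 * (ι 12 * x ^ 3)
        ≈⟨ solve 1 (λ y → con (+ 2) :* (con (+ 12) :* y) := con (+ 24) :* y) refl (x ^ 3) ⟩
      ι 24 * x ^ 3
        ∎)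
    where
    Q = (M * (M + ι 1)) ^ 2
    t = M - ι 1
    0≤t : 0# ≤ t
    0≤t = x≤y⇒0≤y-x 1≤M
    0<M : 0# < M
    0<M = <-≤-trans (0<ι-suc 0) 1≤M
    0≤M : 0# ≤ M
    0≤M = <⇒≤ 0<M
    0≤x : 0# ≤ x
    0≤x = ≤-trans 0≤M M≤x
    0≤x³ : 0# ≤ x ^ 3
    0≤x³ = ^-nonneg 3 0≤x
    ζ-Z-w≤0 : ζ - (Z + M ⁻¹) ≤ 0#
    ζ-Z-w≤0 = ≤-trans (+-monoˡ-≤ _ ζ≤Z+M⁻¹) (≤-reflexive (-‿inverseʳ _))
    x⁴w≤ : x ^ 4 * M ⁻¹ ≤ ι 2 * x ^ 3
    x⁴w≤ = begin
      x ^ 4 * M ⁻¹  ≈⟨ *-assoc _ _ _ ⟩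
      x * (x ^ 3 * M ⁻¹)  ≤⟨ *-monoʳ-≤ _ (*-nonneg 0≤x³ (⁻¹-nonneg 0<M)) (≤-trans x≤M+1 (+-monoʳ-≤ M 1≤M)) ⟩
      (M + M) * (x ^ 3 * M ⁻¹)  ≈⟨ solve 3 (λ m y w → (m :+ m) :* (y :* w) := con (+ 2) :* y :* (m :* w)) refl M (x ^ 3) (M ⁻¹) ⟩
      ι 2 * x ^ 3 * (M * M ⁻¹)  ≈⟨ trans (*-congˡ (⁻¹-inverseʳ (pos⇒≉0 0<M))) (*-identityʳ _) ⟩
      ι 2 * x ^ 3  ∎
    Q-x⁴≤ : Q - x ^ 4 ≤ ι 3 * x ^ 3
    Q-x⁴≤ = begin
      Q - x ^ 4  ≤⟨ +-monoʳ-≤ Q (neg-mono-≤ (^-mono-≤ 4 0≤M M≤x)) ⟩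
      -- The left side is 2M³ + M², and M ≥ 1.
      Q - M ^ 4  ≤⟨ ≤-by (M ^ 2 * t) (*-nonneg (^-nonneg 2 0≤M) 0≤t)
                                           (solve 1 (λ m → con (+ 3) :* m :^ 3 := (m :* (m :+ con (+ 1))) :^ 2 :- m :^ 4 :+ m :^ 2 :* (m :- con (+ 1))) refl M) ⟩
      ι 3 * M ^ 3  ≤⟨ *-monoˡ-≤ _ (0≤ι 3) (^-mono-≤ 3 0≤M M≤x) ⟩
      ι 3 * x ^ 3  ∎
    -- In terms of t = M - 1 the difference of the two sides has nonnegative coefficients.
    x⁴-Q≤ : x ^ 4 - Q ≤ ι 12 * x ^ 3
    x⁴-Q≤ = begin
      x ^ 4 - Q  ≤⟨ +-monoˡ-≤ (- Q) (^-mono-≤ 4 0≤x x≤M+1) ⟩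
      -- The left side is 2M³ + 5M² + 4M + 1, and 12 is the sum of its coefficients.
      (M + ι 1) ^ 4 - Q  ≤⟨ ≤-by (ι 16 * t + ι 25 * t ^ 2 + ι 10 * t ^ 3)
                                           (+-nonneg (+-nonneg (*-nonneg (0≤ι 16) 0≤t) (*-nonneg (0≤ι 25) (^-nonneg 2 0≤t))) (*-nonneg (0≤ι 10) (^-nonneg 3 0≤t)))
                                           (solve 1 (λ m → con (+ 12) :* m :^ 3 := (m :+ con (+ 1)) :^ 4 :- (m :* (m :+ con (+ 1))) :^ 2
                                              :+ (con (+ 16) :* (m :- con (+ 1)) :+ con (+ 25) :* (m :- con (+ 1)) :^ 2 :+ con (+ 10) :* (m :- con (+ 1)) :^ 3)) refl M) ⟩
      ι 12 * M ^ 3  ≤⟨ *-monoˡ-≤ _ (0≤ι 12) (^-mono-≤ 3 0≤M M≤x) ⟩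
      ι 12 * x ^ 3  ∎

  inverseSquare : ℕ → Carrier
  inverseSquare k = (ι k ^ 2) ⁻¹

  module _ (ζ : Carrier) (isZeta : IsZeta2 ζ) where

    partialSums⟶ζ : inverseSquares ⟶ ζ
    partialSums⟶ζ = ⟶-cong (λ m → trans (reflexive (≡.sym (Σ<≡sum m (λ k → (ι (suc k) ^ 2) ⁻¹)))) (convert m)) refl isZeta
      where
      convert : ∀ m → Σ< m (λ k → (ι (suc k) ^ 2) ⁻¹) ≈ inverseSquares m
      convert zero    = Σ<-empty (λ k → (ι (suc k) ^ 2) ⁻¹)
      convert (suc m) = trans (Σ<-snoc m (λ k → (ι (suc k) ^ 2) ⁻¹)) (trans (+-comm _ _) (+-congˡ (convert m)))

    inverseSquares≤ζ : ∀ m → inverseSquares m ≤ ζ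
    inverseSquares≤ζ m = limit-≥ m (λ j m≤j → inverseSquares-mono m≤j) partialSums⟶ζ

    ζ≤inverseSquares : ∀ m → 0 ℕ.< m → ζ ≤ inverseSquares m + (ι m) ⁻¹
    ζ≤inverseSquares m 0<m = limit-≤ m (λ j m≤j → inverseSquares-upper 0<m m≤j) partialSums⟶ζ

    inverseSquares-1 : inverseSquares 1 ≈ 1#
    inverseSquares-1 = trans (+-identityʳ _) (trans (inverse-square (0<ι-suc 0)) (trans (*-cong ι1⁻¹≈1 ι1⁻¹≈1) (*-identityˡ 1#)))

    1≤ζ : 1# ≤ ζ
    1≤ζ = ≤-trans (≤-reflexive (sym inverseSquares-1)) (inverseSquares≤ζ 1)

    ζ≤2 : ζ ≤ ι 2
    ζ≤2 = ≤-trans (ζ≤inverseSquares 1 ℕ.z<s) (+-mono-≤ (≤-reflexive inverseSquares-1)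
      (≤-reflexive (trans ι1⁻¹≈1 (sym ι-1))))

  module _ (n : ℕ) where

    multiplesSum : (ℕ → Carrier) → ℕ → Carrier
    multiplesSum f d = ΣL (range n) (λ k → 𝟙 (d ∣? k) * f k)

    -- Coprimality is the indicator of gcd p q = 1, which `möbius-inversion` expands over the
    -- divisors d of the gcd. As d divides the gcd exactly when it divides p and q, the double sum
    -- for each d is a product of two equal sums.
    coprimeSum-expand : coprimeSum n ≈ ΣL (terms n) (λ (s , d) → s * (multiplesSum ι d * multiplesSum ι d))
    coprimeSum-expand = begin-equality
      ΣL (range n) (λ p → ΣL (range n) (λ q → 𝟙 (coprime? p q) * (ι p * ι q)))
        ≈⟨ ΣL-cong (range n) (λ {p} p∈ → ΣL-cong (range n) (λ {q} q∈ → expand (∈-range⁻ n p∈) q)) ⟩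
      ΣL (range n) (λ p → ΣL (range n) (λ q → ΣL (terms n) (summand p q)))
        ≈⟨ ΣL-cong (range n) (λ {p} _ → ΣL-swap (range n) (terms n) (summand p)) ⟩
      ΣL (range n) (λ p → ΣL (terms n) (λ t → ΣL (range n) (λ q → summand p q t)))
        ≈⟨ ΣL-swap (range n) (terms n) (λ p t → ΣL (range n) (λ q → summand p q t)) ⟩
      ΣL (terms n) (λ t → ΣL (range n) (λ p → ΣL (range n) (λ q → summand p q t)))
        ≈⟨ ΣL-cong (terms n) (λ {t} _ → collect t) ⟩
      ΣL (terms n) (λ (s , d) → s * (multiplesSum ι d * multiplesSum ι d))
        ∎
      where
      summand : ℕ → ℕ → Carrier × ℕ → Carrier
      summand p q (s , d) = s * ((𝟙 (d ∣? p) * ι p) * (𝟙 (d ∣? q) * ι q))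
      expand : ∀ {p} → 0 ℕ.< p × p ℕ.≤ n → ∀ q → 𝟙 (coprime? p q) * (ι p * ι q) ≈ ΣL (terms n) (summand p q)
      expand {p} (0<p , p≤n) q = begin-equality
        𝟙 (coprime? p q) * (ι p * ι q)
          ≈⟨ *-congʳ (𝟙-cong (coprime? p q) (gcd p q ℕ.≟ 1) coprime⇒gcd≡1 gcd≡1⇒coprime) ⟩
        𝟙 (gcd p q ℕ.≟ 1) * (ι p * ι q)
          ≈⟨ *-congʳ (möbius-inversion n 0<gcd (ℕ.≤-trans (∣⇒≤ {{ℕ.>-nonZero 0<p}} (gcd[m,n]∣m p q)) p≤n)) ⟨
        signedDivisorSum (terms n) (gcd p q) * (ι p * ι q)
          ≈⟨ ΣL-*ʳ (terms n) (ι p * ι q) (λ (s , d) → s * 𝟙 (d ∣? gcd p q)) ⟨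
        ΣL (terms n) (λ (s , d) → s * 𝟙 (d ∣? gcd p q) * (ι p * ι q))
          ≈⟨ ΣL-cong (terms n) (λ {(s , d)} _ → trans (*-congʳ (*-congˡ (divides-gcd d)))
               (solve 5 (λ s i j p q → s :* (i :* j) :* (p :* q) := s :* ((i :* p) :* (j :* q))) refl s _ _ (ι p) (ι q))) ⟩
        ΣL (terms n) (summand p q)
          ∎
        where
        0<gcd : 0 ℕ.< gcd p q
        0<gcd = ℕ.n≢0⇒n>0 λ gcd≡0 → ℕ.<-irrefl (≡.sym (0∣⇒≡0 (≡.subst (_∣ p) gcd≡0 (gcd[m,n]∣m p q)))) 0<p
        divides-gcd : ∀ d → 𝟙 (d ∣? gcd p q) ≈ 𝟙 (d ∣? p) * 𝟙 (d ∣? q)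
        divides-gcd d = trans
          (𝟙-cong (d ∣? gcd p q) (d ∣? p ×-dec d ∣? q)
            (λ d∣g → ∣-trans d∣g (gcd[m,n]∣m p q) , ∣-trans d∣g (gcd[m,n]∣n p q)) (λ (d∣p , d∣q) → gcd-greatest d∣p d∣q))
          (𝟙-× (d ∣? p) (d ∣? q))
      collect : ∀ t → ΣL (range n) (λ p → ΣL (range n) (λ q → summand p q t)) ≈ proj₁ t * (multiplesSum ι (proj₂ t) * multiplesSum ι (proj₂ t))
      collect (s , d) = begin-equality
        ΣL (range n) (λ p → ΣL (range n) (λ q → summand p q (s , d)))
          ≈⟨ ΣL-cong (range n) (λ _ → ΣL-*ˡ (range n) s _) ⟩
        ΣL (range n) (λ p → s * ΣL (range n) (λ q → (𝟙 (d ∣? p) * ι p) * (𝟙 (d ∣? q) * ι q)))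
          ≈⟨ ΣL-*ˡ (range n) s _ ⟩
        s * ΣL (range n) (λ p → ΣL (range n) (λ q → (𝟙 (d ∣? p) * ι p) * (𝟙 (d ∣? q) * ι q)))
          ≈⟨ *-congˡ (ΣL-*-ΣL (range n) (range n) (λ k → 𝟙 (d ∣? k) * ι k) (λ k → 𝟙 (d ∣? k) * ι k)) ⟩
        s * (multiplesSum ι d * multiplesSum ι d)
          ∎

    -- Among the terms k⁻² with k ≤ n the indicator of k = 1 selects the value 1; expanding that
    -- indicator and exchanging the sums gives the right side.
    one-expand : 0 ℕ.< n → 1# ≈ ΣL (terms n) (λ (s , d) → s * multiplesSum inverseSquare d)
    one-expand 0<n = begin-equality
      1#
        ≈⟨ trans (inverse-square (0<ι-suc 0)) (trans (*-cong ι1⁻¹≈1 ι1⁻¹≈1) (*-identityˡ 1#)) ⟨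
      inverseSquare 1
        ≈⟨ ΣL-range-≟1 n 0<n ⟨
      ΣL (range n) (λ k → 𝟙 (k ℕ.≟ 1) * inverseSquare k)
        ≈⟨ ΣL-cong (range n) (λ {k} k∈ → *-congʳ (möbius-inversion n (proj₁ (∈-range⁻ n k∈)) (proj₂ (∈-range⁻ n k∈)))) ⟨
      ΣL (range n) (λ k → signedDivisorSum (terms n) k * inverseSquare k)
        ≈⟨ ΣL-cong (range n) (λ {k} _ → trans (sym (ΣL-*ʳ (terms n) (inverseSquare k) (λ (s , d) → s * 𝟙 (d ∣? k))))
             (ΣL-cong (terms n) (λ _ → *-assoc _ _ _))) ⟩
      ΣL (range n) (λ k → ΣL (terms n) (λ (s , d) → s * (𝟙 (d ∣? k) * inverseSquare k)))
        ≈⟨ ΣL-swap (range n) (terms n) (λ k (s , d) → s * (𝟙 (d ∣? k) * inverseSquare k)) ⟩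
      ΣL (terms n) (λ (s , d) → ΣL (range n) (λ k → s * (𝟙 (d ∣? k) * inverseSquare k)))
        ≈⟨ ΣL-cong (terms n) (λ {(s , d)} _ → ΣL-*ˡ (range n) s _) ⟩
      ΣL (terms n) (λ (s , d) → s * multiplesSum inverseSquare d)
        ∎
      where
      ΣL-range-≟1 : ∀ n → 0 ℕ.< n → ΣL (range n) (λ k → 𝟙 (k ℕ.≟ 1) * inverseSquare k) ≈ inverseSquare 1
      ΣL-range-≟1 1      _ = trans (+-identityʳ _) (trans (*-congʳ (𝟙-yes (1 ℕ.≟ 1) ≡.refl)) (*-identityˡ _))
      ΣL-range-≟1 (2+ n) _ = trans (+-cong (trans (*-congʳ (𝟙-no (2+ n ℕ.≟ 1) λ ())) (zeroˡ _)) (ΣL-range-≟1 (suc n) ℕ.z<s)) (+-identityˡ _)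

  module _ (n : ℕ) (ζ : Carrier) (isZeta : IsZeta2 ζ) where
    private
      N = ι n
      0≤N = 0≤ι n

    divisor-error : ℕ → Carrier
    divisor-error d = ζ * (ι 2 * multiplesSum n ι d) ^ 2 - N ^ 4 * multiplesSum n inverseSquare d

    0≤ζ : 0# ≤ ζ
    0≤ζ = ≤-trans 0≤1 (1≤ζ ζ isZeta)

    -- With m = ⌊n/d⌋ and x = n/d the error is d² times the quantity in `floor-error`, and d² · 24
    -- x³ = 24 n³/d. For d > n one has m = 0, both sums are empty, and the indicator on the right
    -- vanishes too.
    divisor-error-bound : ∀ d → 0 ℕ.< d → ∣ divisor-error d ∣ ≤ 𝟙 (d ℕ.≤? n) * (ι 24 * N ^ 3 * (ι d) ⁻¹)
    divisor-error-bound d 0<d with ΣL-multiples d n 0<d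
    ... | m , r , n≡ , r<d , sums = cases m n≡
            (trans (*-congˡ (sums ι)) (twice-triangular d m))
            (trans (sums inverseSquare) (inverseSquares-scale d m 0<d))
      where
      D u : Carrier
      D = ι d
      u = (ι d) ⁻¹
      Du≈1 : D * u ≈ 1#
      Du≈1 = ⁻¹-inverseʳ (pos⇒≉0 (0<ι 0<d))
      0≤u : 0# ≤ u
      0≤u = ⁻¹-nonneg (0<ι 0<d)
      cases : ∀ m → n ≡ d ℕ.* m ℕ.+ r → ι 2 * multiplesSum n ι d ≈ D * (ι m * (ι m + ι 1)) →
              multiplesSum n inverseSquare d ≈ u * u * inverseSquares m → ∣ divisor-error d ∣ ≤ 𝟙 (d ℕ.≤? n) * (ι 24 * N ^ 3 * u)
      cases zero n≡ 2A≈ B≈ = ≤-reflexive (begin-equality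
        ∣ divisor-error d ∣  ≈⟨ ∣∣-cong (+-cong (*-congˡ (^-congˡ 2 2A≈)) (-‿cong (*-congˡ B≈))) ⟩
        ∣ ζ * (D * (0# * (0# + ι 1))) ^ 2 - N ^ 4 * (u * u * 0#) ∣
                                                         ≈⟨ ∣∣-cong (solve 4 (λ z d n4 u → z :* (d :* (con (+ 0) :* (con (+ 0) :+ con (+ 1)))) :^ 2 :- n4 :* (u :* u :* con (+ 0)) := con (+ 0)) refl ζ D (N ^ 4) u) ⟩
        ∣ 0# ∣  ≈⟨ nonneg⇒∣x∣≈x ≤-refl ⟩
        0#  ≈⟨ zeroˡ _ ⟨
        0# * (ι 24 * N ^ 3 * u)  ≈⟨ *-congʳ (𝟙-no (d ℕ.≤? n) (ℕ.<⇒≱ (ℕ.≤-trans (ℕ.s≤s (ℕ.≤-reflexive n≡r)) r<d))) ⟨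
        𝟙 (d ℕ.≤? n) * (ι 24 * N ^ 3 * u)  ∎)
        where
        n≡r : n ≡ r
        n≡r = ≡.trans n≡ (≡.cong (ℕ._+ r) (ℕ.*-zeroʳ d))
      cases m@(suc _) n≡ 2A≈ B≈ = begin
        ∣ divisor-error d ∣
          ≈⟨ ∣∣-cong (+-cong (*-congˡ (^-congˡ 2 2A≈)) (-‿cong (*-cong (^-congˡ 4 N≈Dx) B≈))) ⟩
        ∣ ζ * (D * (ι m * (ι m + ι 1))) ^ 2 - (D * x) ^ 4 * (u * u * Z) ∣
          ≈⟨ ∣∣-cong (solve 6 (λ z d m x u Z → z :* (d :* (m :* (m :+ con (+ 1)))) :^ 2 :- (d :* x) :^ 4 :* (u :* u :* Z)
                       := d :^ 2 :* (z :* (m :* (m :+ con (+ 1))) :^ 2 :- (d :* u) :^ 2 :* (x :^ 4 :* Z))) refl ζ D (ι m) x u Z) ⟩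
        ∣ D ^ 2 * (ζ * (ι m * (ι m + ι 1)) ^ 2 - (D * u) ^ 2 * (x ^ 4 * Z)) ∣
          ≈⟨ ∣∣-cong (*-congˡ (+-congˡ (-‿cong (trans (*-congʳ [Du]²≈1) (*-identityˡ _))))) ⟩
        ∣ D ^ 2 * (ζ * (ι m * (ι m + ι 1)) ^ 2 - x ^ 4 * Z) ∣
          ≈⟨ trans (∣∣-* _ _) (*-congʳ (nonneg⇒∣x∣≈x 0≤D²)) ⟩
        D ^ 2 * ∣ ζ * (ι m * (ι m + ι 1)) ^ 2 - x ^ 4 * Z ∣
          ≤⟨ *-monoˡ-≤ (D ^ 2) 0≤D² (floor-error ζ (ι m) x Z (ι-mono-≤ {1} {m} (ℕ.s≤s ℕ.z≤n)) M≤x x≤M+1 0≤ζ (ζ≤2 ζ isZeta) (inverseSquares≤ζ ζ isZeta m) (ζ≤inverseSquares ζ isZeta m ℕ.z<s)) ⟩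
        D ^ 2 * (ι 24 * x ^ 3)
          ≈⟨ solve 3 (λ d n u → d :^ 2 :* (con (+ 24) :* (n :* u) :^ 3) := (d :* u) :^ 2 :* (con (+ 24) :* n :^ 3 :* u)) refl D N u ⟩
        (D * u) ^ 2 * (ι 24 * N ^ 3 * u)
          ≈⟨ *-congʳ [Du]²≈1 ⟩
        1# * (ι 24 * N ^ 3 * u)
          ≈⟨ *-congʳ (𝟙-yes (d ℕ.≤? n) (ℕ.≤-trans (ℕ.m≤m*n d m) dm≤n)) ⟨
        𝟙 (d ℕ.≤? n) * (ι 24 * N ^ 3 * u)
          ∎
        where
        x Z : Carrier
        x = N * u
        Z = inverseSquares m
        0≤D² : 0# ≤ D ^ 2
        0≤D² = ^-nonneg 2 (0≤ι d)
        [Du]²≈1 : (D * u) ^ 2 ≈ 1#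
        [Du]²≈1 = trans (*-cong Du≈1 (trans (*-identityʳ _) Du≈1)) (*-identityˡ 1#)
        N≈Dx : N ≈ D * x
        N≈Dx = sym (trans (solve 3 (λ d n u → d :* (n :* u) := n :* (d :* u)) refl D N u) (trans (*-congˡ Du≈1) (*-identityʳ N)))
        dm≤n : d ℕ.* m ℕ.≤ n
        dm≤n = ℕ.≤-trans (ℕ.m≤m+n (d ℕ.* m) r) (ℕ.≤-reflexive (≡.sym n≡))
        M≤x : ι m ≤ x
        M≤x = *-cancelˡ-≤ D (0<ι 0<d) (begin
          D * ι m  ≈⟨ ι-* d m ⟨
          ι (d ℕ.* m)  ≤⟨ ι-mono-≤ dm≤n ⟩
          N  ≈⟨ N≈Dx ⟩
          D * x  ∎)
        x≤M+1 : x ≤ ι m + ι 1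
        x≤M+1 = *-cancelˡ-≤ D (0<ι 0<d) (begin
          D * x  ≈⟨ N≈Dx ⟨
          N  ≤⟨ ι-mono-≤ (ℕ.≤-trans (ℕ.≤-reflexive n≡) (ℕ.+-monoʳ-≤ (d ℕ.* m) (ℕ.<⇒≤ r<d))) ⟩
          ι (d ℕ.* m ℕ.+ d)  ≈⟨ trans (ι-+ (d ℕ.* m) d) (+-congʳ (ι-* d m)) ⟩
          D * ι m + D  ≈⟨ +-congˡ (trans (*-congˡ ι-1) (*-identityʳ D)) ⟨
          D * ι m + D * ι 1  ≈⟨ distribˡ D (ι m) (ι 1) ⟨
          D * (ι m + ι 1)  ∎)

    coprimeSum-asymptotic : 0 ℕ.< n → ∣ ι 4 * ζ * coprimeSum n - N ^ 4 ∣ ≤ ι 24 * N ^ 3 * harmonic n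
    coprimeSum-asymptotic 0<n = begin
      ∣ ι 4 * ζ * coprimeSum n - N ^ 4 ∣
        ≈⟨ ∣∣-cong (+-cong (*-congˡ (coprimeSum-expand n)) (-‿cong (trans (sym (*-identityʳ _)) (*-congˡ (one-expand n 0<n))))) ⟩
      ∣ ι 4 * ζ * ΣL (terms n) (λ (s , d) → s * (A d * A d)) - N ^ 4 * ΣL (terms n) (λ (s , d) → s * B d) ∣
        ≈⟨ ∣∣-cong (+-cong (ΣL-*ˡ (terms n) _ _) (-‿cong (ΣL-*ˡ (terms n) _ _))) ⟨
      ∣ ΣL (terms n) (λ (s , d) → ι 4 * ζ * (s * (A d * A d))) - ΣL (terms n) (λ (s , d) → N ^ 4 * (s * B d)) ∣
        ≈⟨ ∣∣-cong (ΣL-minus (terms n) _ _) ⟨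
      ∣ ΣL (terms n) (λ (s , d) → ι 4 * ζ * (s * (A d * A d)) - N ^ 4 * (s * B d)) ∣
        ≈⟨ ∣∣-cong (ΣL-cong (terms n) (λ {(s , d)} _ → solve 5 (λ z s a n4 b → con (+ 4) :* z :* (s :* (a :* a)) :- n4 :* (s :* b)
                                                          := s :* (z :* (con (+ 2) :* a) :^ 2 :- n4 :* b)) refl ζ s (A d) (N ^ 4) (B d))) ⟩
      ∣ ΣL (terms n) (λ (s , d) → s * divisor-error d) ∣
        ≤⟨ ∣ΣL∣≤ (terms n) _ ⟩
      ΣL (terms n) (λ (s , d) → ∣ s * divisor-error d ∣)
        ≤⟨ ΣL-mono (terms n) (λ {(s , d)} t∈ → bound s d t∈) ⟩
      ΣL (terms n) (λ (s , d) → ι 24 * N ^ 3 * (𝟙 (d ℕ.≤? n) * (ι d) ⁻¹))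
        ≈⟨ ΣL-*ˡ (terms n) (ι 24 * N ^ 3) _ ⟩
      ι 24 * N ^ 3 * ΣL (terms n) (λ (s , d) → 𝟙 (d ℕ.≤? n) * (ι d) ⁻¹)
        ≈⟨ *-congˡ (reflexive (ΣL-map proj₂ (terms n) (λ d → 𝟙 (d ℕ.≤? n) * (ι d) ⁻¹))) ⟨
      ι 24 * N ^ 3 * ΣL (map proj₂ (terms n)) (λ d → 𝟙 (d ℕ.≤? n) * (ι d) ⁻¹)
        ≤⟨ *-monoˡ-≤ _ (*-nonneg (0≤ι 24) (^-nonneg 3 0≤N)) (ΣL-unique≤ΣL-range {λ d → (ι d) ⁻¹} (map proj₂ (terms n)) n (λ 0<d → ⁻¹-nonneg (0<ι 0<d))
             (λ d∈ → let t , t∈ , d≡ = ∈-map⁻ proj₂ d∈ in ≡.subst (0 ℕ.<_) (≡.sym d≡) (positive n t∈)) (unique n)) ⟩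
      ι 24 * N ^ 3 * harmonic n
        ∎
      where
      A B : ℕ → Carrier
      A = multiplesSum n ι
      B = multiplesSum n inverseSquare
      bound : ∀ s d → (s , d) ∈ terms n → ∣ s * divisor-error d ∣ ≤ ι 24 * N ^ 3 * (𝟙 (d ℕ.≤? n) * (ι d) ⁻¹)
      bound s d t∈ = begin
        ∣ s * divisor-error d ∣  ≈⟨ ∣∣-* s _ ⟩
        ∣ s ∣ * ∣ divisor-error d ∣  ≤⟨ *-monoʳ-≤ _ (∣∣-nonneg _) (sign≤1 n t∈) ⟩
        1# * ∣ divisor-error d ∣  ≈⟨ *-identityˡ _ ⟩
        ∣ divisor-error d ∣  ≤⟨ divisor-error-bound d (positive n t∈) ⟩
        𝟙 (d ℕ.≤? n) * (ι 24 * N ^ 3 * (ι d) ⁻¹)  ≈⟨ solve 3 (λ i k u → i :* (k :* u) := k :* (i :* u)) refl (𝟙 (d ℕ.≤? n)) (ι 24 * N ^ 3) ((ι d) ⁻¹) ⟩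
        ι 24 * N ^ 3 * (𝟙 (d ℕ.≤? n) * (ι d) ⁻¹)  ∎

  -- Enumeration of the roots

  module RootEnumeration
    (π a b : Carrier) (isPi : IsPi π) (0≤a : 0# ≤ a) (a≤b : a ≤ b) (b≤1 : b ≤ 1#) where

    -- (p , q , k) encodes the root e^(2πik/(pq)) for the knot T_{p,q}. Such triples can be listed
    -- and compared by ≡.
    Code : Set
    Code = ℕ × ℕ × ℕ

    Valid : Code → Set (ℓ₁ ⊔ ℓ₂)
    Valid (p , q , k) = k ℕ.< p ℕ.* q × Coprime p q × (p ∤ k × q ∤ k) × (a * ι (p ℕ.* q) ≤ ι k × ι k ≤ b * ι (p ℕ.* q))

    valid? : Decidable Valid
    valid? (p , q , k) = (k ℕ.<? p ℕ.* q) ×-dec (coprime? p q ×-dec admissible? a b 0≤a a≤b b≤1 p q k)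

    -- The common bound n² ≥ pq on k makes this a product of three lists; the condition k < pq is
    -- restored by `Valid`.
    box : ℕ → List Code
    box n = cartesianProduct (range n) (cartesianProduct (range n) (downFrom (n ℕ.* n)))

    codes : ℕ → List Code
    codes n = filter valid? (box n)

    codes-unique : ∀ n → Unique (codes n)
    codes-unique n = Unique.filter⁺ valid? (Unique.cartesianProduct⁺ (range-unique n) (Unique.cartesianProduct⁺ (range-unique n) (Unique.downFrom⁺ (n ℕ.* n))))
      where
      range-unique : ∀ n → Unique (range n)
      range-unique n = Unique.map⁺ ℕ.suc-injective (Unique.downFrom⁺ n)

    length-codes : ∀ n → ι (length (codes n)) ≈ ΣL (range n) (λ p → ΣL (range n) (λ q → 𝟙 (coprime? p q) * rootCount a b 0≤a a≤b b≤1 p q))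
    length-codes n = trans (length-filter valid? (box n)) (trans (ΣL-product (range n) (cartesianProduct (range n) (downFrom (n ℕ.* n))) (λ x → 𝟙 (valid? x)))
      (ΣL-cong (range n) (λ {p} p∈ → trans (ΣL-product (range n) (downFrom (n ℕ.* n)) (λ (q , k) → 𝟙 (valid? (p , q , k))))
        (ΣL-cong (range n) (λ {q} q∈ → inner (proj₂ (∈-range⁻ n p∈)) (proj₂ (∈-range⁻ n q∈)))))))
      where
      inner : ∀ {p q} → p ℕ.≤ n → q ℕ.≤ n → ΣL (downFrom (n ℕ.* n)) (λ k → 𝟙 (valid? (p , q , k))) ≈ 𝟙 (coprime? p q) * rootCount a b 0≤a a≤b b≤1 p q
      inner {p} {q} p≤n q≤n = begin-equality
        ΣL (downFrom (n ℕ.* n)) (λ k → 𝟙 (valid? (p , q , k)))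
          ≈⟨ ΣL-cong (downFrom (n ℕ.* n)) (λ {k} _ → trans (𝟙-× (k ℕ.<? p ℕ.* q) (coprime? p q ×-dec adm? k)) (*-congˡ (𝟙-× (coprime? p q) (adm? k)))) ⟩
        ΣL (downFrom (n ℕ.* n)) (λ k → 𝟙 (k ℕ.<? p ℕ.* q) * (𝟙 (coprime? p q) * 𝟙 (adm? k)))
          ≈⟨ ΣL-truncate (λ k → 𝟙 (coprime? p q) * 𝟙 (adm? k)) (ℕ.*-mono-≤ p≤n q≤n) ⟩
        ΣL (downFrom (p ℕ.* q)) (λ k → 𝟙 (coprime? p q) * 𝟙 (adm? k))
          ≈⟨ ΣL-*ˡ (downFrom (p ℕ.* q)) (𝟙 (coprime? p q)) (λ k → 𝟙 (adm? k)) ⟩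
        𝟙 (coprime? p q) * rootCount a b 0≤a a≤b b≤1 p q
          ∎
        where
        adm? : ∀ k → Dec ((p ∤ k × q ∤ k) × (a * ι (p ℕ.* q) ≤ ι k × ι k ≤ b * ι (p ℕ.* q)))
        adm? = admissible? a b 0≤a a≤b b≤1 p q

    length-codes-bound : ∀ n → 0 ℕ.< n → ∣ ι (length (codes n)) - (b - a) * coprimeSum n ∣ ≤ ι 5 * ι n ^ 3
    length-codes-bound n 0<n = begin
      ∣ ι (length (codes n)) - (b - a) * coprimeSum n ∣
        ≈⟨ ∣∣-cong (+-cong (length-codes n) (-‿cong (trans (sym (ΣL-*ˡ (range n) (b - a) _)) (ΣL-cong (range n) (λ {p} _ → sym (ΣL-*ˡ (range n) (b - a) (λ q → 𝟙 (coprime? p q) * (ι p * ι q)))))))) ⟩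
      ∣ ΣL (range n) (λ p → ΣL (range n) (λ q → 𝟙 (coprime? p q) * rc p q)) - ΣL (range n) (λ p → ΣL (range n) (λ q → (b - a) * (𝟙 (coprime? p q) * (ι p * ι q)))) ∣
        ≈⟨ ∣∣-cong (ΣL-minus (range n) _ _) ⟨
      ∣ ΣL (range n) (λ p → ΣL (range n) (λ q → 𝟙 (coprime? p q) * rc p q) - ΣL (range n) (λ q → (b - a) * (𝟙 (coprime? p q) * (ι p * ι q)))) ∣
        ≤⟨ ∣ΣL∣≤ (range n) _ ⟩
      ΣL (range n) (λ p → ∣ ΣL (range n) (λ q → 𝟙 (coprime? p q) * rc p q) - ΣL (range n) (λ q → (b - a) * (𝟙 (coprime? p q) * (ι p * ι q))) ∣)
        ≤⟨ ΣL-mono (range n) (λ {p} p∈ → row p (∈-range⁻ n p∈)) ⟩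
      ΣL (range n) (λ _ → ι n * (ι n + ι n + ι 3))
        ≈⟨ ΣL-range-const n _ ⟩
      ι n * (ι n * (ι n + ι n + ι 3))
        -- Each of the n² pairs contributes at most 2n + 3, and 3n² ≤ 3n³ since n ≥ 1.
        ≤⟨ ≤-by (ι 3 * ι n ^ 2 * (ι n - ι 1)) (*-nonneg (*-nonneg (0≤ι 3) (^-nonneg 2 (0≤ι n))) (x≤y⇒0≤y-x (ι-mono-≤ 0<n)))
             (solve 1 (λ n → con (+ 5) :* n :^ 3 := n :* (n :* (n :+ n :+ con (+ 3))) :+ con (+ 3) :* n :^ 2 :* (n :- con (+ 1))) refl (ι n)) ⟩
      ι 5 * ι n ^ 3
        ∎
      where
      rc : ℕ → ℕ → Carrier
      rc = rootCount a b 0≤a a≤b b≤1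
      entry : ∀ p q → 0 ℕ.< p × p ℕ.≤ n → 0 ℕ.< q × q ℕ.≤ n → ∣ 𝟙 (coprime? p q) * rc p q - (b - a) * (𝟙 (coprime? p q) * (ι p * ι q)) ∣ ≤ ι n + ι n + ι 3
      entry p q (0<p , p≤n) (0<q , q≤n) = begin
        ∣ 𝟙 (coprime? p q) * rc p q - (b - a) * (𝟙 (coprime? p q) * (ι p * ι q)) ∣
          ≈⟨ ∣∣-cong (solve 4 (λ i r d m → i :* r :- d :* (i :* m) := i :* (r :- d :* m)) refl (𝟙 (coprime? p q)) (rc p q) (b - a) (ι p * ι q)) ⟩
        ∣ 𝟙 (coprime? p q) * (rc p q - (b - a) * (ι p * ι q)) ∣
          ≈⟨ trans (∣∣-* _ _) (*-congʳ (nonneg⇒∣x∣≈x (𝟙-nonneg (coprime? p q)))) ⟩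
        𝟙 (coprime? p q) * ∣ rc p q - (b - a) * (ι p * ι q) ∣
          ≤⟨ *-monoʳ-≤ _ (∣∣-nonneg _) (𝟙≤1 (coprime? p q)) ⟩
        1# * ∣ rc p q - (b - a) * (ι p * ι q) ∣
          ≈⟨ *-identityˡ _ ⟩
        ∣ rc p q - (b - a) * (ι p * ι q) ∣
          ≤⟨ rootCount-bound a b 0≤a a≤b b≤1 p q 0<p 0<q ⟩
        ι p + ι q + ι 3
          ≤⟨ +-monoˡ-≤ (ι 3) (+-mono-≤ (ι-mono-≤ p≤n) (ι-mono-≤ q≤n)) ⟩
        ι n + ι n + ι 3
          ∎
      row : ∀ p → 0 ℕ.< p × p ℕ.≤ n → ∣ ΣL (range n) (λ q → 𝟙 (coprime? p q) * rc p q) - ΣL (range n) (λ q → (b - a) * (𝟙 (coprime? p q) * (ι p * ι q))) ∣ ≤ ι n * (ι n + ι n + ι 3)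
      row p p-bounds = begin
        ∣ ΣL (range n) (λ q → 𝟙 (coprime? p q) * rc p q) - ΣL (range n) (λ q → (b - a) * (𝟙 (coprime? p q) * (ι p * ι q))) ∣
          ≈⟨ ∣∣-cong (ΣL-minus (range n) _ _) ⟨
        ∣ ΣL (range n) (λ q → 𝟙 (coprime? p q) * rc p q - (b - a) * (𝟙 (coprime? p q) * (ι p * ι q))) ∣
          ≤⟨ ∣ΣL∣≤ (range n) _ ⟩
        ΣL (range n) (λ q → ∣ 𝟙 (coprime? p q) * rc p q - (b - a) * (𝟙 (coprime? p q) * (ι p * ι q)) ∣)
          ≤⟨ ΣL-mono (range n) (λ {q} q∈ → entry p q p-bounds (∈-range⁻ n q∈)) ⟩
        ΣL (range n) (λ _ → ι n + ι n + ι 3)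
          ≈⟨ ΣL-range-const n _ ⟩
        ι n * (ι n + ι n + ι 3)
          ∎

    module _ (X : Carrier) (n : ℕ) (n≤X : ι n ≤ X) (X<1+n : X < ι (suc n)) where
      private
        S : Setoid _ _
        S = Ω₁-between π X a b

        Element : Set _
        Element = Setoid.Carrier S

      module Decode {p q k : ℕ} (0<p : 0 ℕ.< p) (p≤n : p ℕ.≤ n) (0<q : 0 ℕ.< q) (q≤n : q ℕ.≤ n) (valid : Valid (p , q , k)) where
        0<pq : 0# < ι (p ℕ.* q)
        0<pq = 0<ι (ℕ.*-mono-< {0} {p} {0} 0<p 0<q)

        k<pq : k ℕ.< p ℕ.* q
        k<pq = proj₁ valid

        θ : Carrier
        θ = ι k * (ι (p ℕ.* q)) ⁻¹

        θpq≈k : θ * ι (p ℕ.* q) ≈ ι k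
        θpq≈k = trans (*-assoc _ _ _) (trans (*-congˡ (⁻¹-inverseˡ (pos⇒≉0 0<pq))) (*-identityʳ _))

        α : ℂ
        α = proj₁ (cis-exists (ι 2 * π * θ))

        θ<1 : θ < 1#
        θ<1 = ≰⇒> λ 1≤θ → <⇒≱ (ι-mono-< k<pq) (begin
          ι (p ℕ.* q)  ≈⟨ *-identityˡ _ ⟨
          1# * ι (p ℕ.* q)  ≤⟨ *-monoʳ-≤ _ (<⇒≤ 0<pq) 1≤θ ⟩
          θ * ι (p ℕ.* q)  ≈⟨ θpq≈k ⟩
          ι k  ∎)

        isTheta : IsTheta π α θ
        isTheta = *-nonneg (0≤ι k) (⁻¹-nonneg 0<pq) , θ<1 , proj₂ (cis-exists (ι 2 * π * θ))

        -- If α^d = 1, then θ d is an integer j, and k = θ p q = θ d e = j e is a multiple of e.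
        not-power : ∀ d e → p ℕ.* q ≡ d ℕ.* e → e ∤ k → ¬ α ^ℂ d ≈ℂ 1ℂ
        not-power d e pq≡de e∤k αᵈ≈1 =
          let j , θd≈j = power≈1⇒integer π isPi isTheta d αᵈ≈1 in
          e∤k (divides j (ι-injective (begin-equality
            ι k  ≈⟨ θpq≈k ⟨
            θ * ι (p ℕ.* q)  ≈⟨ *-congˡ (trans (reflexive (≡.cong ι pq≡de)) (ι-* d e)) ⟩
            θ * (ι d * ι e)  ≈⟨ *-assoc _ _ _ ⟨
            θ * ι d * ι e  ≈⟨ *-congʳ θd≈j ⟩
            ι j * ι e  ≈⟨ ι-* j e ⟨
            ι (j ℕ.* e)  ∎)))

        element : Element
        element = record
          { p       = p
          ; q       = q
          ; p>0     = 0<p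
          ; q>0     = 0<q
          ; coprime = proj₁ (proj₂ valid)
          ; height≤ = ≤-trans (ι-mono-≤ (ℕ.⊔-lub p≤n q≤n)) n≤X
          ; α       = α
          ; isRoot  = ⇒alexanderRoot p q α (proj₁ (proj₂ valid)) (integer⇒power≈1 π isPi isTheta (p ℕ.* q) k θpq≈k)
                        (not-power p q ≡.refl (proj₂ (proj₁ (proj₂ (proj₂ valid)))))
                        (not-power q p (ℕ.*-comm p q) (proj₁ (proj₁ (proj₂ (proj₂ valid)))))
          } , θ , isTheta , a≤θ , θ≤b
          where
          cancel : ∀ {x y} → x * ι (p ℕ.* q) ≤ y * ι (p ℕ.* q) → x ≤ y
          cancel {x} {y} le = *-cancelˡ-≤ (ι (p ℕ.* q)) 0<pq (≤-trans (≤-reflexive (*-comm _ x)) (≤-trans le (≤-reflexive (*-comm y _))))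
          a≤θ : a ≤ θ
          a≤θ = cancel (≤-trans (proj₁ (proj₂ (proj₂ (proj₂ valid)))) (≤-reflexive (sym θpq≈k)))
          θ≤b : θ ≤ b
          θ≤b = cancel (≤-trans (≤-reflexive θpq≈k) (proj₂ (proj₂ (proj₂ (proj₂ valid)))))

      module Encode (y : Element) where
        open Ω₁ (proj₁ y) public

        θ : Carrier
        θ = proj₁ (proj₂ y)

        isTheta : IsTheta π α θ
        isTheta = proj₁ (proj₂ (proj₂ y))

        a≤θ : a ≤ θ
        a≤θ = proj₁ (proj₂ (proj₂ (proj₂ y)))

        θ≤b : θ ≤ b
        θ≤b = proj₂ (proj₂ (proj₂ (proj₂ y)))

        powers : α ^ℂ (p ℕ.* q) ≈ℂ 1ℂ × (¬ α ^ℂ p ≈ℂ 1ℂ) × (¬ α ^ℂ q ≈ℂ 1ℂ)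
        powers = alexanderRoot⇒ p q α p>0 q>0 isRoot

        k : ℕ
        k = proj₁ (power≈1⇒integer π isPi isTheta (p ℕ.* q) (proj₁ powers))

        θpq≈k : θ * ι (p ℕ.* q) ≈ ι k
        θpq≈k = proj₂ (power≈1⇒integer π isPi isTheta (p ℕ.* q) (proj₁ powers))

        0<pq : 0# < ι (p ℕ.* q)
        0<pq = 0<ι (ℕ.*-mono-< {0} {p} {0} p>0 q>0)

        not-divides : ∀ d e → 0 ℕ.< e → p ℕ.* q ≡ d ℕ.* e → ¬ α ^ℂ d ≈ℂ 1ℂ → e ∤ k
        not-divides d e 0<e pq≡de αᵈ≉1 (divides j k≡je) = αᵈ≉1 (integer⇒power≈1 π isPi isTheta d j
          (*-cancelˡ (pos⇒≉0 (0<ι 0<e)) (begin-equality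
            ι e * (θ * ι d)  ≈⟨ solve 3 (λ e t d → e :* (t :* d) := t :* (d :* e)) refl (ι e) θ (ι d) ⟩
            θ * (ι d * ι e)  ≈⟨ *-congˡ (trans (reflexive (≡.cong ι pq≡de)) (ι-* d e)) ⟨
            θ * ι (p ℕ.* q)  ≈⟨ θpq≈k ⟩
            ι k  ≈⟨ trans (reflexive (≡.cong ι k≡je)) (ι-* j e) ⟩
            ι j * ι e  ≈⟨ *-comm _ _ ⟩
            ι e * ι j  ∎)))

        code : Code
        code = p , q , k

        valid : Valid code
        valid =
          ι-cancel-< (begin-strict
            ι k  ≈⟨ θpq≈k ⟨
            θ * ι (p ℕ.* q)  ≈⟨ *-comm _ _ ⟩
            ι (p ℕ.* q) * θ  <⟨ *-monoˡ-< _ 0<pq (proj₁ (proj₂ isTheta)) ⟩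
            ι (p ℕ.* q) * 1#  ≈⟨ *-identityʳ _ ⟩
            ι (p ℕ.* q)  ∎) ,
          coprime ,
          (not-divides q p p>0 (ℕ.*-comm p q) (proj₂ (proj₂ powers)) , not-divides p q q>0 ≡.refl (proj₁ (proj₂ powers))) ,
          ≤-trans (*-monoʳ-≤ _ (<⇒≤ 0<pq) a≤θ) (≤-reflexive θpq≈k) ,
          ≤-trans (≤-reflexive (sym θpq≈k)) (*-monoʳ-≤ _ (<⇒≤ 0<pq) θ≤b)

        p⊔q≤n : p ℕ.⊔ q ℕ.≤ n
        p⊔q≤n = ℕ.s≤s⁻¹ (ι-cancel-< (≤-<-trans height≤ X<1+n))

        p≤n : p ℕ.≤ n
        p≤n = ℕ.≤-trans (ℕ.m≤m⊔n p q) p⊔q≤n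

        q≤n : q ℕ.≤ n
        q≤n = ℕ.≤-trans (ℕ.m≤n⊔m p q) p⊔q≤n

        code∈ : code ∈ codes n
        code∈ = ∈-filter⁺ valid? (∈-cartesianProduct⁺ (∈-range⁺ p>0 p≤n) (∈-cartesianProduct⁺ (∈-range⁺ q>0 q≤n)
          (∈-downFrom⁺ (ℕ.<-≤-trans (proj₁ valid) (ℕ.*-mono-≤ p≤n q≤n))))) valid

      decode : ∀ {x} → x ∈ codes n → Element
      decode {p , q , k} x∈ =
        let x∈box , valid = ∈-filter⁻ valid? {xs = box n} x∈
            p∈ , qk∈ = ∈-cartesianProduct⁻ (range n) (cartesianProduct (range n) (downFrom (n ℕ.* n))) x∈box
            q∈ , _ = ∈-cartesianProduct⁻ (range n) (downFrom (n ℕ.* n)) qk∈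
            0<p , p≤n = ∈-range⁻ n p∈
            0<q , q≤n = ∈-range⁻ n q∈
        in Decode.element 0<p p≤n 0<q q≤n valid

      -- Encoding a decoded element takes its third component from the existence statement
      -- `power≈1⇒integer`, so it does not compute back to k. The equation θ pq = k identifies the
      -- two.
      decode-θ : ∀ {x} (x∈ : x ∈ codes n) → let p , q , k = x in
        Encode.p (decode x∈) ≡ p × Encode.q (decode x∈) ≡ q × Encode.θ (decode x∈) * ι (p ℕ.* q) ≈ ι k
      decode-θ {p , q , k} x∈ = ≡.refl , ≡.refl ,
        (let x∈box , valid = ∈-filter⁻ valid? {xs = box n} x∈
             p∈ , qk∈ = ∈-cartesianProduct⁻ (range n) (cartesianProduct (range n) (downFrom (n ℕ.* n))) x∈box
             q∈ , _ = ∈-cartesianProduct⁻ (range n) (downFrom (n ℕ.* n)) qk∈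
             0<p , p≤n = ∈-range⁻ n p∈
             0<q , q≤n = ∈-range⁻ n q∈
         in Decode.θpq≈k 0<p p≤n 0<q q≤n valid)

      codes-enumerate : HasCardinality S (length (codes n))
      codes-enumerate = Enumeration.enumerated S (codes-unique n) decode Encode.code Encode.code∈ (λ {y} {z} → code-cong {y} {z}) code-decode decode-code
        where
        code-cong : ∀ {y z} → Setoid._≈_ S y z → Encode.code y ≡ Encode.code z
        code-cong {y} {z} (p≡ , q≡ , α≈) = ≡.cong₂ _,_ p≡ (≡.cong₂ _,_ q≡ (ι-injective (begin-equality
          ι Y.k  ≈⟨ Y.θpq≈k ⟨
          Y.θ * ι (Y.p ℕ.* Y.q)  ≈⟨ *-cong (theta-unique π isPi {Y.α} {Z.α} Y.isTheta Z.isTheta α≈) (reflexive (≡.cong₂ (λ p q → ι (p ℕ.* q)) p≡ q≡)) ⟩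
          Z.θ * ι (Z.p ℕ.* Z.q)  ≈⟨ Z.θpq≈k ⟩
          ι Z.k  ∎)))
          where
          module Y = Encode y
          module Z = Encode z

        code-decode : ∀ {x} (x∈ : x ∈ codes n) → Encode.code (decode x∈) ≡ x
        code-decode {p , q , k} x∈ = ≡.cong (λ k → p , q , k) (ι-injective (trans (sym (Encode.θpq≈k (decode x∈))) (proj₂ (proj₂ (decode-θ x∈)))))

        decode-code : ∀ {x} (x∈ : x ∈ codes n) y → x ≡ Encode.code y → Setoid._≈_ S (decode x∈) y
        decode-code x∈ y ≡.refl = ≡.refl , ≡.refl ,
          cis-unique {ι 2 * π * Y.θ} {E′.α} {Y.α} (cis-cong {ι 2 * π * E′.θ} {ι 2 * π * Y.θ} {E′.α} {E′.α} (*-congˡ θ≈) ℂ.refl (proj₂ (proj₂ E′.isTheta))) (proj₂ (proj₂ Y.isTheta))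
          where
          module Y = Encode y
          module E′ = Encode (decode x∈)
          θ≈ : E′.θ ≈ Y.θ
          θ≈ = *-cancelˡ (pos⇒≉0 Y.0<pq) (trans (*-comm _ _) (trans (trans (proj₂ (proj₂ (decode-θ x∈))) (sym Y.θpq≈k)) (*-comm _ _)))

  -- The asymptotic formula

  n≤2^n : ∀ n → n ℕ.≤ 2 ℕ.^ n
  n≤2^n zero    = ℕ.z≤n
  n≤2^n (suc n) = ℕ.≤-trans (ℕ.+-mono-≤ (ℕ.m^n>0 2 n) (n≤2^n n)) (ℕ.≤-reflexive (≡.cong (2 ℕ.^ n ℕ.+_) (≡.sym (ℕ.+-identityʳ _))))

  -- With B an integer upper bound for e and 2^k ≤ n, the bound n ≤ e^y gives k ≤ B ⌈y⌉.
  harmonic-log : ∃₂ λ K X₀ → 0 ℕ.< X₀ × (∀ X y n → ι X₀ ≤ X → IsExp y X → 0 ℕ.< n → ι n ≤ X → 1# ≤ y × harmonic n ≤ ι K * y)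
  -- X > B forces y ≥ 1, because y < 1 would give X ≤ B. The constant 2B + 1 comes from 1 + k ≤ y +
  -- B(1 + m) ≤ y + 2By with m = ⌊y⌋.
  harmonic-log = suc (2 ℕ.* B) , suc (B ℕ.^ 1) , ℕ.z<s , bounds
    where
    B : ℕ
    B = proj₁ exp-bound
    bound : ∀ X y → IsExp y X → 0# < X → ∀ m → y ≤ ι m → X ≤ ι (B ℕ.^ m)
    bound = proj₂ (proj₂ exp-bound)
    bounds : ∀ X y n → ι (suc (B ℕ.^ 1)) ≤ X → IsExp y X → 0 ℕ.< n → ι n ≤ X → 1# ≤ y × harmonic n ≤ ι (suc (2 ℕ.* B)) * y
    bounds X y n X₀≤X exp[y] 0<n n≤X =
      let m , m≤y , y<1+m = floor y (≤-trans 0≤1 1≤y)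
          k , 2^k≤n , H≤1+k = harmonic-dyadic n 0<n
          -- B ≤ 2^B bounds B^(m + 1) by 2^(B(m + 1)), so that the exponents of 2 can be compared.
          2^k≤ = ℕ.≤-trans (ι-cancel-≤ (≤-trans (ι-mono-≤ 2^k≤n) (≤-trans n≤X (bound X y exp[y] 0<X (suc m) (<⇒≤ y<1+m)))))
                           (ℕ.≤-trans (ℕ.^-monoˡ-≤ (suc m) (n≤2^n B)) (ℕ.≤-reflexive (ℕ.^-*-assoc 2 B (suc m))))
          k≤ = ℕ.≮⇒≥ {B ℕ.* suc m} {k} (λ lt → ℕ.<⇒≱ (ℕ.^-monoʳ-< 2 (ℕ.n<1+n 1) lt) 2^k≤)
      in 1≤y , (begin
        harmonic n  ≤⟨ H≤1+k ⟩
        1# + ι k  ≤⟨ +-mono-≤ 1≤y (ι-mono-≤ k≤) ⟩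
        y + ι (B ℕ.* suc m)  ≈⟨ +-congˡ (ι-* B (suc m)) ⟩
        y + ι B * (1# + ι m)  ≤⟨ +-monoʳ-≤ y (*-monoˡ-≤ (ι B) (0≤ι B) (+-mono-≤ 1≤y m≤y)) ⟩
        y + ι B * (y + y)  ≈⟨ solve 2 (λ b y → y :+ b :* (y :+ y) := (con (+ 1) :+ con (+ 2) :* b) :* y) refl (ι B) y ⟩
        (ι 1 + ι 2 * ι B) * y  ≈⟨ *-congʳ (+-cong ι-1 (sym (ι-* 2 B))) ⟩
        ι (suc (2 ℕ.* B)) * y  ∎)
      where
      0<X : 0# < X
      0<X = <-≤-trans (0<ι-suc (B ℕ.^ 1)) X₀≤X
      1≤y : 1# ≤ y
      1≤y = ≮⇒≥ λ y<1 → <⇒≱ (ι-mono-< (ℕ.n<1+n (B ℕ.^ 1)))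
        (≤-trans X₀≤X (bound X y exp[y] 0<X 1 (≤-trans (<⇒≤ y<1) (≤-reflexive (sym ι-1)))))

  fourth-power-floor : ∀ {N X} → 0# ≤ N → N ≤ X → X ≤ N + 1# → ∣ N ^ 4 - X ^ 4 ∣ ≤ ι 4 * X ^ 3
  fourth-power-floor {N} {X} 0≤N N≤X X≤N+1 = begin
    ∣ N ^ 4 - X ^ 4 ∣  ≈⟨ ∣x-y∣≈∣y-x∣ _ _ ⟩
    ∣ X ^ 4 - N ^ 4 ∣  ≈⟨ nonneg⇒∣x∣≈x (x≤y⇒0≤y-x (^-mono-≤ 4 0≤N N≤X)) ⟩
    X ^ 4 - N ^ 4  ≈⟨ solve 2 (λ x n → x :^ 4 :- n :^ 4 := (x :- n) :* (x :^ 3 :+ x :^ 2 :* n :+ x :* n :^ 2 :+ n :^ 3)) refl X N ⟩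
    (X - N) * (X ^ 3 + X ^ 2 * N + X * N ^ 2 + N ^ 3)
      ≤⟨ *-mono-≤ (x≤y⇒0≤y-x N≤X) (+-nonneg (+-nonneg (+-nonneg (^-nonneg 3 0≤X) (*-nonneg (^-nonneg 2 0≤X) 0≤N)) (*-nonneg 0≤X (^-nonneg 2 0≤N))) (^-nonneg 3 0≤N))
           X-N≤1
           (+-mono-≤ (+-mono-≤ (+-mono-≤ ≤-refl (*-monoˡ-≤ _ (^-nonneg 2 0≤X) N≤X)) (*-monoˡ-≤ X 0≤X (^-mono-≤ 2 0≤N N≤X))) (^-mono-≤ 3 0≤N N≤X)) ⟩
    1# * (X ^ 3 + X ^ 2 * X + X * X ^ 2 + X ^ 3)
      ≈⟨ trans (*-identityˡ _) (solve 1 (λ x → x :^ 3 :+ x :^ 2 :* x :+ x :* x :^ 2 :+ x :^ 3 := con (+ 4) :* x :^ 3) refl X) ⟩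
    ι 4 * X ^ 3  ∎
    where
    0≤X : 0# ≤ X
    0≤X = ≤-trans 0≤N N≤X
    X-N≤1 : X - N ≤ 1#
    X-N≤1 = ≤-trans (+-monoˡ-≤ (- N) X≤N+1) (≤-reflexive (solve 2 (λ n o → n :+ o :- n := o) refl N 1#))

  -- With w = 1/(4ζ), the difference splits into the counting error R - δF, δw times the error of
  -- the coprime sum, and δw times N⁴ - X⁴. Since δw ≤ 1 the last two do not grow. The constants 5
  -- of the counting error and 4 of the rounding of X add up to 9, which is absorbed into X³ y
  -- because y ≥ 1; the coprime sum contributes 24K.
  assemble : ∀ {δ ζ N X F R H K y} → 0# ≤ δ → δ ≤ 1# → 1# ≤ ζ → 0# ≤ N → N ≤ X → X ≤ N + 1# → 1# ≤ y → 0# ≤ K → H ≤ K * y →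
    ∣ R - δ * F ∣ ≤ ι 5 * N ^ 3 → ∣ ι 4 * ζ * F - N ^ 4 ∣ ≤ ι 24 * N ^ 3 * H →
    ∣ R - δ * (ι 4 * ζ) ⁻¹ * X ^ 4 ∣ ≤ (ι 9 + ι 24 * K) * (X ^ 3 * y)
  assemble {δ} {ζ} {N} {X} {F} {R} {H} {K} {y} 0≤δ δ≤1 1≤ζ 0≤N N≤X X≤N+1 1≤y 0≤K H≤Ky count-bound sum-bound = begin
    ∣ R - δ * w * X ^ 4 ∣
      ≈⟨ ∣∣-cong (begin-equality
           R - δ * w * X ^ 4
             ≈⟨ solve 6 (λ r d w x4 f n4 → r :- d :* w :* x4 := (r :- d :* f) :+ d :* (f :- w :* n4) :+ d :* w :* (n4 :- x4)) refl R δ w (X ^ 4) F (N ^ 4) ⟩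
           (R - δ * F) + δ * (F - w * N ^ 4) + δ * w * (N ^ 4 - X ^ 4)
             ≈⟨ +-congʳ (+-congˡ (*-congˡ (+-congʳ (trans (*-congʳ (⁻¹-inverseˡ (pos⇒≉0 0<4ζ))) (*-identityˡ F))))) ⟨
           (R - δ * F) + δ * (w * (ι 4 * ζ) * F - w * N ^ 4) + δ * w * (N ^ 4 - X ^ 4)
             ≈⟨ +-congʳ (+-congˡ (solve 5 (λ d w z f n4 → d :* (w :* z :* f :- w :* n4) := d :* w :* (z :* f :- n4)) refl δ w (ι 4 * ζ) F (N ^ 4))) ⟩
           (R - δ * F) + δ * w * (ι 4 * ζ * F - N ^ 4) + δ * w * (N ^ 4 - X ^ 4)
             ∎) ⟩
    ∣ (R - δ * F) + δ * w * (ι 4 * ζ * F - N ^ 4) + δ * w * (N ^ 4 - X ^ 4) ∣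
      ≤⟨ ≤-trans (∣∣-triangle _ _) (+-mono-≤ (≤-trans (∣∣-triangle _ _) (+-mono-≤ count-bound (damp _))) (damp _)) ⟩
    ι 5 * N ^ 3 + ∣ ι 4 * ζ * F - N ^ 4 ∣ + ∣ N ^ 4 - X ^ 4 ∣
      ≤⟨ +-mono-≤ (+-mono-≤ (*-monoˡ-≤ (ι 5) (0≤ι 5) N³≤X³) sum-bound) (fourth-power-floor 0≤N N≤X X≤N+1) ⟩
    ι 5 * X ^ 3 + ι 24 * N ^ 3 * H + ι 4 * X ^ 3
      ≤⟨ +-monoˡ-≤ _ (+-monoʳ-≤ _ (≤-trans (*-monoˡ-≤ _ (*-nonneg (0≤ι 24) (^-nonneg 3 0≤N)) H≤Ky)
           (*-monoʳ-≤ _ (*-nonneg 0≤K 0≤y) (*-monoˡ-≤ _ (0≤ι 24) N³≤X³)))) ⟩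
    ι 5 * X ^ 3 + ι 24 * X ^ 3 * (K * y) + ι 4 * X ^ 3
      ≤⟨ ≤-by (ι 9 * X ^ 3 * (y - 1#)) (*-nonneg (*-nonneg (0≤ι 9) (^-nonneg 3 (≤-trans 0≤N N≤X))) (x≤y⇒0≤y-x 1≤y))
           (trans (solve 3 (λ c k y → (con (+ 9) :+ con (+ 24) :* k) :* (c :* y)
                    := con (+ 5) :* c :+ con (+ 24) :* c :* (k :* y) :+ con (+ 4) :* c :+ con (+ 9) :* c :* (y :- con (+ 1))) refl (X ^ 3) K y)
             (+-congˡ (*-congˡ (+-congˡ (-‿cong ι-1))))) ⟩
    (ι 9 + ι 24 * K) * (X ^ 3 * y)
      ∎
    where
    w : Carrier
    w = (ι 4 * ζ) ⁻¹
    0≤y : 0# ≤ y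
    0≤y = ≤-trans 0≤1 1≤y
    N³≤X³ : N ^ 3 ≤ X ^ 3
    N³≤X³ = ^-mono-≤ 3 0≤N N≤X
    1≤4ζ : 1# ≤ ι 4 * ζ
    1≤4ζ = begin
      1#  ≈⟨ *-identityˡ 1# ⟨
      1# * 1#  ≤⟨ *-mono-≤ 0≤1 0≤1 (1≤ι {4} (ℕ.s≤s ℕ.z≤n)) 1≤ζ ⟩
      ι 4 * ζ  ∎
    0<4ζ : 0# < ι 4 * ζ
    0<4ζ = <-≤-trans 0<1 1≤4ζ
    0≤w : 0# ≤ w
    0≤w = ⁻¹-nonneg 0<4ζ
    w≤1 : w ≤ 1#
    w≤1 = ≤-trans (⁻¹-anti-≤ 0<1 1≤4ζ) (≤-reflexive 1⁻¹≈1)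
    damp : ∀ x → ∣ δ * w * x ∣ ≤ ∣ x ∣
    damp x = begin
      ∣ δ * w * x ∣  ≈⟨ trans (∣∣-* _ x) (*-congʳ (nonneg⇒∣x∣≈x (*-nonneg 0≤δ 0≤w))) ⟩
      δ * w * ∣ x ∣  ≤⟨ *-monoʳ-≤ _ (∣∣-nonneg x) (*-mono-≤ 0≤δ 0≤w δ≤1 w≤1) ⟩
      1# * 1# * ∣ x ∣  ≈⟨ trans (*-congʳ (*-identityˡ 1#)) (*-identityˡ _) ⟩
      ∣ x ∣  ∎

  -- Heights are integers, so the count depends on X only through n = ⌊X⌋, and the estimates for n
  -- apply. The bound X₀ ≤ X makes n positive.
  root-asymptotics : ∀ π ζ2 → IsPi π → IsZeta2 ζ2 → ∀ a b → 0# ≤ a → a ≤ b → b ≤ 1# →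
    ∃₂ λ C X₀ → ∀ X → X₀ ≤ X → ∀ logX → IsLog X logX →
      ∃ λ N → HasCardinality (Ω₁-between π X a b) N
            × ∣ ι N - (b - a) * (ι 4 * ζ2) ⁻¹ * X ^ 4 ∣ ≤ C * (X ^ 3 * logX)
  root-asymptotics π ζ2 isPi isZeta a b 0≤a a≤b b≤1 =
    let K , X₀ , 0<X₀ , log-bounds = harmonic-log in
    ι 9 + ι 24 * ι K , ι X₀ , λ X X₀≤X logX isLog →
      let n , n≤X , X<1+n = floor X (≤-trans (0≤ι X₀) X₀≤X)
          0<n = ℕ.≤-trans 0<X₀ (ℕ.s≤s⁻¹ (ι-cancel-< (≤-<-trans X₀≤X X<1+n)))
          1≤y , H≤Ky = log-bounds X logX n X₀≤X isLog 0<n n≤X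
      in length (codes n) , codes-enumerate X n n≤X X<1+n ,
         assemble (x≤y⇒0≤y-x a≤b) b-a≤1 (1≤ζ ζ2 isZeta) (0≤ι n) n≤X (≤-trans (<⇒≤ X<1+n) (≤-reflexive (+-comm 1# (ι n)))) 1≤y (0≤ι K) H≤Ky
           (length-codes-bound n 0<n) (coprimeSum-asymptotic n ζ2 isZeta 0<n)
    where
    open RootEnumeration π a b isPi 0≤a a≤b b≤1
    b-a≤1 : b - a ≤ 1#
    b-a≤1 = ≤-trans (≤-by a 0≤a (solve 2 (λ a b → b := b :- a :+ a) refl a b)) b≤1

theorem1 : ∀ {c ℓ₁ ℓ₂} (ℝ : RealField c ℓ₁ ℓ₂) → let open Analysis ℝ in
    ∀ π ζ2 → IsPi π → IsZeta2 ζ2 →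
    ∀ a b → 0# ≤ a → a ≤ b → b ≤ 1# →
    ∃₂ λ C X₀ → ∀ X → X₀ ≤ X → ∀ logX → IsLog X logX →
    ∃ λ N → HasCardinality (Ω₁-between π X a b) N
    × ∣ ι N - (b - a) * (ι 4 * ζ2) ⁻¹ * X ^ 4 ∣ ≤ C * (X ^ 3 * logX)
theorem1 = RootAsymptotics.root-asymptotics
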